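{- Let $q$ be a prime power and let $g,n$ be positive integers with $g\mid q^2+q+1$. If $$n\le q+1-\left\lfloor \frac{g}{2}\right\rfloor,\qquad n=ag+r,\qquad 0\le r<g,$$ with $a,r$ integers, then $$G(g,n)\le \frac{q^2+q+1}{g}-\left\lceil \frac{\frac{q^2+q+1}{g}+\frac{g a(a-1)}2+ra}{n}\right\rceil.$$
   Context: A finite set $\mathcal{G}\subset\mathbb{Z}$ is a $g$-Golomb ruler if for every positive integer $d$ the number of pairs $(a,c)\in \mathcal{G}^2$ with $c-a=d$ is at most $g$. $G(g,n)$ denotes the minimum possible diameter (largest element minus smallest element) of a $g$-Golomb ruler with exactly $n$ elements (marks). -}

module Defs where

open import Data.Nat as ℕ using (ℕ; zero; suc; NonZero; z≤n; s≤s)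
import Data.Nat.Properties as ℕ
open import Data.Nat.Primality using (Prime)
open import Data.Integer as ℤ using (ℤ; +_; 0ℤ; _-_; +≤+)
import Data.Integer.Properties as ℤ
open import Algebra.Bundles using (module AbelianGroup)
open import Algebra.Properties.Group (AbelianGroup.group ℤ.+-0-abelianGroup) using (∙-cancelʳ)
open import Data.Integer.Tactic.RingSolver using (solve-∀)
open import Data.List using (List; []; _∷_; length; map; filter; cartesianProduct; upTo; _++_)
open import Data.List.Properties using (length-map; map-++; filter-none)
open import Data.List.Membership.Propositional using (_∈_; find; lose)
open import Data.List.Membership.Propositional.Properties
  using (∈-map⁺; ∈-upTo⁺; ∈-cartesianProduct⁻; ∈-filter⁻)
open import Data.List.Relation.Unary.All as All using (All; []; _∷_)
import Data.List.Relation.Unary.All.Properties as All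
open import Data.List.Relation.Unary.AllPairs using ([]; _∷_)
open import Data.List.Relation.Unary.Any using (Any; any?; here; there)
open import Data.List.Relation.Unary.Unique.Propositional using (Unique)
import Data.List.Relation.Unary.Unique.Propositional.Properties as Unique
open import Data.List.Relation.Unary.Unique.DecPropositional ℤ._≟_ using (unique?)
open import Data.Product using (∃; ∃₂; ∃-syntax; _×_; _,_; proj₁; proj₂)
open import Data.Empty using (⊥-elim)
open import Function using (_∘_)
open import Relation.Nullary using (Dec; yes; no)
open import Relation.Nullary.Decidable using (_×-dec_; _→-dec_; map′)
open import Relation.Unary using (Decidable)
open import Relation.Binary.PropositionalEquality
  using (_≡_; _≢_; refl; sym; trans; cong; cong₂; subst)

PrimePower : ℕ → Set
PrimePower q = ∃₂ λ p k → Prime p × 1 ℕ.≤ k × q ≡ p ℕ.^ k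

-- Finite subsets of ℤ are represented by duplicate-free lists.

differenceCount : List ℤ → ℤ → ℕ
differenceCount xs d =
  length (filter (λ (a , c) → c - a ℤ.≟ d) (cartesianProduct xs xs))

record IsGolombRuler (g : ℕ) (xs : List ℤ) : Set where
  constructor mkGolomb
  field
    distinct : Unique xs
    bounded  : ∀ d → 0ℤ ℤ.< d → differenceCount xs d ℕ.≤ g

IsMinimum IsMaximum : List ℤ → ℤ → Set
IsMinimum xs m = m ∈ xs × All (m ℤ.≤_) xs
IsMaximum xs m = m ∈ xs × All (ℤ._≤ m) xs

HasDiameter : List ℤ → ℕ → Set
HasDiameter xs δ = ∃₂ λ lo hi → IsMinimum xs lo × IsMaximum xs hi × hi - lo ≡ + δ

HasRuler : ℕ → ℕ → ℕ → Set
HasRuler g n δ = ∃[ xs ] length xs ≡ n × IsGolombRuler g xs × HasDiameter xs δ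

IsLeast : (ℕ → Set) → ℕ → Set
IsLeast P m = P m × (∀ k → P k → m ℕ.≤ k)

private

  module Translate (t : ℤ) where

    shift : ℤ → ℤ
    shift x = x - t

    shift-diff : ∀ a c → shift c - shift a ≡ c - a
    shift-diff a c = lemma a c t
      where
      lemma : ∀ a c t → (c - t) - (a - t) ≡ c - a
      lemma = solve-∀

    shift-injective : ∀ {x y} → shift x ≡ shift y → x ≡ y
    shift-injective {x} {y} = ∙-cancelʳ (ℤ.- t) x y

    shift-≤ : ∀ {x y} → x ℤ.≤ y → shift x ℤ.≤ shift y
    shift-≤ = ℤ.+-monoˡ-≤ (ℤ.- t)

  length-filter-map : ∀ {A B : Set} (f : A → B) {P : B → Set} {Q : A → Set}
    (P? : Decidable P) (Q? : Decidable Q) →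
    (∀ {x} → P (f x) → Q x) → (∀ {x} → Q x → P (f x)) →
    ∀ xs → length (filter P? (map f xs)) ≡ length (filter Q? xs)
  length-filter-map f P? Q? to from [] = refl
  length-filter-map f P? Q? to from (x ∷ xs) with P? (f x) | Q? x
  ... | yes _ | yes _ = cong suc (length-filter-map f P? Q? to from xs)
  ... | no _  | no _  = length-filter-map f P? Q? to from xs
  ... | yes p | no ¬q = ⊥-elim (¬q (to p))
  ... | no ¬p | yes q = ⊥-elim (¬p (from q))

  cartesianProduct-map : ∀ {A B : Set} (f : A → B) xs ys →
    cartesianProduct (map f xs) (map f ys) ≡
    map (λ (a , c) → f a , f c) (cartesianProduct xs ys)
  cartesianProduct-map f [] ys = refl
  cartesianProduct-map f (x ∷ xs) ys =
    trans (cong₂ _++_ (row ys) (cartesianProduct-map f xs ys))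
          (sym (map-++ _ (map (x ,_) ys) _))
    where
    row : ∀ ys → map (f x ,_) (map f ys) ≡ map (λ (a , c) → f a , f c) (map (x ,_) ys)
    row []       = refl
    row (y ∷ ys) = cong (_ ∷_) (row ys)

  module _ (t : ℤ) where
    open Translate t

    differenceCount-shift : ∀ xs d →
      differenceCount (map shift xs) d ≡ differenceCount xs d
    differenceCount-shift xs d =
      trans (cong (length ∘ filter (λ (a , c) → c - a ℤ.≟ d)) (cartesianProduct-map shift xs xs))
            (length-filter-map _ _ _
              (λ {(a , c)} → trans (sym (shift-diff a c)))
              (λ {(a , c)} → trans (shift-diff a c))
              (cartesianProduct xs xs))

    shift-golomb : ∀ {g xs} → IsGolombRuler g xs → IsGolombRuler g (map shift xs)
    shift-golomb {g} {xs} (mkGolomb u b) =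
      mkGolomb (Unique.map⁺ shift-injective u)
               (λ d 0<d → subst (ℕ._≤ g) (sym (differenceCount-shift xs d)) (b d 0<d))

    shift-diameter : ∀ {xs δ} → HasDiameter xs δ → HasDiameter (map shift xs) δ
    shift-diameter (lo , hi , (lo∈ , lo≤) , (hi∈ , ≤hi) , eq) =
      shift lo , shift hi ,
      (∈-map⁺ shift lo∈ , All.map⁺ (All.map shift-≤ lo≤)) ,
      (∈-map⁺ shift hi∈ , All.map⁺ (All.map shift-≤ ≤hi)) ,
      trans (shift-diff lo hi) eq

  range : ℕ → List ℤ
  range δ = map +_ (upTo (suc δ))

  ∈-range : ∀ {δ x} → 0ℤ ℤ.≤ x → x ℤ.≤ + δ → x ∈ range δ
  ∈-range (+≤+ _) (+≤+ k≤δ) = ∈-map⁺ +_ (∈-upTo⁺ (s≤s k≤δ))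

  anyList? : ∀ {A : Set} (R : List A) n {Q : List A → Set} → Decidable Q →
    Dec (∃[ xs ] length xs ≡ n × All (_∈ R) xs × Q xs)
  anyList? R zero Q? =
    map′ (λ q → [] , refl , [] , q) (λ { ([] , _ , _ , q) → q }) (Q? [])
  anyList? {A} R (suc n) {Q} Q? =
    map′ (λ a → let (x , x∈ , xs , l , xs⊆ , q) = find {P = Tail} a
                in x ∷ xs , cong suc l , x∈ ∷ xs⊆ , q)
         (λ { (x ∷ xs , l , x∈ ∷ xs⊆ , q) →
                lose {P = Tail} x∈ (xs , ℕ.suc-injective l , xs⊆ , q) })
         (any? (λ x → anyList? R n (Q? ∘ (x ∷_))) R)
    where
    Tail : A → Set
    Tail x = ∃[ xs ] length xs ≡ n × All (_∈ R) xs × Q (x ∷ xs)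

  golomb? : ∀ g → Decidable (IsGolombRuler g)
  golomb? g xs =
    map′ (λ (u , b) → mkGolomb u (to b))
         (λ (mkGolomb u b) → u , All.universal (λ (a , c) → b (c - a)) pairs)
         (unique? xs ×-dec
          All.all? (λ (a , c) → (0ℤ ℤ.<? c - a) →-dec (differenceCount xs (c - a) ℕ.≤? g)) pairs)
    where
    pairs = cartesianProduct xs xs
    to : All (λ (a , c) → 0ℤ ℤ.< c - a → differenceCount xs (c - a) ℕ.≤ g) pairs →
         ∀ d → 0ℤ ℤ.< d → differenceCount xs d ℕ.≤ g
    to b d 0<d with any? (λ (a , c) → c - a ℤ.≟ d) pairs
    ... | yes p with find p
    ...   | _ , p∈ , refl = All.lookup b p∈ 0<d
    to b d 0<d | no ¬p =
      subst (ℕ._≤ g) (sym (cong length (filter-none _ (All.¬Any⇒All¬ _ ¬p)))) z≤n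

  diameter? : ∀ δ → Decidable (λ xs → HasDiameter xs δ)
  diameter? δ xs =
    map′ (λ p → let (lo , lo∈ , lo≤ , q) = find {P = Low} p
                    (hi , hi∈ , ≤hi , eq) = find {P = High lo} q
                in lo , hi , (lo∈ , lo≤) , (hi∈ , ≤hi) , eq)
         (λ (lo , hi , (lo∈ , lo≤) , (hi∈ , ≤hi) , eq) →
            lose {P = Low} lo∈ (lo≤ , lose {P = High lo} hi∈ (≤hi , eq)))
         (any? (λ lo → All.all? (lo ℤ.≤?_) xs ×-dec
            any? (λ hi → All.all? (ℤ._≤? hi) xs ×-dec (hi - lo ℤ.≟ + δ)) xs) xs)
    where
    High : ℤ → ℤ → Set
    High lo hi = All (ℤ._≤ hi) xs × hi - lo ≡ + δ
    Low : ℤ → Set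
    Low lo = All (lo ℤ.≤_) xs × Any (High lo) xs

  hasRuler? : ∀ g n → Decidable (HasRuler g n)
  hasRuler? g n δ =
    map′ (λ (xs , l , _ , r) → xs , l , r) normalise
         (anyList? (range δ) n (λ xs → golomb? g xs ×-dec diameter? δ xs))
    where
    normalise : HasRuler g n δ →
      ∃[ xs ] length xs ≡ n × All (_∈ range δ) xs × IsGolombRuler g xs × HasDiameter xs δ
    normalise (xs , l , gol , dia@(lo , hi , (_ , lo≤) , (_ , ≤hi) , eq)) =
      map shift xs , trans (length-map shift xs) l ,
      All.map⁺ (All.map (λ (lo≤x , x≤hi) →
        ∈-range (ℤ.i≤j⇒0≤j-i lo≤x) (subst (_ ℤ.≤_) eq (shift-≤ x≤hi)))
        (All.zip (lo≤ , ≤hi))) ,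
      shift-golomb lo gol , shift-diameter lo dia
      where open Translate lo

  -- Each new mark exceeds twice the previous largest one, so `marks n` is a
  -- 1-Golomb ruler; hence G is defined for all positive g and n.

  top : ℕ → ℕ
  top zero    = 0
  top (suc n) = suc (top n ℕ.+ top n)

  marks : ℕ → List ℕ
  marks zero    = []
  marks (suc n) = top (suc n) ∷ marks n

  marks≤top : ∀ n → All (ℕ._≤ top n) (marks n)
  marks≤top zero    = []
  marks≤top (suc n) =
    ℕ.≤-refl ∷ All.map (λ x≤ → ℕ.m≤n⇒m≤1+n (ℕ.m≤n⇒m≤n+o _ x≤)) (marks≤top n)

  1≤marks : ∀ n → All (1 ℕ.≤_) (marks n)
  1≤marks zero    = []
  1≤marks (suc n) = s≤s z≤n ∷ 1≤marks n

  1∈marks : ∀ n → 1 ∈ marks (suc n)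
  1∈marks zero    = here refl
  1∈marks (suc n) = there (1∈marks n)

  length-marks : ∀ n → length (marks n) ≡ n
  length-marks zero    = refl
  length-marks (suc n) = cong suc (length-marks n)

  top<top : ∀ n → top n ℕ.< top (suc n)
  top<top n = s≤s (ℕ.m≤m+n _ _)

  unique-marks : ∀ n → Unique (marks n)
  unique-marks zero    = []
  unique-marks (suc n) =
    All.map (λ x≤ eq → ℕ.<⇒≢ (ℕ.≤-<-trans x≤ (top<top n)) (sym eq)) (marks≤top n)
    ∷ unique-marks n

  too-far : ∀ n {a c a′} → a ∈ marks n → c ∈ marks n → top (suc n) ℕ.+ a′ ≢ c ℕ.+ a
  too-far n {a} {c} {a′} a∈ c∈ eq = ℕ.<-irrefl refl (begin-strict
    c ℕ.+ a             ≤⟨ ℕ.+-mono-≤ (All.lookup (marks≤top n) c∈) (All.lookup (marks≤top n) a∈) ⟩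
    top n ℕ.+ top n     <⟨ ℕ.n<1+n _ ⟩
    top (suc n)         ≤⟨ ℕ.m≤m+n _ a′ ⟩
    top (suc n) ℕ.+ a′  ≡⟨ eq ⟩
    c ℕ.+ a             ∎)
    where open ℕ.≤-Reasoning

  sidon : ∀ n {a c a′ c′} → a ∈ marks n → c ∈ marks n → a′ ∈ marks n → c′ ∈ marks n →
    a ℕ.< c → a′ ℕ.< c′ → c ℕ.+ a′ ≡ c′ ℕ.+ a → a ≡ a′ × c ≡ c′
  sidon (suc n) (here refl) c∈ a′∈ c′∈ a<c a′<c′ eq =
    ⊥-elim (ℕ.<⇒≱ a<c (All.lookup (marks≤top (suc n)) c∈))
  sidon (suc n) (there a∈) c∈ (here refl) c′∈ a<c a′<c′ eq =
    ⊥-elim (ℕ.<⇒≱ a′<c′ (All.lookup (marks≤top (suc n)) c′∈))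
  sidon (suc n) (there a∈) (here refl) (there a′∈) (here refl) a<c a′<c′ eq =
    sym (ℕ.+-cancelˡ-≡ (top (suc n)) _ _ eq) , refl
  sidon (suc n) (there a∈) (here refl) (there a′∈) (there c′∈) a<c a′<c′ eq =
    ⊥-elim (too-far n a∈ c′∈ eq)
  sidon (suc n) (there a∈) (there c∈) (there a′∈) (here refl) a<c a′<c′ eq =
    ⊥-elim (too-far n a′∈ c∈ (sym eq))
  sidon (suc n) (there a∈) (there c∈) (there a′∈) (there c′∈) a<c a′<c′ eq =
    sidon n a∈ c∈ a′∈ c′∈ a<c a′<c′ eq

  length≤1 : ∀ {A : Set} {xs : List A} → Unique xs →
    (∀ {x y} → x ∈ xs → y ∈ xs → x ≡ y) → length xs ℕ.≤ 1
  length≤1 {xs = []}         u same = z≤n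
  length≤1 {xs = x ∷ []}     u same = s≤s z≤n
  length≤1 {xs = x ∷ y ∷ xs} ((x≢y ∷ _) ∷ _) same =
    ⊥-elim (x≢y (same (here refl) (there (here refl))))

  cross : ∀ {a c a′ c′} → + c - + a ≡ + c′ - + a′ → c ℕ.+ a′ ≡ c′ ℕ.+ a
  cross {a} {c} {a′} {c′} eq =
    ℤ.+-injective (trans (move (+ c) (+ a) (+ a′))
      (trans (cong (ℤ._+ (+ a ℤ.+ + a′)) eq) (back (+ c′) (+ a) (+ a′))))
    where
    move : ∀ c a a′ → c ℤ.+ a′ ≡ (c - a) ℤ.+ (a ℤ.+ a′)
    move = solve-∀
    back : ∀ c′ a a′ → (c′ - a′) ℤ.+ (a ℤ.+ a′) ≡ c′ ℤ.+ a
    back = solve-∀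

  positive : ∀ {a c d} → 0ℤ ℤ.< d → + c - + a ≡ d → a ℕ.< c
  positive 0<d refl = ℕ.≰⇒> λ c≤a → ℤ.<⇒≱ 0<d (ℤ.i≤j⇒i-j≤0 (+≤+ c≤a))

  marks-golomb : ∀ n → IsGolombRuler 1 (map +_ (marks n))
  marks-golomb n = mkGolomb (Unique.map⁺ ℤ.+-injective (unique-marks n)) bound
    where
    bound : ∀ d → 0ℤ ℤ.< d → differenceCount (map +_ (marks n)) d ℕ.≤ 1
    bound d 0<d = subst (ℕ._≤ 1) (sym count-eq)
      (length≤1 (Unique.filter⁺ P? (Unique.cartesianProduct⁺ (unique-marks n) (unique-marks n))) same)
      where
      P? : Decidable {A = ℕ × ℕ} (λ (a , c) → + c - + a ≡ d)
      P? (a , c) = + c - + a ℤ.≟ d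
      pairs = cartesianProduct (marks n) (marks n)
      count-eq : differenceCount (map +_ (marks n)) d ≡ length (filter P? pairs)
      count-eq = trans
        (cong (length ∘ filter (λ (a , c) → c - a ℤ.≟ d)) (cartesianProduct-map +_ (marks n) (marks n)))
        (length-filter-map _ _ P? (λ p → p) (λ p → p) pairs)
      same : ∀ {x y} → x ∈ filter P? pairs → y ∈ filter P? pairs → x ≡ y
      same {x} {y} x∈ y∈ =
        let (x∈′ , xd) = ∈-filter⁻ P? {xs = pairs} x∈
            (y∈′ , yd) = ∈-filter⁻ P? {xs = pairs} y∈
            (a∈ , c∈)   = ∈-cartesianProduct⁻ (marks n) (marks n) x∈′
            (a′∈ , c′∈) = ∈-cartesianProduct⁻ (marks n) (marks n) y∈′
            (a≡ , c≡)   = sidon n a∈ c∈ a′∈ c′∈ (positive 0<d xd) (positive 0<d yd)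
                            (cross {proj₁ x} {proj₂ x} {proj₁ y} {proj₂ y} (trans xd (sym yd)))
        in cong₂ _,_ a≡ c≡

  hasRuler : ∀ g n .{{_ : NonZero g}} .{{_ : NonZero n}} → ∃ (HasRuler g n)
  hasRuler (suc g) (suc n) =
    top n ℕ.+ top n , map +_ (marks (suc n)) ,
    trans (length-map +_ (marks (suc n))) (length-marks (suc n)) ,
    mkGolomb (IsGolombRuler.distinct gol)
      (λ d 0<d → ℕ.≤-trans (IsGolombRuler.bounded gol d 0<d) (s≤s z≤n)) ,
    + 1 , + top (suc n) ,
    (∈-map⁺ +_ (1∈marks n) , All.map⁺ (All.map +≤+ (1≤marks (suc n)))) ,
    (here refl , All.map⁺ (All.map +≤+ (marks≤top (suc n)))) ,
    refl
    where gol = marks-golomb (suc n)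

  least : ∀ {P : ℕ → Set} → Decidable P → ∃ P → ∃ (IsLeast P)
  least {P} P? (m , Pm) = search m 0 (subst P (sym (ℕ.+-identityʳ m)) Pm) (λ _ _ → z≤n)
    where
    search : ∀ fuel k → P (fuel ℕ.+ k) → (∀ j → P j → k ℕ.≤ j) → ∃ (IsLeast P)
    search zero k p below = k , p , below
    search (suc fuel) k p below with P? k
    ... | yes q = k , q , below
    ... | no ¬q = search fuel (suc k) (subst P (sym (ℕ.+-suc fuel k)) p)
            (λ j Pj → ℕ.≤∧≢⇒< (below j Pj) (λ { refl → ¬q Pj }))

  minimalRuler : ∀ g n .{{_ : NonZero g}} .{{_ : NonZero n}} → ∃ (IsLeast (HasRuler g n))
  minimalRuler g n = least (hasRuler? g n) (hasRuler g n)

G : ∀ g n .{{_ : NonZero g}} .{{_ : NonZero n}} → ℕ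
G g n = proj₁ (minimalRuler g n)

G-isLeast : ∀ g n .{{_ : NonZero g}} .{{_ : NonZero n}} → IsLeast (HasRuler g n) (G g n)
G-isLeast g n = proj₂ (minimalRuler g n)

-- Singer's difference set, in Bose's form: if ω generates the multiplicative group of a field with q³
-- elements and F is the subfield with q elements, then the logarithms modulo v = q² + q + 1 of 1 and of
-- ω + a (a ∈ F) form a Sidon set modulo v, because 1, ω, ω² are independent over F and a product of two
-- linear forms determines its factors.  Modulo m = v/g every nonzero difference then occurs at most g
-- times, and at most (g − 1)/2 marks are lost to coincidences.  Cutting n of these residues at a largest
-- cyclic gap L gives a ruler of diameter m − L.  Each gap length occurs at most g times and the gaps add
-- up to m, so the n numbers L − (gap) have sum n L − m ≥ g a(a−1)/2 + r a.
--
-- For the field, put Q = q³ = p^K and N = Q − 1, and let 𝔽_p[X] act on N-periodic sequences over 𝔽_p by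
-- shifts.  Since X^Q acts as X, Frobenius gives P^Q = P for every P, so each P^N is idempotent.  Start from
-- a sequence t that is a nonzero multiple of X^(N/ℓ) − 1 for every prime ℓ dividing N and replace it by
-- P^N t whenever this is nonzero: after finitely many P, the polynomials modulo the annihilator of t
-- form a field in which X has order exactly N.

module Submission where

open import Defs
open import Data.Nat as ℕ using (ℕ; NonZero; zero; suc; z≤n; s≤s)
open import Data.Nat.Divisibility using (_∣_)
open import Data.Integer as ℤ using (ℤ; +_)
open import Data.Rational as ℚ using (ℚ; ceiling)
open import Relation.Binary.PropositionalEquality as ≡ using (_≡_)
open import Level using (0ℓ)
open import Algebra.Bundles using (CommutativeRing)
import Data.Nat.Properties as ℕ
import Data.Nat.DivMod as ℕ
import Data.Nat.Tactic.RingSolver as ℕ-Solver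
import Data.Integer.Properties as ℤ
open import Data.Integer.Tactic.RingSolver using (solve-∀)
open import Data.List.Relation.Unary.All as All using (All; []; _∷_)
import Data.List.Relation.Unary.All.Properties as All
import Data.List.Relation.Unary.AllPairs.Properties as AllPairs
import Data.List.Relation.Unary.Unique.Propositional.Properties as Unique
open import Data.List.Membership.Propositional using (_∈_; find; lose)
open import Data.Product using (_×_; _,_; ∃; ∃₂; proj₁; proj₂)
open import Data.Sum using (_⊎_; inj₁; inj₂)
open import Data.Empty using (⊥; ⊥-elim)
open import Relation.Nullary using (¬_; Dec; yes; no)

-- The usual order is reversed: instead of finding a generator in a given field, the order of X is
-- secured first. Refining t only multiplies it by polynomials, so the factors X^(N/ℓ) - 1 put into
-- the initial sequence survive to the end. Since P^Q = P with Q ≥ 2 excludes nilpotents, a factor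
-- X^c - 1 of a nonzero t cannot act on t as zero, and this gives X its exact order. No irreducible
-- polynomial has to be found and the size of the field is never counted: logarithms exist because
-- every nonzero x is a root of Y^N - 1, which the N powers of X already exhaust. The constants g
-- and (g - 1)/2 come from lifting residues. A residue modulo m has g lifts modulo v = g m; for the
-- residue 0 the lift 0 is excluded, which leaves g - 1. A collision of two marks uses two of these,
-- one for each order of the pair.

-- Binomial coefficients modulo a prime and the Frobenius map.

module Frobenius where

  import Data.Nat.Divisibility as ℕ∣
  open import Data.Nat.Primality using (Prime; euclidsLemma; ¬prime[0])
  open import Data.Nat.Combinatorics using (_C_; nC1≡n; nCn≡1; nCk+nC[k+1]≡[n+1]C[k+1])
  open import Data.Fin as Fin using (Fin; toℕ; fromℕ; inject₁)
  import Data.Fin.Properties as Fin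
  open import Relation.Binary.PropositionalEquality as ≡ using (_≡_; cong; cong₂; module ≡-Reasoning)

  C-absorption : ∀ n k → suc k ℕ.* (suc n C suc k) ≡ suc n ℕ.* (n C k)
  C-absorption zero zero = ≡.refl
  C-absorption zero (suc k) = ℕ.*-zeroʳ k
  C-absorption (suc n) zero = ≡.trans (ℕ.*-identityˡ _) (≡.trans (nC1≡n (suc (suc n))) (≡.sym (ℕ.*-identityʳ _)))
  C-absorption (suc n) (suc k) = begin
    suc (suc k) ℕ.* (suc (suc n) C suc (suc k))
      ≡⟨ cong (suc (suc k) ℕ.*_) (nCk+nC[k+1]≡[n+1]C[k+1] (suc n) (suc k)) ⟨
    suc (suc k) ℕ.* (a ℕ.+ (suc n C suc (suc k)))
      ≡⟨ expand (suc k) a _ ⟩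
    a ℕ.+ (suc k ℕ.* a ℕ.+ suc (suc k) ℕ.* (suc n C suc (suc k)))
      ≡⟨ cong (a ℕ.+_) (cong₂ ℕ._+_ (C-absorption n k) (C-absorption n (suc k))) ⟩
    a ℕ.+ (suc n ℕ.* (n C k) ℕ.+ suc n ℕ.* (n C suc k))
      ≡⟨ cong (a ℕ.+_) (ℕ.*-distribˡ-+ (suc n) (n C k) (n C suc k)) ⟨
    a ℕ.+ suc n ℕ.* ((n C k) ℕ.+ (n C suc k))
      ≡⟨ cong (λ b → a ℕ.+ suc n ℕ.* b) (nCk+nC[k+1]≡[n+1]C[k+1] n k) ⟩
    suc (suc n) ℕ.* a ∎
    where
    open ≡-Reasoning
    a = suc n C suc k
    expand : ∀ k a b → suc k ℕ.* (a ℕ.+ b) ≡ a ℕ.+ (k ℕ.* a ℕ.+ suc k ℕ.* b)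
    expand = ℕ-Solver.solve-∀

  -- Absorption makes `suc k` times the coefficient a multiple of the prime; `suc k` is too small to
  -- be divisible by it, so Euclid's lemma leaves the coefficient.
  prime∣C : ∀ {n k} → Prime (suc n) → k ℕ.< n → suc n ℕ∣.∣ (suc n C suc k)
  prime∣C {n} {k} pr k<n with euclidsLemma (suc k) (suc n C suc k) pr
    (ℕ∣.divides (n C k) (≡.trans (C-absorption n k) (ℕ.*-comm (suc n) (n C k))))
  ... | inj₂ d = d
  ... | inj₁ d = ⊥-elim (ℕ.<⇒≱ k<n (ℕ.≤-pred (ℕ∣.∣⇒≤ d)))

  module Powers {c ℓ} (R : CommutativeRing c ℓ) where
    open CommutativeRing R
    open import Algebra.Properties.CommutativeSemiring.Exp commutativeSemiring
    open import Relation.Binary.Reasoning.Setoid setoid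

    1^≈1 : ∀ n → 1# ^ n ≈ 1#
    1^≈1 zero    = refl
    1^≈1 (suc n) = trans (*-identityˡ _) (1^≈1 n)

    ^*≈1 : ∀ x a k → x ^ a ≈ 1# → x ^ (k ℕ.* a) ≈ 1#
    ^*≈1 x a k x^a≈1 = begin
      x ^ (k ℕ.* a)   ≡⟨ cong (x ^_) (ℕ.*-comm k a) ⟩
      x ^ (a ℕ.* k)   ≈⟨ ^-assocʳ x a k ⟨
      (x ^ a) ^ k     ≈⟨ ^-congˡ k x^a≈1 ⟩
      1# ^ k          ≈⟨ 1^≈1 k ⟩
      1#              ∎

  module FrobeniusMap {c ℓ} (R : CommutativeRing c ℓ) where
    open CommutativeRing R
    open import Algebra.Properties.Semiring.Mult semiring
      using (×-assocˡ; ×-congʳ; ×-assoc-*) renaming (_×_ to _·_)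
    open import Algebra.Properties.CommutativeSemiring.Exp commutativeSemiring
    open import Algebra.Properties.CommutativeSemiring.Binomial commutativeSemiring
    open import Algebra.Properties.Semiring.Sum semiring
    open import Relation.Binary.Reasoning.Setoid setoid

    module _ {p : ℕ} (p×1≈0 : p · 1# ≈ 0#) where

      multiple≈0 : ∀ {n} x → p ℕ∣.∣ n → n · x ≈ 0#
      multiple≈0 x (ℕ∣.divides k ≡.refl) = begin
        (k ℕ.* p) · x        ≈⟨ ×-assocˡ x k p ⟨
        k · (p · x)          ≈⟨ ×-congʳ k (×-congʳ p (*-identityˡ x)) ⟨
        k · (p · (1# * x))   ≈⟨ ×-congʳ k (×-assoc-* p 1# x) ⟨
        k · ((p · 1#) * x)   ≈⟨ ×-congʳ k (trans (*-congʳ p×1≈0) (zeroˡ x)) ⟩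
        k · 0#               ≈⟨ sum-replicate k ⟨
        sum {k} (λ _ → 0#)   ≈⟨ sum-replicate-zero k ⟩
        0#                   ∎

    frobenius : ∀ p → Prime p → p · 1# ≈ 0# → ∀ x y → (x + y) ^ p ≈ x ^ p + y ^ p
    frobenius zero    pr _ x y = ⊥-elim (¬prime[0] pr)
    frobenius (suc n) pr p×1≈0 x y = begin
      (x + y) ^ p                             ≈⟨ theorem p x y ⟩
      term Fin.zero + sum (λ i → term (Fin.suc i))
        ≈⟨ +-cong first (sum-init-last (λ i → term (Fin.suc i))) ⟩
      y ^ p + (sum (λ i → term (Fin.suc (inject₁ i))) + term (fromℕ p))
        ≈⟨ +-congˡ (+-cong (trans (sum-cong-≋ middle) (sum-replicate-zero n)) last) ⟩
      y ^ p + (0# + x ^ p)                    ≈⟨ +-congˡ (+-identityˡ _) ⟩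
      y ^ p + x ^ p                           ≈⟨ +-comm _ _ ⟩
      x ^ p + y ^ p                           ∎
      where
      p = suc n
      term = binomialTerm x y p
      first : term Fin.zero ≈ y ^ p
      first = trans (+-identityʳ _) (*-identityˡ _)
      middle : ∀ i → term (Fin.suc (inject₁ i)) ≈ 0#
      middle i = multiple≈0 p×1≈0 _ (prime∣C pr (≡.subst (ℕ._< n) (≡.sym (Fin.toℕ-inject₁ i)) (Fin.toℕ<n i)))
      last : term (fromℕ p) ≈ x ^ p
      last = begin
        (p C toℕ (fromℕ p)) · (x ^ toℕ (fromℕ p) * y ^ (p ℕ.∸ toℕ (fromℕ p)))
          ≡⟨ cong (λ k → (p C k) · (x ^ k * y ^ (p ℕ.∸ k))) (Fin.toℕ-fromℕ p) ⟩
        (p C p) · (x ^ p * y ^ (p ℕ.∸ p))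
          ≡⟨ cong₂ (λ k l → k · (x ^ p * y ^ l)) (nCn≡1 p) (ℕ.n∸n≡0 p) ⟩
        1 · (x ^ p * 1#)  ≈⟨ +-identityʳ _ ⟩
        x ^ p * 1#        ≈⟨ *-identityʳ _ ⟩
        x ^ p             ∎

    frobenius^ : ∀ {p} → Prime p → p · 1# ≈ 0# →
      ∀ k x y → (x + y) ^ (p ℕ.^ k) ≈ x ^ (p ℕ.^ k) + y ^ (p ℕ.^ k)
    frobenius^ pr p×1≈0 zero x y = trans (*-identityʳ _) (+-cong (sym (*-identityʳ x)) (sym (*-identityʳ y)))
    frobenius^ {p} pr p×1≈0 (suc k) x y = begin
      (x + y) ^ (p ℕ.* q)                  ≈⟨ ^-assocʳ (x + y) p q ⟨
      ((x + y) ^ p) ^ q                    ≈⟨ ^-congˡ q (frobenius p pr p×1≈0 x y) ⟩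
      (x ^ p + y ^ p) ^ q                  ≈⟨ frobenius^ pr p×1≈0 k (x ^ p) (y ^ p) ⟩
      (x ^ p) ^ q + (y ^ p) ^ q            ≈⟨ +-cong (^-assocʳ x p q) (^-assocʳ y p q) ⟩
      x ^ (p ℕ.* q) + y ^ (p ℕ.* q)        ∎
      where q = p ℕ.^ k

-- Roots of polynomials over an integral domain.

module Roots where

  open import Data.List using (List; []; _∷_; length; replicate; _++_)
  open import Data.List.Relation.Unary.AllPairs using (AllPairs; []; _∷_)
  open import Relation.Binary.PropositionalEquality as ≡ using (_≡_; cong)

  -- Integrality as a disjunction, so that each use yields a case distinction rather than a
  -- refutation.
  Cancellative : CommutativeRing 0ℓ 0ℓ → Set
  Cancellative R = ∀ x y z → x * z ≈ y * z → x ≈ y ⊎ z ≈ 0#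
    where open CommutativeRing R

  module PolynomialRoots (R : CommutativeRing 0ℓ 0ℓ) (cancel : Cancellative R) where

    open CommutativeRing R
    open import Algebra.Properties.Semiring.Exp semiring using (_^_)
    open import Algebra.Solver.Ring.NaturalCoefficients.Default commutativeSemiring
      using (solve; _:+_; _:*_; _:=_; con)
    open import Relation.Binary.Reasoning.Setoid setoid

    eval : List Carrier → Carrier → Carrier
    eval []      x = 0#
    eval (a ∷ P) x = a + x * eval P x

    -- Synthetic division by X - r: the coefficients are the partial values of Horner's scheme at r.
    quot : Carrier → List Carrier → List Carrier
    quot r []            = []
    quot r (a ∷ [])      = []
    quot r (a ∷ b ∷ P) = eval (b ∷ P) r ∷ quot r (b ∷ P)

    length-quot : ∀ r a P → length (quot r (a ∷ P)) ≡ length P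
    length-quot r a []      = ≡.refl
    length-quot r a (b ∷ P) = cong suc (length-quot r b P)

    -- P(x) − P(r) = (x − r) Q(x), with both sides moved so that no subtraction occurs.
    division : ∀ r P x → eval P x + r * eval (quot r P) x ≈ eval P r + x * eval (quot r P) x
    division r [] x = trans (+-congˡ (zeroʳ r)) (sym (+-congˡ (zeroʳ x)))
    division r (a ∷ []) x = +-cong (+-congˡ (trans (zeroʳ x) (sym (zeroʳ r)))) (trans (zeroʳ r) (sym (zeroʳ x)))
    division r (a ∷ b ∷ P) x = begin
      (a + x * Px) + r * (Pr + x * Q)
        ≈⟨ solve 6 (λ a x Px r Pr Q → (a :+ x :* Px) :+ r :* (Pr :+ x :* Q) :=
             (a :+ r :* Pr) :+ x :* (Px :+ r :* Q)) refl a x Px r Pr Q ⟩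
      (a + r * Pr) + x * (Px + r * Q)
        ≈⟨ +-congˡ (*-congˡ (division r (b ∷ P) x)) ⟩
      (a + r * Pr) + x * (Pr + x * Q) ∎
      where
      Px = eval (b ∷ P) x
      Pr = eval (b ∷ P) r
      Q = eval (quot r (b ∷ P)) x

    -- Each coefficient of P is a Horner value minus r times the next one, and these values are P(r)
    -- followed by the coefficients of the quotient.
    quot≈0 : ∀ r P → All (_≈ 0#) (quot r P) → eval P r ≈ 0# → All (_≈ 0#) P
    quot≈0 r [] _ _ = []
    quot≈0 r (a ∷ []) _ e = trans (sym (trans (+-congˡ (zeroʳ r)) (+-identityʳ a))) e ∷ []
    quot≈0 r (a ∷ b ∷ P) (Pr ∷ Q) e =
      trans (sym (trans (+-congˡ (trans (*-congˡ Pr) (zeroʳ r))) (+-identityʳ a))) e ∷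
      quot≈0 r (b ∷ P) Q Pr

    -- Dividing by X - r keeps the other roots, because s - r can be cancelled. Comparing list
    -- lengths plays the part of "degree less than the number of roots" and avoids leading
    -- coefficients.
    many-roots⇒zero : ∀ P rs → AllPairs _≉_ rs → All (λ r → eval P r ≈ 0#) rs →
      length P ℕ.≤ length rs → All (_≈ 0#) P
    many-roots⇒zero [] rs _ _ _ = []
    many-roots⇒zero P@(a ∷ P′) (r ∷ rs) (r≉rs ∷ rs≉) (Pr≈0 ∷ Prs≈0) (s≤s len) =
      quot≈0 r P (many-roots⇒zero (quot r P) rs rs≉ (All.zipWith root (r≉rs , Prs≈0))
        (≡.subst (ℕ._≤ length rs) (≡.sym (length-quot r a P′)) len)) Pr≈0
      where
      root : ∀ {s} → r ≉ s × eval P s ≈ 0# → eval (quot r P) s ≈ 0#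
      root {s} (r≉s , Ps≈0) with cancel r s (eval (quot r P) s) (begin
        r * Q          ≈⟨ +-identityˡ _ ⟨
        0# + r * Q     ≈⟨ +-congʳ Ps≈0 ⟨
        eval P s + r * Q  ≈⟨ division r P s ⟩
        eval P r + s * Q  ≈⟨ +-congʳ Pr≈0 ⟩
        0# + s * Q     ≈⟨ +-identityˡ _ ⟩
        s * Q          ∎)
        where Q = eval (quot r P) s
      ... | inj₁ r≈s = ⊥-elim (r≉s r≈s)
      ... | inj₂ Q≈0 = Q≈0

    monomial : ℕ → List Carrier
    monomial k = replicate k 0# ++ 1# ∷ []

    eval-monomial : ∀ k x → eval (monomial k) x ≈ x ^ k
    eval-monomial zero    x = trans (+-congˡ (zeroʳ x)) (+-identityʳ 1#)
    eval-monomial (suc k) x = trans (+-identityˡ _) (*-congˡ (eval-monomial k x))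

    length-monomial : ∀ k → length (monomial k) ≡ suc k
    length-monomial zero    = ≡.refl
    length-monomial (suc k) = cong suc (length-monomial k)

-- The Bose-Singer Sidon set in a cyclic domain.

module SidonSets where

  open import Data.List using ([]; _∷_; applyUpTo; replicate)
  open import Data.List.Properties using (length-applyUpTo)
  open import Data.List.Relation.Unary.Any as Any using (Any; any?)
  import Data.List.Relation.Unary.Any.Properties as Any
  open import Data.List.Relation.Unary.AllPairs using (AllPairs; []; _∷_)
  open import Relation.Binary.PropositionalEquality as ≡ using (_≡_; _≢_; cong)
  open Frobenius
  open Roots

  module _ (R : CommutativeRing 0ℓ 0ℓ) where
    open CommutativeRing R
    open import Algebra.Properties.Semiring.Exp semiring using (_^_)

    -- What the Singer argument takes from a field with N + 1 elements and its q-power map.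
    -- Finiteness enters through `fixed`.
    record CyclicDomain (q N : ℕ) : Set where
      field
        _≟_         : ∀ x y → Dec (x ≈ y)
        cancel      : Cancellative R
        1≉0         : 1# ≉ 0#
        frobenius-q : ∀ x y → (x + y) ^ q ≈ x ^ q + y ^ q
        fixed       : ∀ x → x ^ suc N ≈ x
        ω           : Carrier
        ω^N≈1       : ω ^ N ≈ 1#
        ω-order     : ∀ i → ω ^ i ≈ 1# → i ℕ.< N → i ≡ 0

  -- Congruence modulo v of natural numbers, with both sides moved so that no subtraction occurs.
  Congruent : ℕ → ℕ → ℕ → Set
  Congruent v m n = ∃ λ z → ∃ λ z′ → v ℕ.* z ℕ.+ m ≡ v ℕ.* z′ ℕ.+ n

  -- The congruence is D i - D j ≡ D k - D l with the terms moved: a difference of two distinct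
  -- marks determines its ordered pair. The case k = l = i shows that D is injective modulo v.
  Sidon : ℕ → ℕ → (ℕ → ℕ) → Set
  Sidon v n D = ∀ i j k l → i ℕ.< n → j ℕ.< n → k ℕ.< n → l ℕ.< n → i ≢ j →
    Congruent v (D i ℕ.+ D l) (D k ℕ.+ D j) → i ≡ k × j ≡ l

  module BoseSinger (R : CommutativeRing 0ℓ 0ℓ) (q r v N : ℕ)
    (q≡suc-r : q ≡ suc r) (1<q : 1 ℕ.< q) (N≡r*v : N ≡ r ℕ.* v) (q²<N : q ℕ.* q ℕ.< N)
    (E : CyclicDomain R q N) where

    open CommutativeRing R
    open import Algebra.Properties.CommutativeSemiring.Exp commutativeSemiring
    open CyclicDomain E
    open PolynomialRoots R cancel
    open Powers R
    open import Algebra.Properties.Ring ring using (-‿distribʳ-*; x∙y⁻¹≈ε⇒x≈y; +-cancelʳ)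
    open import Algebra.Solver.Ring.NaturalCoefficients.Default commutativeSemiring
      using (solve; _:+_; _:*_; _:=_; con)
    open import Relation.Binary.Reasoning.Setoid setoid

    no-zero-divisors : ∀ x y → x * y ≈ 0# → x ≈ 0# ⊎ y ≈ 0#
    no-zero-divisors x y e = cancel x 0# y (trans e (sym (zeroˡ y)))

    ω^N*i≈1 : ∀ i → ω ^ (N ℕ.* i) ≈ 1#
    ω^N*i≈1 i = trans (^-congʳ ω (ℕ.*-comm N i)) (^*≈1 ω N i ω^N≈1)

    N≡suc : ∃ λ n → N ≡ suc n
    N≡suc = suc-pred N (ℕ.≤-<-trans z≤n q²<N)
      where
      suc-pred : ∀ m → 1 ℕ.≤ m → ∃ λ n → m ≡ suc n
      suc-pred (suc n) _ = n , ≡.refl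

    nonzero : ∀ {x y} → x * y ≈ 1# → x ≉ 0#
    nonzero {x} {y} xy≈1 x≈0 = 1≉0 (trans (sym xy≈1) (trans (*-congʳ x≈0) (zeroˡ y)))

    ω^≉0 : ∀ i → ω ^ i ≉ 0#
    ω^≉0 i with N≡suc
    ... | n , N≡ = nonzero {y = ω ^ (n ℕ.* i)} (begin
      ω ^ i * ω ^ (n ℕ.* i)  ≈⟨ ^-homo-* ω i (n ℕ.* i) ⟨
      ω ^ (suc n ℕ.* i)      ≡⟨ cong (λ m → ω ^ (m ℕ.* i)) N≡ ⟨
      ω ^ (N ℕ.* i)          ≈⟨ ω^N*i≈1 i ⟩
      1#                     ∎)

    ω^-injective-≤ : ∀ {i j} → i ℕ.≤ j → j ℕ.< N → ω ^ i ≈ ω ^ j → i ≡ j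
    ω^-injective-≤ {i} {j} i≤j j<N e with cancel 1# (ω ^ (j ℕ.∸ i)) (ω ^ i) (begin
      1# * ω ^ i                 ≈⟨ *-identityˡ _ ⟩
      ω ^ i                      ≈⟨ e ⟩
      ω ^ j                      ≡⟨ cong (ω ^_) (ℕ.m∸n+n≡m i≤j) ⟨
      ω ^ (j ℕ.∸ i ℕ.+ i)        ≈⟨ ^-homo-* ω (j ℕ.∸ i) i ⟩
      ω ^ (j ℕ.∸ i) * ω ^ i      ∎)
    ... | inj₁ 1≈ = ℕ.≤-antisym i≤j (ℕ.m∸n≡0⇒m≤n
            (ω-order (j ℕ.∸ i) (sym 1≈) (ℕ.≤-<-trans (ℕ.m∸n≤m j i) j<N)))
    ... | inj₂ ≈0 = ⊥-elim (ω^≉0 i ≈0)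

    ω^-injective : ∀ {i j} → i ℕ.< N → j ℕ.< N → ω ^ i ≈ ω ^ j → i ≡ j
    ω^-injective {i} {j} i<N j<N e with ℕ.≤-total i j
    ... | inj₁ i≤j = ω^-injective-≤ i≤j j<N e
    ... | inj₂ j≤i = ≡.sym (ω^-injective-≤ j≤i i<N (sym e))

    -- Otherwise x and the powers of ω would be N + 1 roots of X^N − 1.
    log : ∀ x → x ≉ 0# → ∃ λ i → ω ^ i ≈ x
    log x x≉0 with any? (λ y → x ≟ y) (applyUpTo (ω ^_) N)
    ... | yes x∈ = let (i , _ , e) = Any.applyUpTo⁻ (ω ^_) x∈ in i , sym e
    ... | no x∉ with N≡suc
    ...   | n , N≡ = ⊥-elim (1≉0 (one (All.++⁻ʳ (replicate n 0#) (All.tail zeros))))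
      where
      -- The coefficients of X^N - 1: N + 1 entries against the N + 1 roots below. The last entry is
      -- 1, so the list cannot vanish.
      P = - 1# ∷ monomial n
      one : ∀ {x} → All (_≈ 0#) (x ∷ []) → x ≈ 0#
      one (e ∷ []) = e
      P-root : ∀ {y} → y ^ N ≈ 1# → eval P y ≈ 0#
      P-root {y} e = begin
        - 1# + y * eval (monomial n) y  ≈⟨ +-congˡ (*-congˡ (eval-monomial n y)) ⟩
        - 1# + y ^ suc n                ≡⟨ cong (λ m → - 1# + y ^ m) N≡ ⟨
        - 1# + y ^ N                    ≈⟨ +-congˡ e ⟩
        - 1# + 1#                       ≈⟨ -‿inverseˡ 1# ⟩
        0#                              ∎
      x^N≈1 : x ^ N ≈ 1#
      x^N≈1 with cancel (x ^ N) 1# x (trans (*-comm _ x) (trans (fixed x) (sym (*-identityˡ x))))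
      ... | inj₁ e = e
      ... | inj₂ x≈0 = ⊥-elim (x≉0 x≈0)
      zeros : All (_≈ 0#) P
      zeros = many-roots⇒zero P (x ∷ applyUpTo (ω ^_) N)
        (All.¬Any⇒All¬ _ x∉ ∷ AllPairs.applyUpTo⁺₁ (ω ^_) N
          (λ i<j j<N e → ℕ.<⇒≢ i<j (ω^-injective (ℕ.<-trans i<j j<N) j<N e)))
        (P-root x^N≈1 ∷ All.applyUpTo⁺₂ (ω ^_) N λ i →
          P-root (trans (^-assocʳ ω i N) (trans (^-congʳ ω (ℕ.*-comm i N)) (ω^N*i≈1 i))))
        (ℕ.≤-reflexive (cong suc (≡.trans (length-monomial n)
          (≡.trans (≡.sym N≡) (≡.sym (length-applyUpTo (ω ^_) N))))))

    -- The subfield F as the fixed set of the q-power map. Elements of it are supplied by 0 and the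
    -- powers of ω^v.
    InF : Carrier → Set
    InF x = x ^ q ≈ x

    0∈F : InF 0#
    0∈F = trans (^-congʳ 0# q≡suc-r) (zeroˡ _)

    1∈F : InF 1#
    1∈F = 1^≈1 q

    +∈F : ∀ {x y} → InF x → InF y → InF (x + y)
    +∈F x∈ y∈ = trans (frobenius-q _ _) (+-cong x∈ y∈)

    *∈F : ∀ {x y} → InF x → InF y → InF (x * y)
    *∈F x∈ y∈ = trans (^-distrib-* _ _ q) (*-cong x∈ y∈)

    -- v q = v + (q - 1) v = v + N, and ω^N = 1.
    ω^v∈F : ∀ j → InF (ω ^ (v ℕ.* j))
    ω^v∈F j = begin
      (ω ^ (v ℕ.* j)) ^ q                ≈⟨ ^-assocʳ ω (v ℕ.* j) q ⟩
      ω ^ (v ℕ.* j ℕ.* q)                ≡⟨ cong (ω ^_) exponent ⟩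
      ω ^ (v ℕ.* j ℕ.+ N ℕ.* j)          ≈⟨ ^-homo-* ω (v ℕ.* j) (N ℕ.* j) ⟩
      ω ^ (v ℕ.* j) * ω ^ (N ℕ.* j)      ≈⟨ *-congˡ (ω^N*i≈1 j) ⟩
      ω ^ (v ℕ.* j) * 1#                 ≈⟨ *-identityʳ _ ⟩
      ω ^ (v ℕ.* j)                      ∎
      where
      rearrange : ∀ v j r → v ℕ.* j ℕ.* suc r ≡ v ℕ.* j ℕ.+ r ℕ.* v ℕ.* j
      rearrange = ℕ-Solver.solve-∀
      exponent : v ℕ.* j ℕ.* q ≡ v ℕ.* j ℕ.+ N ℕ.* j
      exponent = ≡.trans (cong (v ℕ.* j ℕ.*_) q≡suc-r)
        (≡.trans (rearrange v j r) (cong (λ n → v ℕ.* j ℕ.+ n ℕ.* j) (≡.sym N≡r*v)))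

    quadratic : Carrier → Carrier → Carrier → Carrier → Carrier
    quadratic A B C y = A * (y * y) + B * y + C

    quadratic-frobenius : ∀ {A B C} → InF A → InF B → InF C → ∀ y →
      quadratic A B C y ^ q ≈ quadratic A B C (y ^ q)
    quadratic-frobenius A∈ B∈ C∈ y =
      trans (frobenius-q _ _) (+-cong (trans (frobenius-q _ _) (+-cong
        (trans (^-distrib-* _ _ q) (*-cong A∈ (^-distrib-* y y q)))
        (trans (^-distrib-* _ _ q) (*-congʳ B∈)))) C∈)

    -- Such an equation also holds at ω^q and ω^(q²).
    independent : ∀ {A B C A′ B′ C′} → InF A → InF B → InF C → InF A′ → InF B′ → InF C′ →
      quadratic A B C ω ≈ quadratic A′ B′ C′ ω → A ≈ A′ × B ≈ B′ × C ≈ C′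
    independent {A} {B} {C} {A′} {B′} {C′} A∈ B∈ C∈ A′∈ B′∈ C′∈ e = split zeros
      where
      P = C - C′ ∷ B - B′ ∷ A - A′ ∷ []
      conjugate : ∀ {y} → quadratic A B C y ≈ quadratic A′ B′ C′ y →
        quadratic A B C (y ^ q) ≈ quadratic A′ B′ C′ (y ^ q)
      conjugate {y} e = trans (sym (quadratic-frobenius A∈ B∈ C∈ y))
        (trans (^-congˡ q e) (quadratic-frobenius A′∈ B′∈ C′∈ y))
      restore : ∀ x y → x - y + y ≈ x
      restore x y = trans (+-assoc _ _ _) (trans (+-congˡ (-‿inverseˡ y)) (+-identityʳ x))
      root : ∀ {y} → quadratic A B C y ≈ quadratic A′ B′ C′ y → eval P y ≈ 0#
      root {y} e = +-cancelʳ (quadratic A′ B′ C′ y) _ _ (begin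
        eval P y + quadratic A′ B′ C′ y
          ≈⟨ solve 7 (λ a b c A′ B′ C′ y →
               (c :+ y :* (b :+ y :* (a :+ y :* con 0))) :+ (A′ :* (y :* y) :+ B′ :* y :+ C′) :=
               (a :+ A′) :* (y :* y) :+ (b :+ B′) :* y :+ (c :+ C′)) refl (A - A′) (B - B′) (C - C′) A′ B′ C′ y ⟩
        quadratic (A - A′ + A′) (B - B′ + B′) (C - C′ + C′) y
          ≈⟨ +-cong (+-cong (*-congʳ (restore A A′)) (*-congʳ (restore B B′))) (restore C C′) ⟩
        quadratic A B C y   ≈⟨ e ⟩
        quadratic A′ B′ C′ y ≈⟨ +-identityˡ _ ⟨
        0# + quadratic A′ B′ C′ y ∎)
      q<q² : q ℕ.< q ℕ.* q
      q<q² = ℕ.m<m*n q q {{ℕ.>-nonZero (ℕ.<-trans (s≤s z≤n) 1<q)}} 1<q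
      ω≈ω^1 : ω ≈ ω ^ 1
      ω≈ω^1 = sym (*-identityʳ ω)
      ω≉ω^q : ω ≉ ω ^ q
      ω≉ω^q e = ℕ.<⇒≢ 1<q (ω^-injective (ℕ.<-trans 1<q (ℕ.<-trans q<q² q²<N)) (ℕ.<-trans q<q² q²<N)
        (trans (sym ω≈ω^1) e))
      ω≉ω^q² : ω ≉ (ω ^ q) ^ q
      ω≉ω^q² e = ℕ.<⇒≢ (ℕ.<-trans 1<q q<q²) (ω^-injective (ℕ.<-trans 1<q (ℕ.<-trans q<q² q²<N)) q²<N
        (trans (sym ω≈ω^1) (trans e (^-assocʳ ω q q))))
      ω^q≉ω^q² : ω ^ q ≉ (ω ^ q) ^ q
      ω^q≉ω^q² e = ℕ.<⇒≢ q<q² (ω^-injective (ℕ.<-trans q<q² q²<N) q²<N (trans e (^-assocʳ ω q q)))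
      -- Three coefficients against three roots: `q²<N` keeps the exponents 1, q, q² below the order
      -- of ω, so the conjugates are distinct.
      zeros : All (_≈ 0#) P
      zeros = many-roots⇒zero P (ω ∷ ω ^ q ∷ (ω ^ q) ^ q ∷ [])
        ((ω≉ω^q ∷ ω≉ω^q² ∷ []) ∷ (ω^q≉ω^q² ∷ []) ∷ [] ∷ [])
        (root e ∷ root (conjugate e) ∷ root (conjugate (conjugate e)) ∷ [])
        (s≤s (s≤s (s≤s z≤n)))
      split : All (_≈ 0#) P → A ≈ A′ × B ≈ B′ × C ≈ C′
      split (c ∷ b ∷ a ∷ []) = x∙y⁻¹≈ε⇒x≈y A A′ a , x∙y⁻¹≈ε⇒x≈y B B′ b , x∙y⁻¹≈ε⇒x≈y C C′ c

    -- The q + 1 points (s i : t i) of the projective line over F.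
    s t : ℕ → Carrier
    s zero    = 0#
    s (suc i) = 1#
    t zero          = 1#
    t (suc zero)    = 0#
    t (suc (suc j)) = ω ^ (v ℕ.* j)

    s∈F : ∀ i → InF (s i)
    s∈F zero    = 0∈F
    s∈F (suc i) = 1∈F

    t∈F : ∀ i → InF (t i)
    t∈F zero          = 1∈F
    t∈F (suc zero)    = 0∈F
    t∈F (suc (suc j)) = ω^v∈F j

    -- Index 0 is the point at infinity. For the affine points the claim is that the t values
    -- differ: the exponents v j with j < q - 1 stay below N, the order of ω.
    proportional⇒≡ : ∀ {i k} → i ℕ.< suc q → k ℕ.< suc q → s k * t i ≈ t k * s i → i ≡ k
    proportional⇒≡ {zero} {zero} _ _ e = ≡.refl
    proportional⇒≡ {zero} {suc k} _ _ e = ⊥-elim (1≉0 (trans (sym (*-identityʳ 1#)) (trans e (zeroʳ _))))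
    proportional⇒≡ {suc i} {zero} _ _ e = ⊥-elim (1≉0 (trans (sym (*-identityʳ 1#)) (trans (sym e) (zeroˡ _))))
    proportional⇒≡ {suc i} {suc k} i≤q k≤q e =
      cong suc (t-injective i k i≤q k≤q (trans (sym (*-identityˡ _)) (trans e (*-identityʳ _))))
      where
      instance
        v≢0 : NonZero v
        v≢0 = ℕ.≢-nonZero λ v≡0 → ℕ.n≮0 (≡.subst (q ℕ.* q ℕ.<_)
          (≡.trans N≡r*v (≡.trans (cong (r ℕ.*_) v≡0) (ℕ.*-zeroʳ r))) q²<N)
      v*j<N : ∀ {j} → suc (suc j) ℕ.< suc q → v ℕ.* j ℕ.< N
      v*j<N {j} (s≤s lt) with ≡.subst (suc (suc j) ℕ.≤_) q≡suc-r lt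
      ... | s≤s j<r = ≡.subst (v ℕ.* j ℕ.<_) (≡.trans (ℕ.*-comm v r) (≡.sym N≡r*v))
        (ℕ.*-monoʳ-< v j<r)
      t-injective : ∀ i k → suc i ℕ.< suc q → suc k ℕ.< suc q → t (suc i) ≈ t (suc k) → i ≡ k
      t-injective zero zero _ _ e = ≡.refl
      t-injective zero (suc k) _ _ e = ⊥-elim (ω^≉0 (v ℕ.* k) (sym e))
      t-injective (suc i) zero _ _ e = ⊥-elim (ω^≉0 (v ℕ.* i) e)
      t-injective (suc i) (suc k) i≤q k≤q e =
        cong suc (ℕ.*-cancelˡ-≡ i k v
          (ω^-injective (v*j<N i≤q) (v*j<N k≤q) e))

    point : ℕ → Carrier
    point i = s i * ω + t i

    point≉0 : ∀ i → point i ≉ 0#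
    point≉0 i e = contradiction i (proj₂ (independent 0∈F (s∈F i) (t∈F i) 0∈F 0∈F 0∈F (begin
      0# * (ω * ω) + s i * ω + t i
        ≈⟨ solve 3 (λ ω s t → con 0 :* (ω :* ω) :+ s :* ω :+ t := s :* ω :+ t) refl ω (s i) (t i) ⟩
      point i ≈⟨ e ⟩
      0# ≈⟨ solve 1 (λ ω → con 0 := con 0 :* (ω :* ω) :+ con 0 :* ω :+ con 0) refl ω ⟩
      0# * (ω * ω) + 0# * ω + 0# ∎)))
      where
      contradiction : ∀ i → s i ≈ 0# × t i ≈ 0# → ⊥
      contradiction zero    (_ , e) = 1≉0 e
      contradiction (suc i) (e , _) = 1≉0 e

    D : ℕ → ℕ
    D i = proj₁ (log (point i) (point≉0 i))

    ω^D : ∀ i → ω ^ D i ≈ point i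
    ω^D i = proj₂ (log (point i) (point≉0 i))

    -- The homogeneous version of `point i`, which is its value at (ω, 1). In two variables even the
    -- constant point of index 0 acquires a nontrivial zero.
    form : ℕ → Carrier → Carrier → Carrier
    form i y z = s i * y + t i * z

    module _ {c c′} (c∈ : InF c) (c′∈ : InF c′) {i l k j}
      (e : c * (point i * point l) ≈ c′ * (point k * point j)) where
      -- By `independent` the two products agree coefficient by coefficient, so (ω, 1) may be
      -- replaced by any (y, z).
      product-forms : ∀ y z → c * (form i y z * form l y z) ≈ c′ * (form k y z * form j y z)
      product-forms y z = trans (sym (expand-form c (s i) (t i) (s l) (t l))) (trans (equate (independent
        (*∈F c∈ (*∈F (s∈F i) (s∈F l)))
        (*∈F c∈ (+∈F (*∈F (s∈F i) (t∈F l)) (*∈F (t∈F i) (s∈F l))))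
        (*∈F c∈ (*∈F (t∈F i) (t∈F l)))
        (*∈F c′∈ (*∈F (s∈F k) (s∈F j)))
        (*∈F c′∈ (+∈F (*∈F (s∈F k) (t∈F j)) (*∈F (t∈F k) (s∈F j))))
        (*∈F c′∈ (*∈F (t∈F k) (t∈F j)))
        (trans (expand-point c (s i) (t i) (s l) (t l)) (trans e (sym (expand-point c′ (s k) (t k) (s j) (t j)))))))
        (expand-form c′ (s k) (t k) (s j) (t j)))
        where
        expand-point : ∀ c a b a′ b′ → quadratic (c * (a * a′)) (c * (a * b′ + b * a′)) (c * (b * b′)) ω ≈
          c * ((a * ω + b) * (a′ * ω + b′))
        expand-point c a b a′ b′ = solve 6 (λ ω c a b a′ b′ →
          (c :* (a :* a′)) :* (ω :* ω) :+ (c :* (a :* b′ :+ b :* a′)) :* ω :+ c :* (b :* b′) :=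
          c :* ((a :* ω :+ b) :* (a′ :* ω :+ b′))) refl ω c a b a′ b′
        expand-form : ∀ c a b a′ b′ →
          (c * (a * a′)) * (y * y) + (c * (a * b′ + b * a′)) * (y * z) + c * (b * b′) * (z * z) ≈
          c * ((a * y + b * z) * (a′ * y + b′ * z))
        expand-form c a b a′ b′ = solve 7 (λ y z c a b a′ b′ →
          (c :* (a :* a′)) :* (y :* y) :+ (c :* (a :* b′ :+ b :* a′)) :* (y :* z) :+ c :* (b :* b′) :* (z :* z) :=
          c :* ((a :* y :+ b :* z) :* (a′ :* y :+ b′ :* z))) refl y z c a b a′ b′
        equate : ∀ {A B C A′ B′ C′} → A ≈ A′ × B ≈ B′ × C ≈ C′ →
          A * (y * y) + B * (y * z) + C * (z * z) ≈ A′ * (y * y) + B′ * (y * z) + C′ * (z * z)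
        equate (A , B , C) = +-cong (+-cong (*-congʳ A) (*-congʳ B)) (*-congʳ C)

      -- This stands in for unique factorisation. At (t i, - s i) the form of i vanishes, hence so
      -- does the form of k or of j, and a common zero makes the two points proportional.
      common-point : c′ ≉ 0# → i ℕ.< suc q → k ℕ.< suc q → j ℕ.< suc q → i ≡ k ⊎ i ≡ j
      common-point c′≉0 i≤q k≤q j≤q = cases (no-zero-divisors c′ _ kj≈0)
        where
        z = - s i
        vanish : form i (t i) z ≈ 0#
        vanish = begin
          s i * t i + t i * z       ≈⟨ +-congˡ (-‿distribʳ-* (t i) (s i)) ⟨
          s i * t i - t i * s i     ≈⟨ +-congˡ (-‿cong (*-comm (t i) (s i))) ⟩
          s i * t i - s i * t i     ≈⟨ -‿inverseʳ _ ⟩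
          0#                        ∎
        kj≈0 : c′ * (form k (t i) z * form j (t i) z) ≈ 0#
        kj≈0 = begin
          c′ * (form k (t i) z * form j (t i) z)  ≈⟨ product-forms (t i) z ⟨
          c * (form i (t i) z * form l (t i) z)   ≈⟨ *-congˡ (*-congʳ vanish) ⟩
          c * (0# * form l (t i) z)               ≈⟨ *-congˡ (zeroˡ _) ⟩
          c * 0#                                  ≈⟨ zeroʳ c ⟩
          0#                                      ∎
        proportional : ∀ k → form k (t i) z ≈ 0# → s k * t i ≈ t k * s i
        proportional k e = x∙y⁻¹≈ε⇒x≈y _ _ (trans (+-congˡ (-‿distribʳ-* (t k) (s i))) e)
        factors : form k (t i) z ≈ 0# ⊎ form j (t i) z ≈ 0# → i ≡ k ⊎ i ≡ j
        factors (inj₁ k≈0) = inj₁ (proportional⇒≡ i≤q k≤q (proportional k k≈0))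
        factors (inj₂ j≈0) = inj₂ (proportional⇒≡ i≤q j≤q (proportional j j≈0))
        cases : c′ ≈ 0# ⊎ form k (t i) z * form j (t i) z ≈ 0# → i ≡ k ⊎ i ≡ j
        cases (inj₁ c′≈0) = ⊥-elim (c′≉0 c′≈0)
        cases (inj₂ e)    = factors (no-zero-divisors _ _ e)

    -- A congruence between sums of logarithms is a proportionality over F between products of two points.
    sidon : Sidon v (suc q) D
    sidon i j k l i≤q j≤q k≤q l≤q i≢j (z , z′ , e) =
      first (common-point (ω^v∈F z) (ω^v∈F z′) {i} {l} {k} {j} e′ (ω^≉0 (v ℕ.* z′)) i≤q k≤q j≤q) ,
      second (common-point (ω^v∈F z′) (ω^v∈F z) {j} {k} {i} {l} e″ (ω^≉0 (v ℕ.* z)) j≤q i≤q l≤q)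
      where
      power : ∀ z i l → ω ^ (v ℕ.* z ℕ.+ (D i ℕ.+ D l)) ≈ ω ^ (v ℕ.* z) * (point i * point l)
      power z i l = trans (^-homo-* ω (v ℕ.* z) _) (*-congˡ
        (trans (^-homo-* ω (D i) (D l)) (*-cong (ω^D i) (ω^D l))))
      e′ : ω ^ (v ℕ.* z) * (point i * point l) ≈ ω ^ (v ℕ.* z′) * (point k * point j)
      e′ = trans (sym (power z i l)) (trans (^-congʳ ω e) (power z′ k j))
      e″ : ω ^ (v ℕ.* z′) * (point j * point k) ≈ ω ^ (v ℕ.* z) * (point i * point l)
      e″ = trans (*-congˡ (*-comm _ _)) (sym e′)
      first : i ≡ k ⊎ i ≡ j → i ≡ k
      first (inj₁ i≡k) = i≡k
      first (inj₂ i≡j) = ⊥-elim (i≢j i≡j)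
      second : j ≡ i ⊎ j ≡ l → j ≡ l
      second (inj₁ j≡i) = ⊥-elim (i≢j (≡.sym j≡i))
      second (inj₂ j≡l) = j≡l

-- Congruence of integers modulo m.

module Congruences where

  open import Data.Integer as ℤ using (ℤ; +_; 0ℤ; _+_; _*_; _-_; -_)
  open import Data.Integer.DivMod using (_/ℕ_; _%ℕ_; a≡a%ℕn+[a/ℕn]*n)
  open import Data.Integer.Divisibility.Signed as Signed using (divides; ∣m∣n⇒∣m+n; ∣m⇒∣-m; ∣n⇒∣m*n; ∣m⇒∣m*n)
  open import Relation.Nullary.Decidable using (map′)
  open import Relation.Binary.PropositionalEquality as ≡ using (_≡_)

  module Congruence (m : ℕ) where

    infix 4 _≅_ _≅?_

    -- A record rather than a synonym for divisibility, so that both sides can be inferred from the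
    -- type.
    record _≅_ (x y : ℤ) : Set where
      constructor mod
      field divisible : + m Signed.∣ x - y
    open _≅_ public

    _≅?_ : ∀ x y → Dec (x ≅ y)
    x ≅? y = map′ mod divisible (+ m Signed.∣? x - y)

    ≅-reflexive : ∀ {x y} → x ≡ y → x ≅ y
    ≅-reflexive {x} ≡.refl = mod (divides 0ℤ (ℤ.+-inverseʳ x))

    ≅-refl : ∀ {x} → x ≅ x
    ≅-refl = ≅-reflexive ≡.refl

    ≅-sym : ∀ {x y} → x ≅ y → y ≅ x
    ≅-sym {x} {y} (mod d) = mod (≡.subst (+ m Signed.∣_) (flip x y) (∣m⇒∣-m d))
      where
      flip : ∀ x y → - (x - y) ≡ y - x
      flip = solve-∀

    ≅-trans : ∀ {x y z} → x ≅ y → y ≅ z → x ≅ z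
    ≅-trans {x} {y} {z} (mod d) (mod e) = mod (≡.subst (+ m Signed.∣_) (telescope x y z) (∣m∣n⇒∣m+n d e))
      where
      telescope : ∀ x y z → (x - y) + (y - z) ≡ x - z
      telescope = solve-∀

    ≅-+-cong : ∀ {x y u w} → x ≅ y → u ≅ w → x + u ≅ y + w
    ≅-+-cong {x} {y} {u} {w} (mod d) (mod e) = mod (≡.subst (+ m Signed.∣_) (regroup x y u w) (∣m∣n⇒∣m+n d e))
      where
      regroup : ∀ x y u w → (x - y) + (u - w) ≡ (x + u) - (y + w)
      regroup = solve-∀

    ≅-*-cong : ∀ {x y u w} → x ≅ y → u ≅ w → x * u ≅ y * w
    ≅-*-cong {x} {y} {u} {w} (mod d) (mod e) =
      mod (≡.subst (+ m Signed.∣_) (regroup x y u w) (∣m∣n⇒∣m+n (∣m⇒∣m*n u d) (∣n⇒∣m*n y e)))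
      where
      regroup : ∀ x y u w → (x - y) * u + y * (u - w) ≡ x * u - y * w
      regroup = solve-∀

    ≅--cong : ∀ {x y} → x ≅ y → - x ≅ - y
    ≅--cong {x} {y} (mod d) = mod (≡.subst (+ m Signed.∣_) (regroup x y) (∣m⇒∣-m d))
      where
      regroup : ∀ x y → - (x - y) ≡ - x - - y
      regroup = solve-∀

    multiple≅0 : ∀ x → x * + m ≅ 0ℤ
    multiple≅0 x = mod (divides x (ℤ.+-identityʳ (x * + m)))

    %ℕ-≅ : ∀ x .{{_ : NonZero m}} → x ≅ + (x %ℕ m)
    %ℕ-≅ x = mod (divides (x /ℕ m) (≡.trans (≡.cong (_- + (x %ℕ m)) (a≡a%ℕn+[a/ℕn]*n x m)) (cancel (+ (x %ℕ m)) (x /ℕ m * + m))))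
      where
      cancel : ∀ x y → (x + y) - x ≡ y
      cancel = solve-∀

-- Polynomials acting on sequences by shifts.

module ShiftRings where

  open import Data.Integer as ℤ using (ℤ; 0ℤ; 1ℤ; _+_; _*_; _-_; -_)
  open import Data.List using (List; []; _∷_; map)
  open import Function using (_∘_)
  open import Relation.Binary.PropositionalEquality as ≡ using (_≡_; cong; cong₂; module ≡-Reasoning)
  open Congruences

  Sequence : Set
  Sequence = ℕ → ℤ

  -- Coefficients in increasing degree; X acts on sequences as the shift.
  Poly : Set
  Poly = List ℤ

  act : Poly → Sequence → Sequence
  act []      s n = 0ℤ
  act (a ∷ P) s n = a * s n + act P s (suc n)

  infixl 6 _⊕_
  infixl 7 _⊛_

  _⊕_ : Poly → Poly → Poly
  []      ⊕ Q       = Q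
  (a ∷ P) ⊕ []      = a ∷ P
  (a ∷ P) ⊕ (b ∷ Q) = a + b ∷ P ⊕ Q

  scale : ℤ → Poly → Poly
  scale c = map (c *_)

  _⊛_ : Poly → Poly → Poly
  []      ⊛ Q = []
  (a ∷ P) ⊛ Q = scale a Q ⊕ (0ℤ ∷ P ⊛ Q)

  act-⊕ : ∀ P Q s n → act (P ⊕ Q) s n ≡ act P s n + act Q s n
  act-⊕ [] Q s n = ≡.sym (ℤ.+-identityˡ _)
  act-⊕ (a ∷ P) [] s n = ≡.sym (ℤ.+-identityʳ _)
  act-⊕ (a ∷ P) (b ∷ Q) s n = ≡.trans (cong (λ y → (a + b) * s n + y) (act-⊕ P Q s (suc n))) (regroup a b (s n) _ _)
    where
    regroup : ∀ a b x y z → (a + b) * x + (y + z) ≡ (a * x + y) + (b * x + z)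
    regroup = solve-∀

  act-scale : ∀ c P s n → act (scale c P) s n ≡ c * act P s n
  act-scale c [] s n = ≡.sym (ℤ.*-zeroʳ c)
  act-scale c (a ∷ P) s n = ≡.trans (cong (λ y → c * a * s n + y) (act-scale c P s (suc n))) (regroup c a (s n) _)
    where
    regroup : ∀ c a x y → c * a * x + c * y ≡ c * (a * x + y)
    regroup = solve-∀

  act-⊛ : ∀ P Q s n → act (P ⊛ Q) s n ≡ act P (act Q s) n
  act-⊛ [] Q s n = ≡.refl
  act-⊛ (a ∷ P) Q s n = begin
    act (scale a Q ⊕ (0ℤ ∷ P ⊛ Q)) s n                      ≡⟨ act-⊕ (scale a Q) _ s n ⟩
    act (scale a Q) s n + (0ℤ * s n + act (P ⊛ Q) s (suc n)) ≡⟨ cong₂ _+_ (act-scale a Q s n) (ℤ.+-identityˡ _) ⟩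
    a * act Q s n + act (P ⊛ Q) s (suc n)                    ≡⟨ cong (λ y → a * act Q s n + y) (act-⊛ P Q s (suc n)) ⟩
    a * act Q s n + act P (act Q s) (suc n)                  ∎
    where open ≡-Reasoning

  act-shift : ∀ c P s n → act P (λ k → s (k ℕ.+ c)) n ≡ act P s (n ℕ.+ c)
  act-shift c [] s n = ≡.refl
  act-shift c (a ∷ P) s n = cong (λ y → a * s (n ℕ.+ c) + y) (act-shift c P s (suc n))

  act-linear : ∀ P a s u n → act P (λ k → a * s k + u k) n ≡ a * act P s n + act P u n
  act-linear [] a s u n = ≡.sym (≡.trans (ℤ.+-identityʳ _) (ℤ.*-zeroʳ a))
  act-linear (b ∷ P) a s u n =
    ≡.trans (cong (λ y → b * (a * s n + u n) + y) (act-linear P a s u (suc n))) (regroup a b (s n) (u n) _ _)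
    where
    regroup : ∀ a b x y z w → b * (a * x + y) + (a * z + w) ≡ a * (b * x + z) + (b * y + w)
    regroup = solve-∀

  act-≗ : ∀ P {s u} → (∀ n → s n ≡ u n) → ∀ n → act P s n ≡ act P u n
  act-≗ [] e n = ≡.refl
  act-≗ (a ∷ P) e n = cong₂ _+_ (cong (a *_) (e n)) (act-≗ P e (suc n))

  act-suc : ∀ P s n → act P (s ∘ suc) n ≡ act P s (suc n)
  act-suc [] s n = ≡.refl
  act-suc (a ∷ P) s n = cong (λ y → a * s (suc n) + y) (act-suc P s (suc n))

  act-0 : ∀ P n → act P (λ _ → 0ℤ) n ≡ 0ℤ
  act-0 [] n = ≡.refl
  act-0 (a ∷ P) n = ≡.trans (cong (λ y → a * 0ℤ + y) (act-0 P (suc n))) (≡.trans (ℤ.+-identityʳ _) (ℤ.*-zeroʳ a))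

  -- Constants pass through Q by linearity, and the shift commutes with Q. Commutativity of the ring
  -- is read off from this.
  act-comm : ∀ P Q s n → act P (act Q s) n ≡ act Q (act P s) n
  act-comm [] Q s n = ≡.sym (act-0 Q n)
  act-comm (a ∷ P) Q s n = begin
    a * act Q s n + act P (act Q s) (suc n)        ≡⟨ cong (λ y → a * act Q s n + y) (act-comm P Q s (suc n)) ⟩
    a * act Q s n + act Q (act P s) (suc n)        ≡⟨ cong (λ y → a * act Q s n + y) (act-suc Q (act P s) n) ⟨
    a * act Q s n + act Q (act P s ∘ suc) n        ≡⟨ act-linear Q a s (act P s ∘ suc) n ⟨
    act Q (act (a ∷ P) s) n                        ∎
    where open ≡-Reasoning

  act-1 : ∀ s n → act (1ℤ ∷ []) s n ≡ s n
  act-1 s n = ≡.trans (ℤ.+-identityʳ _) (ℤ.*-identityˡ _)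

  module _ (p : ℕ) where
    open Congruence p

    act-cong : ∀ P {s u} → (∀ n → s n ≅ u n) → ∀ n → act P s n ≅ act P u n
    act-cong [] e n = ≅-refl
    act-cong (a ∷ P) e n = ≅-+-cong (≅-*-cong (≅-refl {a}) (e n)) (act-cong P e (suc n))

    module _ (t : Sequence) where

      infix 4 _≈_

      -- Having the same effect on t replaces congruence modulo the annihilator ideal, so neither
      -- generators of that ideal nor polynomial division is required.
      record _≈_ (P Q : Poly) : Set where
        constructor pointwise
        field at : ∀ n → act P t n ≅ act Q t n
      open _≈_ public

      private
        exact : ∀ {P Q} → (∀ n → act P t n ≡ act Q t n) → P ≈ Q
        exact e = pointwise λ n → ≅-reflexive (e n)

      ⊕-cong : ∀ {P P′ Q Q′} → P ≈ P′ → Q ≈ Q′ → P ⊕ Q ≈ P′ ⊕ Q′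
      ⊕-cong {P} {P′} {Q} {Q′} (pointwise e) (pointwise f) = pointwise λ n →
        ≅-trans (≅-reflexive (act-⊕ P Q t n)) (≅-trans (≅-+-cong (e n) (f n)) (≅-reflexive (≡.sym (act-⊕ P′ Q′ t n))))

      ⊛-congˡ : ∀ P {Q Q′} → Q ≈ Q′ → P ⊛ Q ≈ P ⊛ Q′
      ⊛-congˡ P {Q} {Q′} (pointwise f) = pointwise λ n →
        ≅-trans (≅-reflexive (act-⊛ P Q t n)) (≅-trans (act-cong P f n) (≅-reflexive (≡.sym (act-⊛ P Q′ t n))))

      ⊛-comm : ∀ P Q → P ⊛ Q ≈ Q ⊛ P
      ⊛-comm P Q = exact λ n → ≡.trans (act-⊛ P Q t n) (≡.trans (act-comm P Q t n) (≡.sym (act-⊛ Q P t n)))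

      ≈-trans : ∀ {P Q S} → P ≈ Q → Q ≈ S → P ≈ S
      ≈-trans (pointwise e) (pointwise f) = pointwise λ n → ≅-trans (e n) (f n)

      ⊛-distribˡ : ∀ P Q S → P ⊛ (Q ⊕ S) ≈ P ⊛ Q ⊕ P ⊛ S
      ⊛-distribˡ P Q S = exact λ n → begin
        act (P ⊛ (Q ⊕ S)) t n                     ≡⟨ act-⊛ P (Q ⊕ S) t n ⟩
        act P (act (Q ⊕ S) t) n                   ≡⟨ act-≗ P (λ k → ≡.trans (act-⊕ Q S t k)
                                                       (cong (_+ act S t k) (≡.sym (ℤ.*-identityˡ (act Q t k))))) n ⟩
        act P (λ k → 1ℤ * act Q t k + act S t k) n ≡⟨ act-linear P 1ℤ (act Q t) (act S t) n ⟩
        1ℤ * act P (act Q t) n + act P (act S t) n ≡⟨ cong (_+ act P (act S t) n) (ℤ.*-identityˡ (act P (act Q t) n)) ⟩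
        act P (act Q t) n + act P (act S t) n     ≡⟨ cong₂ _+_ (act-⊛ P Q t n) (act-⊛ P S t n) ⟨
        act (P ⊛ Q) t n + act (P ⊛ S) t n         ≡⟨ act-⊕ (P ⊛ Q) (P ⊛ S) t n ⟨
        act (P ⊛ Q ⊕ P ⊛ S) t n                   ∎
        where open ≡-Reasoning

      neg : Poly → Poly
      neg = scale (- 1ℤ)

      -- The polynomials modulo p and modulo the annihilator of t.
      sequenceRing : CommutativeRing 0ℓ 0ℓ
      sequenceRing = record
        { Carrier = Poly ; _≈_ = _≈_ ; _+_ = _⊕_ ; _*_ = _⊛_ ; -_ = neg ; 0# = [] ; 1# = 1ℤ ∷ []
        ; isCommutativeRing = record
          { isRing = record
            { +-isAbelianGroup = record
              { isGroup = record
                { isMonoid = record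
                  { isSemigroup = record
                    { isMagma = record
                      { isEquivalence = record
                        { refl = pointwise λ n → ≅-refl
                        ; sym = λ (pointwise e) → pointwise λ n → ≅-sym (e n)
                        ; trans = ≈-trans }
                      ; ∙-cong = ⊕-cong }
                    ; assoc = λ P Q S → exact λ n → begin
                        act (P ⊕ Q ⊕ S) t n                     ≡⟨ act-⊕ (P ⊕ Q) S t n ⟩
                        act (P ⊕ Q) t n + act S t n             ≡⟨ cong (_+ act S t n) (act-⊕ P Q t n) ⟩
                        act P t n + act Q t n + act S t n       ≡⟨ ℤ.+-assoc (act P t n) _ _ ⟩
                        act P t n + (act Q t n + act S t n)     ≡⟨ cong (λ y → act P t n + y) (act-⊕ Q S t n) ⟨
                        act P t n + act (Q ⊕ S) t n             ≡⟨ act-⊕ P (Q ⊕ S) t n ⟨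
                        act (P ⊕ (Q ⊕ S)) t n                   ∎ }
                  ; identity = (λ P → exact λ n → ≡.refl) ,
                               (λ P → exact λ n → ≡.trans (act-⊕ P [] t n) (ℤ.+-identityʳ _)) }
                ; inverse = (λ P → exact λ n → ≡.trans (act-⊕ (neg P) P t n) (≡.trans
                              (cong (_+ act P t n) (act-scale (- 1ℤ) P t n)) (cancelˡ (act P t n)))) ,
                            (λ P → exact λ n → ≡.trans (act-⊕ P (neg P) t n) (≡.trans
                              (cong (λ y → act P t n + y) (act-scale (- 1ℤ) P t n)) (cancelʳ (act P t n))))
                ; ⁻¹-cong = λ {P} {Q} (pointwise e) → pointwise λ n → ≅-trans (≅-reflexive (act-scale (- 1ℤ) P t n))
                    (≅-trans (≅-*-cong (≅-refl { - 1ℤ}) (e n)) (≅-reflexive (≡.sym (act-scale (- 1ℤ) Q t n)))) }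
              ; comm = λ P Q → exact λ n → ≡.trans (act-⊕ P Q t n)
                  (≡.trans (ℤ.+-comm (act P t n) _) (≡.sym (act-⊕ Q P t n))) }
            -- The right factor acts on t first, so it can be replaced directly; the left factor is
            -- replaced after commuting.
            ; *-cong = λ {P} {P′} {Q} {Q′} e f → ≈-trans (⊛-congˡ P f)
                (≈-trans (⊛-comm P Q′) (≈-trans (⊛-congˡ Q′ e) (⊛-comm Q′ P′)))
            ; *-assoc = λ P Q S → exact λ n → begin
                act (P ⊛ Q ⊛ S) t n        ≡⟨ act-⊛ (P ⊛ Q) S t n ⟩
                act (P ⊛ Q) (act S t) n    ≡⟨ act-⊛ P Q (act S t) n ⟩
                act P (act Q (act S t)) n  ≡⟨ act-≗ P (act-⊛ Q S t) n ⟨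
                act P (act (Q ⊛ S) t) n    ≡⟨ act-⊛ P (Q ⊛ S) t n ⟨
                act (P ⊛ (Q ⊛ S)) t n      ∎
            ; *-identity = (λ P → exact λ n → ≡.trans (act-⊛ (1ℤ ∷ []) P t n) (act-1 (act P t) n)) ,
                           (λ P → ≈-trans (⊛-comm P (1ℤ ∷ [])) (exact λ n →
                             ≡.trans (act-⊛ (1ℤ ∷ []) P t n) (act-1 (act P t) n)))
            ; distrib = ⊛-distribˡ , λ P Q S → ≈-trans (⊛-comm (Q ⊕ S) P)
                (≈-trans (⊛-distribˡ P Q S) (⊕-cong (⊛-comm P Q) (⊛-comm P S))) }
          ; *-comm = ⊛-comm } }
        where
        open ≡-Reasoning
        cancelˡ : ∀ x → - 1ℤ * x + x ≡ 0ℤ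
        cancelˡ = solve-∀
        cancelʳ : ∀ x → x + - 1ℤ * x ≡ 0ℤ
        cancelʳ = solve-∀

-- A nonzero periodic sequence divisible by X^(N/ℓ) - 1 for all primes ℓ dividing N.

module Seeds where

  open import Data.Nat as ℕ using (ℕ; zero; suc; NonZero; s≤s; z≤n; _+_; _*_; _∸_; _^_; _<_; _≤_)
  open import Data.Nat.Divisibility
  open import Data.Nat.Primality
    using (Prime; prime?; prime⇒irreducible; prime⇒nonZero; prime⇒nonTrivial; euclidsLemma; ¬prime[1])
  open import Data.Nat.Primality.Factorisation using (factorise)
  open import Data.Nat.Coprimality using (Coprime; coprime-divisor)
  open import Data.Nat.ListAction using (product)
  open import Data.Integer as ℤ using (ℤ; 0ℤ; 1ℤ; _-_)
  open import Data.List using ([]; _∷_)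
  open import Data.List.Relation.Unary.All using ([]; _∷_)
  open import Relation.Nullary.Decidable using (_×-dec_)
  open import Relation.Binary.PropositionalEquality as ≡ using (_≡_; cong; cong₂; subst)
  open import Algebra.Properties.CommutativeSemigroup ℕ.+-commutativeSemigroup using (xy∙z≈xz∙y)
  open Congruences
  open ShiftRings using (Sequence)

  prime-divisor : ∀ n → 2 ≤ n → ∃ λ ℓ → Prime ℓ × ℓ ∣ n
  prime-divisor n 2≤n with factorise n {{ℕ.>-nonZero (ℕ.<-trans (s≤s z≤n) 2≤n)}}
  ... | record { factors = [] ; isFactorisation = n≡1 } =
        ⊥-elim (ℕ.<⇒≢ 2≤n (≡.sym n≡1))
  ... | record { factors = ℓ ∷ ps ; isFactorisation = n≡ ; factorsPrime = ℓ-prime ∷ _ } =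
        ℓ , ℓ-prime , divides (product ps) (≡.trans n≡ (ℕ.*-comm ℓ _))

  prime∣prime^ : ∀ {ℓ b} e → Prime ℓ → Prime b → ℓ ∣ b ^ e → ℓ ≡ b
  prime∣prime^ zero ℓ-prime _ ℓ∣1 = ⊥-elim (¬prime[1] (subst Prime (∣1⇒≡1 ℓ∣1) ℓ-prime))
  prime∣prime^ {ℓ} {b} (suc e) ℓ-prime b-prime d with euclidsLemma b (b ^ e) ℓ-prime d
  ... | inj₂ d′ = prime∣prime^ e ℓ-prime b-prime d′
  ... | inj₁ ℓ∣b with prime⇒irreducible b-prime ℓ∣b
  ...   | inj₁ ℓ≡1 = ⊥-elim (¬prime[1] (subst Prime ℓ≡1 ℓ-prime))
  ...   | inj₂ ℓ≡b = ℓ≡b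

  prime⇒coprime′ : ∀ {d b} → Prime b → ¬ b ∣ d → Coprime d b
  prime⇒coprime′ b-prime b∤d (i∣d , i∣b) with prime⇒irreducible b-prime i∣b
  ... | inj₁ i≡1 = i≡1
  ... | inj₂ ≡.refl = ⊥-elim (b∤d i∣d)

  ∣m+n∣n⇒∣m : ∀ {d} m {n} → d ∣ m + n → d ∣ n → d ∣ m
  ∣m+n∣n⇒∣m {d} m {n} d∣m+n = ∣m+n∣m⇒∣n (subst (d ∣_) (ℕ.+-comm m n) d∣m+n)

  maximal-power : ∀ b N k → ¬ b ^ k ∣ N → ∃ λ e → b ^ e ∣ N × ¬ b ^ suc e ∣ N
  maximal-power b N zero    b^k∤N = ⊥-elim (b^k∤N (1∣ N))
  maximal-power b N (suc k) b^k∤N with b ^ k ∣? N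
  ... | yes d = k , d , b^k∤N
  ... | no ¬d = maximal-power b N k ¬d

  n<b^n : ∀ {b} → 2 ≤ b → ∀ n → n < b ^ n
  n<b^n 2≤b zero = s≤s z≤n
  n<b^n {b} 2≤b (suc n) = begin
    2 + n             ≤⟨ ℕ.+-monoʳ-≤ 1 (n<b^n 2≤b n) ⟩
    1 + b ^ n         ≤⟨ ℕ.+-monoˡ-≤ (b ^ n) (ℕ.≤-trans (s≤s z≤n) (n<b^n 2≤b n)) ⟩
    b ^ n + b ^ n     ≡⟨ cong (λ y → b ^ n + y) (ℕ.+-identityʳ (b ^ n)) ⟨
    2 * b ^ n         ≤⟨ ℕ.*-monoˡ-≤ (b ^ n) 2≤b ⟩
    b * b ^ n         ∎
    where open ℕ.≤-Reasoning

  -- d is the full power of b in N, and c = N/b is one factor b short of it. Thus a shift by c moves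
  -- multiples of d to non-multiples.
  primary-divisor : ∀ {b N} c .{{_ : NonZero N}} → Prime b → N ≡ c * b →
    ∃ λ d → d ∣ N × ¬ d ∣ c × (∀ {ℓ} → Prime ℓ → ℓ ∣ d → ℓ ≡ b)
  primary-divisor {b} {N} c b-prime N≡
    with maximal-power b N N (λ d → ℕ.<⇒≱ (n<b^n (ℕ.nonTrivial⇒n>1 b {{prime⇒nonTrivial b-prime}}) N) (∣⇒≤ d))
  ... | e , d∣N , bd∤N = b ^ e , d∣N ,
    (λ d∣c → bd∤N (subst (b ^ suc e ∣_) (≡.trans (ℕ.*-comm b c) (≡.sym N≡)) (*-monoʳ-∣ b d∣c))) ,
    (λ ℓ-prime → prime∣prime^ e ℓ-prime b-prime)

  Periodic : ℕ → Sequence → Set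
  Periodic N s = ∀ n → s (n + N) ≡ s n

  module _ (p N : ℕ) .{{_ : NonZero N}} (1≇0 : ¬ Congruence._≅_ p 1ℤ 0ℤ) where

    open Congruence p

    SmallPrime : ℕ → ℕ → Set
    SmallPrime b ℓ = Prime ℓ × ℓ ∣ N × ℓ < b

    -- The product of the shift differences t(n + N/ℓ) − t(n) over the primes ℓ < b dividing N,
    -- applied to the indicator of N ℤ.
    record Seed (b : ℕ) : Set where
      field
        seq      : Sequence
        periodic : Periodic N seq
        index    : ℕ
        nonzero  : ¬ seq index ≅ 0ℤ
        -- For the primes not yet treated the sequence still lives on multiples of d; this keeps the
        -- next difference from vanishing.
        support  : ∀ {d} → d ∣ N → (∀ {ℓ} → SmallPrime b ℓ → ¬ ℓ ∣ d) →
                   ∀ n → ¬ seq n ≅ 0ℤ → d ∣ n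
        factor   : ∀ {ℓ c} → SmallPrime b ℓ → N ≡ c * ℓ →
                   ∃ λ w → Periodic N w × (∀ n → seq n ≡ w (n + c) - w n)

    indicator : Sequence
    indicator n with N ∣? n
    ... | yes _ = 1ℤ
    ... | no _  = 0ℤ

    indicator-periodic : Periodic N indicator
    indicator-periodic n with N ∣? n + N | N ∣? n
    ... | yes _ | yes _ = ≡.refl
    ... | no _  | no _  = ≡.refl
    ... | yes d | no ¬d = ⊥-elim (¬d (∣m+n∣n⇒∣m n d ∣-refl))
    ... | no ¬d | yes d = ⊥-elim (¬d (∣m∣n⇒∣m+n d ∣-refl))

    initial : Seed 0
    initial = record
      { seq = indicator
      ; periodic = indicator-periodic
      ; index = 0
      ; nonzero = at-0
      ; support = λ d∣N _ n → support d∣N n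
      ; factor = λ { (_ , _ , ()) } }
      where
      at-0 : ¬ indicator 0 ≅ 0ℤ
      at-0 e with N ∣? 0
      ... | yes _ = 1≇0 e
      ... | no ¬d = ¬d (N ∣0)
      support : ∀ {d} → d ∣ N → ∀ n → ¬ indicator n ≅ 0ℤ → d ∣ n
      support d∣N n ≇0 with N ∣? n
      ... | yes N∣n = ∣-trans d∣N N∣n
      ... | no _    = ⊥-elim (≇0 ≅-refl)

    skip : ∀ {b} → ¬ (Prime b × b ∣ N) → Seed b → Seed (suc b)
    skip {b} ¬b s = record
      { Seed s
      ; support = λ d∣N coprime → Seed.support s d∣N
          (λ (ℓ-prime , ℓ∣N , ℓ<b) → coprime (ℓ-prime , ℓ∣N , ℕ.m<n⇒m<1+n ℓ<b))
      ; factor = λ (ℓ-prime , ℓ∣N , ℓ≤b) → Seed.factor s (ℓ-prime , ℓ∣N ,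
          ℕ.≤∧≢⇒< (ℕ.≤-pred ℓ≤b) (λ { ≡.refl → ¬b (ℓ-prime , ℓ∣N) })) }

    difference : ℕ → Sequence → Sequence
    difference c s n = s (n + c) - s n

    difference-periodic : ∀ c {s} → Periodic N s → Periodic N (difference c s)
    difference-periodic c {s} per n =
      cong₂ _-_ (≡.trans (cong s (xy∙z≈xz∙y n N c)) (per (n + c))) (per n)

    -- A degree count could not show that the product of the X^(N/ℓ) - 1 is nonzero modulo X^N - 1,
    -- since the N/ℓ may add up to more than N. The argument follows supports instead.
    extend : ∀ {b c} → Prime b → N ≡ c * b → Seed b → Seed (suc b)
    extend {b} {c} b-prime N≡ s = record
      { seq = difference c seq
      ; periodic = difference-periodic c periodic
      ; index = index′
      ; nonzero = λ e → nonzero (≅-trans (≅-reflexive (restore (seq index) (seq index′)))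
          (≅-trans (≅-+-cong (≅-trans (≅-reflexive (cong (_- seq index′) (≡.sym (≡.trans (cong seq index′+c) (periodic index))))) e)
            vanish) ≅-refl))
      ; support = support′
      ; factor = factor′ }
      where
      open Seed s
      c≤N : c ≤ N
      c≤N = subst (c ≤_) (≡.sym N≡) (ℕ.m≤m*n c b {{prime⇒nonZero b-prime}})
      -- This is index - c modulo the period. The difference at `index′` is seq index - seq index′,
      -- and the second term will vanish.
      index′ = index + (N ∸ c)
      index′+c : index′ + c ≡ index + N
      index′+c = ≡.trans (ℕ.+-assoc index _ c) (cong (λ y → index + y) (ℕ.m∸n+n≡m c≤N))
      restore : ∀ x y → x ≡ (x - y) ℤ.+ y
      restore = solve-∀
      -- Otherwise both positions would be multiples of the full power d of b in N, so d would
      -- divide N ∸ c and therefore c.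
      vanish : seq index′ ≅ 0ℤ
      vanish with seq index′ ≅? 0ℤ
      ... | yes e = e
      ... | no ≇0 with primary-divisor c b-prime N≡
      ...   | d , d∣N , d∤c , only-b = ⊥-elim (d∤c (∣m+n∣m⇒∣n (subst (d ∣_) (≡.sym (ℕ.m∸n+n≡m c≤N)) d∣N)
              (∣m+n∣m⇒∣n (support d∣N coprime index′ ≇0) (support d∣N coprime index nonzero))))
        where
        coprime : ∀ {ℓ} → SmallPrime b ℓ → ¬ ℓ ∣ d
        coprime (ℓ-prime , _ , ℓ<b) ℓ∣d = ℕ.<⇒≢ ℓ<b (only-b ℓ-prime ℓ∣d)
      support′ : ∀ {d} → d ∣ N → (∀ {ℓ} → SmallPrime (suc b) ℓ → ¬ ℓ ∣ d) →
        ∀ n → ¬ difference c seq n ≅ 0ℤ → d ∣ n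
      support′ {d} d∣N coprime n ≇0 with seq n ≅? 0ℤ | seq (n + c) ≅? 0ℤ
      ... | yes e | yes e′ = ⊥-elim (≇0 (≅-+-cong e′ (≅--cong e)))
      ... | no ≇  | _      = support d∣N (λ (ℓ-prime , ℓ∣N , ℓ<b) → coprime (ℓ-prime , ℓ∣N , ℕ.m<n⇒m<1+n ℓ<b)) n ≇
      -- d is prime to b and divides c b, so it divides c, and shifting by c stays within the
      -- multiples of d.
      ... | _     | no ≇   = ∣m+n∣n⇒∣m n
              (support d∣N (λ (ℓ-prime , ℓ∣N , ℓ<b) → coprime (ℓ-prime , ℓ∣N , ℕ.m<n⇒m<1+n ℓ<b)) (n + c) ≇)
              (coprime-divisor {d} {b} {c} (prime⇒coprime′ b-prime (coprime (b-prime , divides c N≡ , ℕ.≤-refl)))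
                (subst (d ∣_) (≡.trans N≡ (ℕ.*-comm c b)) d∣N))
      factor′ : ∀ {ℓ c′} → SmallPrime (suc b) ℓ → N ≡ c′ * ℓ →
        ∃ λ w → Periodic N w × (∀ n → difference c seq n ≡ w (n + c′) - w n)
      factor′ {ℓ} {c′} (ℓ-prime , ℓ∣N , ℓ≤b) N≡′ with ℓ ℕ.≟ b
      ... | yes ≡.refl = seq , periodic , λ n → cong (λ k → seq (n + k) - seq n)
              (ℕ.*-cancelʳ-≡ c c′ ℓ {{prime⇒nonZero b-prime}} (≡.trans (≡.sym N≡) N≡′))
      ... | no ℓ≢b with factor (ℓ-prime , ℓ∣N , ℕ.≤∧≢⇒< (ℕ.≤-pred ℓ≤b) ℓ≢b) N≡′
      ...   | w , w-periodic , seq≡ = difference c w , difference-periodic c w-periodic , λ n →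
              ≡.trans (cong₂ _-_ (seq≡ (n + c)) (seq≡ n))
                (≡.trans (regroup (w (n + c + c′)) (w (n + c)) (w (n + c′)) (w n))
                  (cong (λ k → (w k - w (n + c′)) - (w (n + c) - w n)) (xy∙z≈xz∙y n c c′)))
        where
        regroup : ∀ x y z u → (x - y) - (z - u) ≡ (x - z) - (y - u)
        regroup = solve-∀

    seed : ∀ b → Seed b
    seed zero = initial
    seed (suc b) with prime? b ×-dec b ∣? N
    ... | no ¬b = skip ¬b (seed b)
    ... | yes (b-prime , divides c N≡) = extend {c = c} b-prime N≡ (seed b)

-- A field of polynomials acting on a sequence, with X of exact order N.

module FiniteFields where

  import Data.Nat.Divisibility as ℕ∣
  open import Data.Nat.GCD using (gcd; gcd[m,n]∣m; gcd[m,n]∣n; gcd-GCD; module Bézout)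
  open import Data.Nat.Primality using (Prime; prime⇒nonZero; prime⇒nonTrivial)
  open import Data.Integer as ℤ using (ℤ; 0ℤ; 1ℤ)
  open import Data.Integer.DivMod using (_%ℕ_; n%ℕd<d)
  open import Data.List
    using (List; []; _∷_; map; length; _∷ʳ_; initLast; _∷ʳ′_; upTo; cartesianProductWith; replicate)
  open import Data.List.Properties using (length-++; length-replicate)
  open import Data.List.Membership.Propositional.Properties using (∈-map⁺; ∈-upTo⁺; ∈-cartesianProductWith⁺)
  open import Data.List.Relation.Unary.Any using (here)
  open import Relation.Nullary.Decidable using (map′)
  open import Relation.Binary.PropositionalEquality as ≡ using (_≡_; cong; cong₂; subst)
  open Congruences
  open Frobenius
  open Roots using (Cancellative)
  open ShiftRings hiding (_≈_)
  open Seeds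
  open SidonSets

  module FixedPower (R : CommutativeRing 0ℓ 0ℓ) where
    open CommutativeRing R
    open import Algebra.Properties.CommutativeSemiring.Exp commutativeSemiring
    open import Algebra.Properties.Ring (CommutativeRing.ring R) using (x∙y⁻¹≈ε⇒x≈y; -‿distribˡ-*)
    open Powers R
    open import Relation.Binary.Reasoning.Setoid setoid

    ^-combine : ∀ x {a b d} k l → d ℕ.+ l ℕ.* b ≡ k ℕ.* a → x ^ a ≈ 1# → x ^ b ≈ 1# → x ^ d ≈ 1#
    ^-combine x {a} {b} {d} k l e x^a≈1 x^b≈1 = begin
      x ^ d                     ≈⟨ *-identityʳ _ ⟨
      x ^ d * 1#                ≈⟨ *-congˡ (^*≈1 x b l x^b≈1) ⟨
      x ^ d * x ^ (l ℕ.* b)     ≈⟨ ^-homo-* x d (l ℕ.* b) ⟨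
      x ^ (d ℕ.+ l ℕ.* b)       ≡⟨ cong (x ^_) e ⟩
      x ^ (k ℕ.* a)             ≈⟨ ^*≈1 x a k x^a≈1 ⟩
      1#                        ∎

    ^-gcd : ∀ x a b → x ^ a ≈ 1# → x ^ b ≈ 1# → x ^ gcd a b ≈ 1#
    ^-gcd x a b x^a≈1 x^b≈1 with Bézout.identity (gcd-GCD a b)
    ... | Bézout.+- k l e = ^-combine x k l e x^a≈1 x^b≈1
    ... | Bézout.-+ k l e = ^-combine x l k e x^b≈1 x^a≈1

    -- An order smaller than N would divide N/ℓ for some prime ℓ.
    exact-order : ∀ x N .{{_ : NonZero N}} → x ^ N ≈ 1# →
      (∀ {ℓ} c → Prime ℓ → N ≡ c ℕ.* ℓ → x ^ c ≉ 1#) →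
      ∀ i → x ^ i ≈ 1# → i ℕ.< N → i ≡ 0
    exact-order x N x^N≈1 ≉1 zero _ _ = ≡.refl
    exact-order x N x^N≈1 ≉1 i@(suc _) x^i≈1 i<N with gcd[m,n]∣n i N
    ... | ℕ∣.divides k N≡k*d = ⊥-elim (not-prime (prime-divisor k (2≤k k N≡k*d)))
      where
      d = gcd i N
      2≤k : ∀ k → N ≡ k ℕ.* d → 2 ℕ.≤ k
      2≤k zero e = ⊥-elim (ℕ.≢-nonZero⁻¹ N e)
      2≤k (suc zero) e = ⊥-elim (ℕ.<⇒≱ i<N (subst (ℕ._≤ i) (≡.sym (≡.trans e (ℕ.+-identityʳ d)))
        (ℕ∣.∣⇒≤ (gcd[m,n]∣m i N))))
      2≤k (suc (suc k)) e = s≤s (s≤s z≤n)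
      not-prime : (∃ λ ℓ → Prime ℓ × ℓ ℕ∣.∣ k) → ⊥
      not-prime (ℓ , ℓ-prime , ℕ∣.divides j k≡j*ℓ) =
        ≉1 (j ℕ.* d) ℓ-prime (≡.trans N≡k*d (≡.trans (cong (ℕ._* d) k≡j*ℓ) (swap j ℓ d)))
          (^*≈1 x d j (^-gcd x i N x^i≈1 x^N≈1))
        where
        swap : ∀ j ℓ d → j ℕ.* ℓ ℕ.* d ≡ j ℕ.* d ℕ.* ℓ
        swap j ℓ d = ≡.trans (ℕ.*-assoc j ℓ d) (≡.trans (cong (j ℕ.*_) (ℕ.*-comm ℓ d)) (≡.sym (ℕ.*-assoc j d ℓ)))

    module Exponent (n : ℕ) (fixed : ∀ x → x ^ suc (suc n) ≈ x) where

      power-idempotent : ∀ x → x ^ suc n * x ^ suc n ≈ x ^ suc n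
      power-idempotent x = begin
        (x * x ^ n) * x ^ suc n   ≈⟨ *-congʳ (*-comm x (x ^ n)) ⟩
        (x ^ n * x) * x ^ suc n   ≈⟨ *-assoc _ _ _ ⟩
        x ^ n * x ^ suc (suc n)   ≈⟨ *-congˡ (fixed x) ⟩
        x ^ n * x                 ≈⟨ *-comm _ _ ⟩
        x ^ suc n                 ∎

      -- The fixed exponent is at least 2, so x equals a multiple of its own square.
      reduced : ∀ x → x * x ≈ 0# → x ≈ 0#
      reduced x xx≈0 = begin
        x                  ≈⟨ fixed x ⟨
        x * (x * x ^ n)    ≈⟨ *-assoc _ _ _ ⟨
        (x * x) * x ^ n    ≈⟨ *-congʳ xx≈0 ⟩
        0# * x ^ n         ≈⟨ zeroˡ _ ⟩
        0#                 ∎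

      module _ (1≉0 : 1# ≉ 0#) (split : ∀ x → x ^ suc n ≈ 0# ⊎ x ^ suc n ≈ 1#) where

        -- If x^N is 0, then x = x x^N is 0. If both powers are 1, then so is (x y)^N, which is 0.
        zero-divisor : ∀ x y → x * y ≈ 0# → x ≈ 0# ⊎ y ≈ 0#
        zero-divisor x y xy≈0 with split x | split y
        ... | inj₁ x^≈0 | _ = inj₁ (trans (sym (fixed x)) (trans (*-congˡ x^≈0) (zeroʳ x)))
        ... | inj₂ _ | inj₁ y^≈0 = inj₂ (trans (sym (fixed y)) (trans (*-congˡ y^≈0) (zeroʳ y)))
        ... | inj₂ x^≈1 | inj₂ y^≈1 = ⊥-elim (1≉0 (begin
          1#                        ≈⟨ *-identityˡ 1# ⟨
          1# * 1#                   ≈⟨ *-cong x^≈1 y^≈1 ⟨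
          x ^ suc n * y ^ suc n     ≈⟨ ^-distrib-* x y (suc n) ⟨
          (x * y) ^ suc n           ≈⟨ ^-congˡ (suc n) xy≈0 ⟩
          0# ^ suc n                ≈⟨ zeroˡ _ ⟩
          0#                        ∎))

        cancel : Cancellative R
        cancel x y z e with zero-divisor (x - y) z (begin
          (x - y) * z          ≈⟨ distribʳ z x (- y) ⟩
          x * z + - y * z      ≈⟨ +-cong e (sym (-‿distribˡ-* y z)) ⟩
          y * z - y * z        ≈⟨ -‿inverseʳ _ ⟩
          0#                   ∎)
        ... | inj₁ x-y≈0 = inj₁ (x∙y⁻¹≈ε⇒x≈y x y x-y≈0)
        ... | inj₂ z≈0   = inj₂ z≈0

  -- Powers of polynomials that do not depend on t, unlike `_^_`, which belongs to a ring that
  -- changes with every refinement.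
  pow : Poly → ℕ → Poly
  pow P zero    = 1ℤ ∷ []
  pow P (suc n) = P ⊛ pow P n

  X : Poly
  X = 0ℤ ∷ 1ℤ ∷ []

  act-X : ∀ s n → act X s n ≡ s (suc n)
  act-X s n = ≡.trans (ℤ.+-identityˡ _) (act-1 s (suc n))

  act-X^ : ∀ k s n → act (pow X k) s n ≡ s (n ℕ.+ k)
  act-X^ zero    s n = ≡.trans (act-1 s n) (cong s (≡.sym (ℕ.+-identityʳ n)))
  act-X^ (suc k) s n = ≡.trans (act-⊛ X (pow X k) s n) (≡.trans (act-X (act (pow X k) s) n)
    (≡.trans (act-X^ k s (suc n)) (cong s (≡.sym (ℕ.+-suc n k)))))

  act-periodic : ∀ {N s} P → Periodic N s → Periodic N (act P s)
  act-periodic {N} {s} P per n = ≡.trans (≡.sym (act-shift N P s n)) (act-≗ P per n)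

  periodic-+* : ∀ {N s} → Periodic N s → ∀ j n → s (n ℕ.+ j ℕ.* N) ≡ s n
  periodic-+* {s = s} per zero n = cong s (ℕ.+-identityʳ n)
  periodic-+* {N} {s} per (suc j) n = ≡.trans (cong s (shuffle n N (j ℕ.* N)))
    (≡.trans (per (n ℕ.+ j ℕ.* N)) (periodic-+* per j n))
    where
    shuffle : ∀ n N m → n ℕ.+ (N ℕ.+ m) ≡ n ℕ.+ m ℕ.+ N
    shuffle n N m = ≡.trans (cong (n ℕ.+_) (ℕ.+-comm N m)) (≡.sym (ℕ.+-assoc n m N))

  -- For the length N these p^N lists represent every polynomial modulo p and X^N - 1; this is what
  -- makes the refinement finite.
  words : ℕ → ℕ → List Poly
  words p zero    = [] ∷ []
  words p (suc N) = cartesianProductWith _∷_ (map ℤ.+_ (upTo p)) (words p N)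

  ∈-words : ∀ {p} w → All (_∈ map ℤ.+_ (upTo p)) w → w ∈ words p (length w)
  ∈-words [] [] = here ≡.refl
  ∈-words (a ∷ w) (a∈ ∷ w∈) = ∈-cartesianProductWith⁺ _∷_ a∈ (∈-words w w∈)

  module _ (p n : ℕ) (p-prime : Prime p) where
    open Congruence p

    N : ℕ
    N = suc n

    private instance
      p≢0 : NonZero p
      p≢0 = prime⇒nonZero p-prime

    1≇0 : ¬ 1ℤ ≅ 0ℤ
    1≇0 (mod d) = ℕ.<⇒≢ (ℕ.nonTrivial⇒n>1 p {{prime⇒nonTrivial p-prime}}) (≡.sym (ℕ∣.∣1⇒≡1 (∣⇒∣ᵤ d)))
      where open import Data.Integer.Divisibility.Signed using (∣⇒∣ᵤ)

    residue∈ : ∀ a → ℤ.+ (a %ℕ p) ∈ map ℤ.+_ (upTo p)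
    residue∈ a = ∈-map⁺ ℤ.+_ (∈-upTo⁺ (n%ℕd<d a p))

    act-∷ʳ : ∀ w z s k → act (w ∷ʳ z) s k ≡ act w s k ℤ.+ z ℤ.* s (length w ℕ.+ k)
    act-∷ʳ [] z s k = ≡.trans (ℤ.+-identityʳ (z ℤ.* s k)) (≡.sym (ℤ.+-identityˡ (z ℤ.* s k)))
    act-∷ʳ (a ∷ w) z s k = ≡.trans (cong (λ y → a ℤ.* s k ℤ.+ y) (act-∷ʳ w z s (suc k)))
      (≡.trans (≡.sym (ℤ.+-assoc (a ℤ.* s k) _ _))
        (cong (λ j → a ℤ.* s k ℤ.+ act w s (suc k) ℤ.+ z ℤ.* s j) (ℕ.+-suc (length w) k)))

    -- Multiplication by X rotates the coefficients.
    reduce : ∀ P → ∃ λ w → w ∈ words p N × (∀ s → Periodic N s → ∀ k → act P s k ≅ act w s k)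
    reduce P = let (w , length≡ , w∈ , e) = word P in w , subst (λ l → w ∈ words p l) length≡ (∈-words w w∈) , e
      where
      zero∈ : 0ℤ ∈ map ℤ.+_ (upTo p)
      zero∈ = ∈-map⁺ ℤ.+_ (∈-upTo⁺ (ℕ.>-nonZero⁻¹ p))
      act-zeros : ∀ j s k → act (replicate j 0ℤ) s k ≡ 0ℤ
      act-zeros zero    s k = ≡.refl
      act-zeros (suc j) s k = ≡.trans (ℤ.+-identityˡ _) (act-zeros j s (suc k))
      word : ∀ P → ∃ λ w → length w ≡ N × All (_∈ map ℤ.+_ (upTo p)) w ×
        (∀ s → Periodic N s → ∀ k → act P s k ≅ act w s k)
      word [] = replicate N 0ℤ , length-replicate N , All.replicate⁺ N zero∈ ,
        λ s _ k → ≅-reflexive (≡.sym (act-zeros N s k))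
      word (a ∷ P) with word P
      ... | w , length≡ , w∈ , e with initLast w
      word (a ∷ P) | _ , () , _ | []
      ... | w′ ∷ʳ′ z = b ∷ w′ , length′ , residue∈ (a ℤ.+ z) ∷ All.++⁻ˡ w′ w∈ , agree
        where
        b = ℤ.+ ((a ℤ.+ z) %ℕ p)
        length′ : suc (length w′) ≡ N
        length′ = ≡.trans (ℕ.+-comm 1 _) (≡.trans (≡.sym (length-++ w′)) length≡)
        regroup : ∀ a x y z → a ℤ.* x ℤ.+ (y ℤ.+ z ℤ.* x) ≡ (a ℤ.+ z) ℤ.* x ℤ.+ y
        regroup = solve-∀
        agree : ∀ s → Periodic N s → ∀ k → act (a ∷ P) s k ≅ act (b ∷ w′) s k
        agree s per k = ≅-trans (≅-+-cong (≅-refl {a ℤ.* s k}) (e s per (suc k))) (≅-trans (≅-reflexive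
          (≡.trans (cong (λ y → a ℤ.* s k ℤ.+ y) (≡.trans (act-∷ʳ w′ z s (suc k))
              (cong (λ y → act w′ s (suc k) ℤ.+ z ℤ.* y) (≡.trans (cong s wrap) (per k)))))
            (regroup a (s k) (act w′ s (suc k)) z)))
          (≅-+-cong (≅-*-cong (%ℕ-≅ (a ℤ.+ z)) (≅-refl {s k})) ≅-refl))
          where
          wrap : length w′ ℕ.+ suc k ≡ k ℕ.+ N
          wrap = ≡.trans (ℕ.+-suc (length w′) k) (≡.trans (cong (ℕ._+ k) length′) (ℕ.+-comm N k))

    zero? : ∀ s → Periodic N s → Dec (∀ k → s k ≅ 0ℤ)
    zero? s per = map′ (λ z k → subst (_≅ 0ℤ) (mod-N k) (z (ℕ.m%n<n k N))) (λ z {k} _ → z k)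
      (ℕ.allUpTo? (λ k → s k ≅? 0ℤ) N)
      where
      mod-N : ∀ k → s (k ℕ.% N) ≡ s k
      mod-N k = ≡.trans (≡.sym (periodic-+* per (k ℕ./ N) (k ℕ.% N)))
        (cong s (≡.sym (ℕ.m≡m%n+[m/n]*n k N)))

    module _ (K : ℕ) (p^K≡ : p ℕ.^ K ≡ suc N) where

      module PeriodicRing (t : Sequence) (t-periodic : Periodic N t) where
        ring′ : CommutativeRing 0ℓ 0ℓ
        ring′ = sequenceRing p t
        open CommutativeRing ring′ public
        open import Algebra.Properties.CommutativeSemiring.Exp commutativeSemiring public
        open import Algebra.Properties.Semiring.Mult semiring public using () renaming (_×_ to _·_)
        open FrobeniusMap ring′ public
        open Powers ring′
        open import Relation.Binary.Reasoning.Setoid setoid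

        ^≡pow : ∀ P k → P ^ k ≡ pow P k
        ^≡pow P zero    = ≡.refl
        ^≡pow P (suc k) = cong (P ⊛_) (^≡pow P k)

        act-· : ∀ m k → act (m · 1#) t k ≡ ℤ.+ m ℤ.* t k
        act-· zero    k = ≡.refl
        act-· (suc m) k = ≡.trans (act-⊕ 1# (m · 1#) t k) (≡.trans (cong₂ ℤ._+_ (act-1 t k) (act-· m k))
          (≡.trans (cong (λ y → y ℤ.+ ℤ.+ m ℤ.* t k) (≡.sym (ℤ.*-identityˡ (t k)))) (≡.sym (ℤ.*-distribʳ-+ (t k) 1ℤ (ℤ.+ m)))))

        characteristic : p · 1# ≈ 0#
        characteristic = pointwise λ k → ≅-trans (≅-reflexive (≡.trans (act-· p k) (ℤ.*-comm (ℤ.+ p) (t k))))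
          (multiple≅0 (t k))

        frobenius-Q : ∀ x y → (x + y) ^ suc N ≈ x ^ suc N + y ^ suc N
        frobenius-Q = subst (λ Q → ∀ x y → (x + y) ^ Q ≈ x ^ Q + y ^ Q) p^K≡ (frobenius^ p-prime characteristic K)

        -- Fermat's little theorem, by adding 1 repeatedly under the Frobenius map.
        fixed-· : ∀ m → (m · 1#) ^ suc N ≈ m · 1#
        fixed-· zero    = zeroˡ (0# ^ N)
        fixed-· (suc m) = trans (frobenius-Q 1# (m · 1#)) (+-cong (1^≈1 (suc N)) (fixed-· m))

        constant≈· : ∀ a → a ∷ [] ≈ (a %ℕ p) · 1#
        constant≈· a = pointwise λ k → ≅-trans (≅-reflexive (ℤ.+-identityʳ (a ℤ.* t k)))
          (≅-trans (≅-*-cong (%ℕ-≅ a) (≅-refl {t k})) (≅-reflexive (≡.sym (act-· (a %ℕ p) k))))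

        fixed-constant : ∀ a → (a ∷ []) ^ suc N ≈ a ∷ []
        fixed-constant a = trans (^-congˡ (suc N) (constant≈· a)) (trans (fixed-· (a %ℕ p)) (sym (constant≈· a)))

        X^N≈1 : X ^ N ≈ 1#
        X^N≈1 = pointwise λ k → ≅-reflexive (≡.trans (cong (λ P → act P t k) (^≡pow X N))
          (≡.trans (act-X^ N t k) (≡.trans (t-periodic k) (≡.sym (act-1 t k)))))

        ∷≈ : ∀ a P → a ∷ P ≈ (a ∷ []) + X * P
        ∷≈ a P = pointwise λ k → ≅-reflexive (≡.sym (≡.trans (act-⊕ (a ∷ []) (X ⊛ P) t k)
          (cong₂ ℤ._+_ (ℤ.+-identityʳ (a ℤ.* t k)) (≡.trans (act-⊛ X P t k) (act-X (act P t) k)))))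

        fixed : ∀ P → P ^ suc N ≈ P
        fixed [] = zeroˡ ([] ^ N)
        fixed (a ∷ P) = begin
          (a ∷ P) ^ Q                      ≈⟨ ^-congˡ Q (∷≈ a P) ⟩
          ((a ∷ []) + X * P) ^ Q           ≈⟨ frobenius-Q (a ∷ []) (X * P) ⟩
          (a ∷ []) ^ Q + (X * P) ^ Q       ≈⟨ +-cong (fixed-constant a) (^-distrib-* X P Q) ⟩
          (a ∷ []) + X ^ Q * P ^ Q         ≈⟨ +-congˡ (*-cong (trans (*-congˡ {X} {X ^ N} {1#} X^N≈1) (*-identityʳ X)) (fixed P)) ⟩
          (a ∷ []) + X * P                 ≈⟨ ∷≈ a P ⟨
          a ∷ P                            ∎
          where Q = suc N

        _≟_ : ∀ P Q → Dec (P ≈ Q)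
        P ≟ Q = map′ to from (zero? (λ k → act P t k ℤ.- act Q t k)
            (λ k → cong₂ ℤ._-_ (act-periodic P t-periodic k) (act-periodic Q t-periodic k)))
          where
          restore : ∀ x y → x ≡ (x ℤ.- y) ℤ.+ y
          restore = solve-∀
          to : (∀ k → act P t k ℤ.- act Q t k ≅ 0ℤ) → P ≈ Q
          to z = pointwise λ k → ≅-trans (≅-reflexive (restore (act P t k) (act Q t k)))
            (≅-trans (≅-+-cong (z k) ≅-refl) (≅-reflexive (ℤ.+-identityˡ _)))
          from : P ≈ Q → ∀ k → act P t k ℤ.- act Q t k ≅ 0ℤ
          from (pointwise e) k = ≅-trans (≅-+-cong (e k) ≅-refl) (≅-reflexive (ℤ.+-inverseʳ (act Q t k)))

        open FixedPower.Exponent ring′ n fixed public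

      -- In a field one of the two holds for every P.
      Split : Sequence → Poly → Set
      Split t P = (∀ k → act (pow P N) t k ≅ 0ℤ) ⊎ (∀ k → act (pow P N) t k ≅ t k)

      NonZeroSequence : Sequence → Set
      NonZeroSequence t = ¬ (∀ k → t k ≅ 0ℤ)

      -- Either alternative says that some polynomial kills t, and it then kills every multiple of
      -- t. So a polynomial that has been dealt with remains so under further refinement.
      split-act : ∀ R {t} P → Split t P → Split (act R t) P
      split-act R {t} P (inj₁ e) = inj₁ λ k → ≅-trans (≅-reflexive (act-comm (pow P N) R t k))
        (≅-trans (act-cong p R e k) (≅-reflexive (act-0 R k)))
      split-act R {t} P (inj₂ e) = inj₂ λ k → ≅-trans (≅-reflexive (act-comm (pow P N) R t k)) (act-cong p R e k)

      -- The idempotent P^N either kills t or can be used to replace t.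
      refine : ∀ Ps t → Periodic N t → NonZeroSequence t →
        ∃ λ R → NonZeroSequence (act R t) × All (Split (act R t)) Ps
      refine [] t per ≢0 = 1ℤ ∷ [] , (λ z → ≢0 λ k → ≅-trans (≅-reflexive (≡.sym (act-1 t k))) (z k)) , []
      refine (P ∷ Ps) t per ≢0 with refine Ps t per ≢0
      ... | R , ≢0′ , splits with zero? (act (pow P N) (act R t)) (act-periodic (pow P N) (act-periodic R per))
      ...   | yes z = R , ≢0′ , inj₁ z ∷ splits
      ...   | no ¬z = pow P N ⊛ R , (λ z → ¬z λ k → ≅-trans (eq k) (z k)) , inj₂ idempotent ∷ All.map (λ {S} → transport {S}) splits
        where
        t′ = act R t
        module E = PeriodicRing t′ (act-periodic R per)
        eq : ∀ k → act (pow P N) t′ k ≅ act (pow P N ⊛ R) t k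
        eq k = ≅-reflexive (≡.sym (act-⊛ (pow P N) R t k))
        idempotent : ∀ k → act (pow P N) (act (pow P N ⊛ R) t) k ≅ act (pow P N ⊛ R) t k
        idempotent k = ≅-trans (≅-reflexive (≡.trans (act-≗ (pow P N) (act-⊛ (pow P N) R t) k)
            (≡.sym (act-⊛ (pow P N) (pow P N) t′ k))))
          (≅-trans (at (subst (λ Y → E._≈_ (Y ⊛ Y) Y) (E.^≡pow P N) (E.power-idempotent P)) k) (eq k))
        transport : ∀ {S} → Split t′ S → Split (act (pow P N ⊛ R) t) S
        transport {S} sp with split-act (pow P N) {t′} S sp
        ... | inj₁ e = inj₁ λ k → ≅-trans (≅-reflexive (act-≗ (pow S N) (act-⊛ (pow P N) R t) k)) (e k)
        ... | inj₂ e = inj₂ λ k → ≅-trans (≅-reflexive (act-≗ (pow S N) (act-⊛ (pow P N) R t) k))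
                (≅-trans (e k) (eq k))

      act-difference : ∀ c s k → act (pow X c ⊕ scale ℤ.-1ℤ (1ℤ ∷ [])) s k ≡ s (k ℕ.+ c) ℤ.- s k
      act-difference c s k = ≡.trans (act-⊕ (pow X c) (scale ℤ.-1ℤ (1ℤ ∷ [])) s k)
        (cong₂ ℤ._+_ (act-X^ c s k) (≡.trans (ℤ.+-identityʳ (ℤ.-1ℤ ℤ.* s k)) (ℤ.-1*i≡-i (s k))))

      -- If X^c = 1 on t = (X^c − 1) w, then (X^c − 1)² kills w, hence so does X^c − 1.
      difference⇒X^≉1 : ∀ {t w c} → NonZeroSequence t → Periodic N w →
        (∀ k → t k ≡ w (k ℕ.+ c) ℤ.- w k) → ¬ (∀ k → t (k ℕ.+ c) ≅ t k)
      difference⇒X^≉1 {t} {w} {c} t≢0 w-periodic t≡ fix = t≢0 λ k →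
        ≅-trans (≅-reflexive (≡.sym (h-w k))) (at (E.reduced h hh≈0) k)
        where
        module E = PeriodicRing w w-periodic
        h = pow X c ⊕ scale ℤ.-1ℤ (1ℤ ∷ [])
        h-w : ∀ k → act h w k ≡ t k
        h-w k = ≡.trans (act-difference c w k) (≡.sym (t≡ k))
        hh≈0 : E._≈_ (h ⊛ h) []
        hh≈0 = pointwise λ k → ≅-trans (≅-reflexive (≡.trans (act-⊛ h h w k)
            (≡.trans (act-≗ h h-w k) (act-difference c t k))))
          (≅-trans (≅-+-cong (fix k) ≅-refl) (≅-reflexive (ℤ.+-inverseʳ (t k))))

      module _ (k : ℕ) where
        private
          -- Every prime divisor of N lies below `suc N`, so all the required factors are present.
          module S = Seed (seed p N 1≇0 (suc N))

          refined : ∃ λ R → NonZeroSequence (act R S.seq) × All (Split (act R S.seq)) (words p N)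
          refined = refine (words p N) S.seq S.periodic (λ z → S.nonzero (z S.index))

          R : Poly
          R = proj₁ refined

          t : Sequence
          t = act R S.seq

          t≢0 : NonZeroSequence t
          t≢0 = proj₁ (proj₂ refined)

          module E = PeriodicRing t (act-periodic R S.periodic)

          1≉0 : ¬ E._≈_ E.1# E.0#
          1≉0 (pointwise e) = t≢0 λ k → ≅-trans (≅-reflexive (≡.sym (act-1 t k))) (e k)

          split : ∀ P → E._≈_ (P E.^ N) E.0# ⊎ E._≈_ (P E.^ N) E.1#
          split P with reduce P
          ... | w , w∈ , e = case (All.lookup (proj₂ (proj₂ refined)) w∈)
            where
            P^≈w^ : E._≈_ (P E.^ N) (pow w N)
            P^≈w^ = subst (E._≈_ (P E.^ N)) (E.^≡pow w N)
              (E.^-congˡ N {P} {w} (pointwise (e t (act-periodic R S.periodic))))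
            case : Split t w → E._≈_ (P E.^ N) E.0# ⊎ E._≈_ (P E.^ N) E.1#
            case (inj₁ z) = inj₁ (E.trans P^≈w^ (pointwise z))
            case (inj₂ o) = inj₂ (E.trans P^≈w^ (pointwise λ k → ≅-trans (o k) (≅-reflexive (≡.sym (act-1 t k)))))

          -- The factor of the seed passes to its multiple: from seq = (X^c - 1) w follows t = R seq
          -- = (X^c - 1)(R w).
          X^c≉1 : ∀ {ℓ} c → Prime ℓ → N ≡ c ℕ.* ℓ → ¬ E._≈_ (X E.^ c) E.1#
          X^c≉1 {ℓ} c ℓ-prime N≡ X^c≈1
            with S.factor (ℓ-prime , ℕ∣.divides c N≡ , s≤s (ℕ∣.∣⇒≤ (ℕ∣.divides c N≡))) N≡
          ... | w , w-periodic , S≡ = difference⇒X^≉1 {t} {act R w} {c} t≢0 (act-periodic R w-periodic) t≡ fix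
            where
            fix : ∀ k → t (k ℕ.+ c) ≅ t k
            fix k = ≅-trans (≅-reflexive (≡.sym (≡.trans (cong (λ P → act P t k) (E.^≡pow X c)) (act-X^ c t k))))
              (≅-trans (at X^c≈1 k) (≅-reflexive (act-1 t k)))
            flip : ∀ x y → x ℤ.- y ≡ ℤ.-1ℤ ℤ.* y ℤ.+ x
            flip = solve-∀
            t≡ : ∀ k → t k ≡ act R w (k ℕ.+ c) ℤ.- act R w k
            t≡ k = ≡.trans (act-≗ R (λ j → ≡.trans (S≡ j) (flip (w (j ℕ.+ c)) (w j))) k)
              (≡.trans (act-linear R ℤ.-1ℤ w (λ j → w (j ℕ.+ c)) k)
                (≡.trans (cong (λ y → ℤ.-1ℤ ℤ.* act R w k ℤ.+ y) (act-shift c R w k))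
                  (≡.sym (flip (act R w (k ℕ.+ c)) (act R w k)))))

        -- The subfield exponent k is still arbitrary; the relation K = 3 k is imposed in `singer`.
        cyclicDomain : ∃ λ F → CyclicDomain F (p ℕ.^ k) N
        cyclicDomain = E.ring′ , record
          { _≟_         = E._≟_
          ; cancel      = E.cancel 1≉0 split
          ; 1≉0         = 1≉0
          ; frobenius-q = E.frobenius^ p-prime E.characteristic k
          ; fixed       = E.fixed
          ; ω           = X
          ; ω^N≈1       = E.X^N≈1
          ; ω-order     = FixedPower.exact-order E.ring′ X N E.X^N≈1 X^c≉1
          }

-- Singer difference sets for every prime power.

module Existence where

  open import Data.Nat.Primality using (prime⇒nonTrivial; prime⇒nonZero)
  open import Relation.Binary.PropositionalEquality as ≡ using (_≡_; refl; cong; subst)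
  open FiniteFields
  open SidonSets

  square<order : ∀ r v → 1 ℕ.≤ r → v ≡ suc r ℕ.^ 2 ℕ.+ suc r ℕ.+ 1 → suc r ℕ.* suc r ℕ.< r ℕ.* v
  square<order r v 1≤r refl = begin-strict
    suc r ℕ.* suc r      ≡⟨ cong (suc r ℕ.*_) (ℕ.*-identityʳ (suc r)) ⟨
    suc r ℕ.^ 2          <⟨ ℕ.≤-<-trans (ℕ.m≤m+n _ (suc r)) (ℕ.m<m+n _ (s≤s z≤n)) ⟩
    v                    ≤⟨ ℕ.m≤n*m v r {{ℕ.>-nonZero 1≤r}} ⟩
    r ℕ.* v              ∎
    where open ℕ.≤-Reasoning

  cube : ∀ r v → v ≡ suc r ℕ.^ 2 ℕ.+ suc r ℕ.+ 1 → suc r ℕ.^ 3 ≡ suc (r ℕ.* v)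
  cube r v refl = expand r
    where
    expand : ∀ r → suc r ℕ.* (suc r ℕ.* (suc r ℕ.* 1)) ≡ suc (r ℕ.* (suc r ℕ.* (suc r ℕ.* 1) ℕ.+ suc r ℕ.+ 1))
    expand = ℕ-Solver.solve-∀

  singer : ∀ q v → PrimePower q → v ≡ q ℕ.^ 2 ℕ.+ q ℕ.+ 1 → ∃ λ D → Sidon v (suc q) D
  singer q v (p , k , p-prime , 1≤k , q≡p^k) v≡ = build q v q≡p^k v≡ 1<q
    where
    1<q : 1 ℕ.< q
    1<q = subst (1 ℕ.<_) (≡.sym q≡p^k) (begin
      2          ≤⟨ ℕ.nonTrivial⇒n>1 p {{prime⇒nonTrivial p-prime}} ⟩
      p          ≡⟨ ℕ.*-identityʳ p ⟨
      p ℕ.^ 1    ≤⟨ ℕ.^-monoʳ-≤ p {{prime⇒nonZero p-prime}} 1≤k ⟩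
      p ℕ.^ k    ∎)
      where open ℕ.≤-Reasoning
    build : ∀ q v → q ≡ p ℕ.^ k → v ≡ q ℕ.^ 2 ℕ.+ q ℕ.+ 1 → 1 ℕ.< q → ∃ λ D → Sidon v (suc q) D
    build (suc r) v q≡ v≡ (s≤s 1≤r) = field⇒sidon (r ℕ.* v) refl
      where
      -- N is generalised so that it can be matched with `suc n`, the form in which the field is
      -- built.
      field⇒sidon : ∀ N → N ≡ r ℕ.* v → ∃ λ D → Sidon v (suc (suc r)) D
      field⇒sidon zero N≡ with () ← subst (suc r ℕ.* suc r ℕ.<_) (≡.sym N≡) (square<order r v 1≤r v≡)
      field⇒sidon (suc n) N≡ =
        let (F , E) = cyclicDomain p n p-prime (k ℕ.* 3) p^3k≡ k
            E′ = subst (λ q → CyclicDomain F q (suc n)) (≡.sym q≡) E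
            q²<N = subst (suc r ℕ.* suc r ℕ.<_) (≡.sym N≡) (square<order r v 1≤r v≡)
        in BoseSinger.D F (suc r) r v (suc n) refl (s≤s 1≤r) N≡ q²<N E′ ,
           BoseSinger.sidon F (suc r) r v (suc n) refl (s≤s 1≤r) N≡ q²<N E′
        where
        p^3k≡ : p ℕ.^ (k ℕ.* 3) ≡ suc (suc n)
        p^3k≡ = ≡.trans (≡.sym (ℕ.^-*-assoc p k 3)) (≡.trans (cong (ℕ._^ 3) (≡.sym q≡))
          (≡.trans (cube r v v≡) (cong suc (≡.sym N≡))))

-- From a Sidon set modulo g m to a ruler cut at a largest gap modulo m.

module Rulers where

  open import Data.Nat.ListAction using (sum)
  open import Data.Integer as ℤ using (ℤ; +_; 0ℤ; _+_; _*_; _-_; -_; +≤+)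
  open import Data.Integer.DivMod using (_%ℕ_; _/ℕ_; n%ℕd<d; a≡a%ℕn+[a/ℕn]*n)
  open import Data.Integer.Divisibility.Signed as Signed using (divides)
  open import Data.List
    using (List; []; _∷_; map; length; filter; _++_; upTo; concatMap; take; cartesianProduct)
  open import Data.List.Properties using (length-++; length-map; length-upTo; length-take; filter-none)
  open import Data.List.Membership.Propositional.Properties
    using (∈-∃++; ∈-++⁺ˡ; ∈-++⁺ʳ; ∈-++⁻; ∈-map⁺; ∈-map⁻; ∈-upTo⁺; ∈-upTo⁻; ∈-filter⁻; ∈-cartesianProduct⁻; ∈-cartesianProduct⁺; ∈-filter⁺)
  open import Data.List.Relation.Unary.Any as Any using (Any; here; there; any?)
  open import Data.List.Relation.Unary.AllPairs as AllPairs using (AllPairs; []; _∷_)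
  open import Data.List.Relation.Unary.Unique.Propositional using (Unique)
  open import Relation.Unary using (Decidable)
  open import Relation.Binary.PropositionalEquality as ≡ using (_≡_; _≢_; refl; cong; cong₂; subst)
  open Congruences

  -- The pigeonhole principle for a relation instead of a function. The partner of the head is
  -- removed from ys; injectivity ensures that no other element needed it.
  matching : ∀ {A B : Set} {R : A → B → Set} {xs} (ys : List B) → Unique xs →
    (∀ {x} → x ∈ xs → ∃ λ y → y ∈ ys × R x y) →
    (∀ {x x′ y} → R x y → R x′ y → x ≡ x′) →
    length xs ℕ.≤ length ys
  matching ys [] _ _ = z≤n
  matching {R = R} {x ∷ xs} ys (x∉xs ∷ unique) partner injective with partner (here refl)
  ... | y , y∈ , Rxy with ∈-∃++ y∈
  ...   | as , bs , refl = begin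
    suc (length xs)              ≤⟨ s≤s (matching (as ++ bs) unique partner′ injective) ⟩
    suc (length (as ++ bs))      ≡⟨ cong suc (length-++ as) ⟩
    suc (length as ℕ.+ length bs) ≡⟨ ℕ.+-suc _ _ ⟨
    length as ℕ.+ suc (length bs) ≡⟨ length-++ as ⟨
    length (as ++ y ∷ bs)        ∎
    where
    open ℕ.≤-Reasoning
    partner′ : ∀ {x′} → x′ ∈ xs → ∃ λ y′ → y′ ∈ as ++ bs × R x′ y′
    partner′ x′∈ with partner (there x′∈)
    ... | y′ , y′∈ , Rx′y′ with ∈-++⁻ as y′∈
    ...   | inj₁ ∈as         = y′ , ∈-++⁺ˡ ∈as , Rx′y′
    ...   | inj₂ (there ∈bs) = y′ , ∈-++⁺ʳ as ∈bs , Rx′y′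
    ...   | inj₂ (here refl) = ⊥-elim (All.lookup x∉xs x′∈ (injective Rxy Rx′y′))

  -- The first d ≤ b satisfying P, or b if there is none.
  first : ∀ {P : ℕ → Set} → Decidable P → ∀ b →
    ∃ λ d → d ℕ.≤ b × (d ℕ.< b → P d) × (∀ {j} → j ℕ.< d → ¬ P j)
  first P? zero = 0 , z≤n , (λ ()) , λ ()
  first P? (suc b) with P? 0
  ... | yes p = 0 , z≤n , (λ _ → p) , λ ()
  ... | no ¬p with first (λ d → P? (suc d)) b
  ...   | d , d≤b , Pd , below = suc d , s≤s d≤b , (λ { (s≤s lt) → Pd lt }) ,
          λ { {zero} _ → ¬p ; {suc j} (s≤s lt) → below lt }

  maximiser : ∀ {A : Set} (f : A → ℕ) x xs → ∃ λ y → y ∈ x ∷ xs × All (λ z → f z ℕ.≤ f y) (x ∷ xs)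
  maximiser f x [] = x , here refl , ℕ.≤-refl ∷ []
  maximiser f x (x′ ∷ xs) with maximiser f x′ xs
  ... | y , y∈ , max with ℕ.≤-total (f x) (f y)
  ...   | inj₁ x≤y = y , there y∈ , x≤y ∷ max
  ...   | inj₂ y≤x = x , here refl , ℕ.≤-refl ∷ All.map (λ z≤y → ℕ.≤-trans z≤y y≤x) max

  count : ℕ → List ℕ → ℕ
  count j = λ xs → length (filter (ℕ._≟ j) xs)

  filter-⊎ : ∀ {A : Set} {P Q R : A → Set} (P? : Decidable P) (Q? : Decidable Q) (R? : Decidable R) →
    (∀ {x} → P x → Q x ⊎ R x) → ∀ xs →
    length (filter P? xs) ℕ.≤ length (filter Q? xs) ℕ.+ length (filter R? xs)
  filter-⊎ P? Q? R? split [] = z≤n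
  filter-⊎ P? Q? R? split (x ∷ xs) with filter-⊎ P? Q? R? split xs | P? x | Q? x | R? x
  ... | ih | no _  | no _  | no _  = ih
  ... | ih | no _  | yes _ | no _  = ℕ.m≤n⇒m≤1+n ih
  ... | ih | no _  | no _  | yes _ = ℕ.≤-trans ih (ℕ.+-monoʳ-≤ (length (filter Q? xs)) (ℕ.n≤1+n _))
  ... | ih | no _  | yes _ | yes _ =
    ℕ.m≤n⇒m≤1+n (ℕ.≤-trans ih (ℕ.+-monoʳ-≤ (length (filter Q? xs)) (ℕ.n≤1+n _)))
  ... | ih | yes _ | yes _ | no _  = s≤s ih
  ... | ih | yes _ | yes _ | yes _ = s≤s (ℕ.≤-trans ih (ℕ.+-monoʳ-≤ (length (filter Q? xs)) (ℕ.n≤1+n _)))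
  ... | ih | yes _ | no _  | yes _ =
    ℕ.≤-trans (s≤s ih) (ℕ.≤-reflexive (≡.sym (ℕ.+-suc (length (filter Q? xs)) _)))
  ... | ih | yes p | no ¬q | no ¬r with split p
  ...   | inj₁ q = ⊥-elim (¬q q)
  ...   | inj₂ r = ⊥-elim (¬r r)

  length-filter-map : ∀ {A B : Set} (f : A → B) {P : B → Set} (P? : Decidable P) xs →
    length (filter P? (map f xs)) ≡ length (filter (λ x → P? (f x)) xs)
  length-filter-map f P? [] = refl
  length-filter-map f P? (x ∷ xs) with P? (f x)
  ... | yes _ = cong suc (length-filter-map f P? xs)
  ... | no _  = length-filter-map f P? xs

  sum-filter : ∀ {A : Set} {P : A → Set} (P? : Decidable P) {f f′ : A → ℕ} →
    (∀ {x} → P x → f x ℕ.≤ suc (f′ x)) → (∀ {x} → ¬ P x → f x ℕ.≤ f′ x) → ∀ xs →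
    sum (map f xs) ℕ.≤ sum (map f′ xs) ℕ.+ length (filter P? xs)
  sum-filter P? on off [] = z≤n
  sum-filter P? {f} {f′} on off (x ∷ xs) with sum-filter P? {f} {f′} on off xs | P? x
  ... | ih | yes p = ℕ.≤-trans (ℕ.+-mono-≤ (on p) ih)
    (ℕ.≤-reflexive (shuffle (f′ x) (sum (map f′ xs)) (length (filter P? xs))))
    where
    shuffle : ∀ x y z → suc x ℕ.+ (y ℕ.+ z) ≡ x ℕ.+ y ℕ.+ suc z
    shuffle = ℕ-Solver.solve-∀
  ... | ih | no ¬p = ℕ.≤-trans (ℕ.+-mono-≤ (off ¬p) ih)
    (ℕ.≤-reflexive (≡.sym (ℕ.+-assoc (f′ x) (sum (map f′ xs)) (length (filter P? xs)))))

  module _ (g : ℕ) where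

    -- How far the values fall short of a in total. Subtracting it from length times a bounds the
    -- sum from below without sorting the list.
    deficiency : ℕ → List ℕ → ℕ
    deficiency a hs = sum (map (a ℕ.∸_) hs)

    atMost : ℕ → List ℕ → ℕ
    atMost a hs = length (filter (ℕ._≤? a) hs)

    atMost-suc : ∀ a hs → atMost (suc a) hs ℕ.≤ count (suc a) hs ℕ.+ atMost a hs
    atMost-suc a = filter-⊎ (ℕ._≤? suc a) (ℕ._≟ suc a) (ℕ._≤? a) split
      where
      split : ∀ {h} → h ℕ.≤ suc a → h ≡ suc a ⊎ h ℕ.≤ a
      split {h} h≤ with h ℕ.≟ suc a
      ... | yes h≡ = inj₁ h≡
      ... | no h≢  = inj₂ (ℕ.≤-pred (ℕ.≤∧≢⇒< h≤ h≢))

    deficiency-suc : ∀ a hs → deficiency (suc a) hs ℕ.≤ deficiency a hs ℕ.+ atMost a hs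
    deficiency-suc a = sum-filter (ℕ._≤? a) (λ h≤a → ℕ.≤-reflexive (ℕ.+-∸-assoc 1 h≤a))
      (λ h≰a → ℕ.≤-trans (ℕ.≤-reflexive (ℕ.m≤n⇒m∸n≡0 (ℕ.≰⇒> h≰a))) z≤n)

    deficiency-0 : ∀ hs → deficiency 0 hs ≡ 0
    deficiency-0 [] = refl
    deficiency-0 (h ∷ hs) = cong₂ ℕ._+_ (ℕ.0∸n≡0 h) (deficiency-0 hs)

    length*≤ : ∀ a hs → length hs ℕ.* a ℕ.≤ sum hs ℕ.+ deficiency a hs
    length*≤ a [] = z≤n
    length*≤ a (h ∷ hs) = ℕ.≤-trans (ℕ.+-mono-≤ (ℕ.m≤n+m∸n a h) (length*≤ a hs))
      (ℕ.≤-reflexive (shuffle h (a ℕ.∸ h) (sum hs) (deficiency a hs)))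
      where
      shuffle : ∀ x y z w → x ℕ.+ y ℕ.+ (z ℕ.+ w) ≡ x ℕ.+ z ℕ.+ (y ℕ.+ w)
      shuffle = ℕ-Solver.solve-∀

    atMost-0 : ∀ hs → atMost 0 hs ℕ.≤ count 0 hs
    atMost-0 hs = ℕ.≤-trans
      (filter-⊎ (ℕ._≤? 0) (ℕ._≟ 0) never (λ h≤0 → inj₁ (ℕ.n≤0⇒n≡0 h≤0)) hs)
      (ℕ.≤-reflexive (≡.trans
        (cong (λ k → count 0 hs ℕ.+ length k) (filter-none never (All.universal (λ _ ()) hs)))
        (ℕ.+-identityʳ _)))
      where
      never : Decidable {A = ℕ} (λ _ → ⊥)
      never _ = no λ ()

    module _ {hs : List ℕ} (count≤g : ∀ j → count j hs ℕ.≤ g) where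

      atMost≤ : ∀ a → atMost a hs ℕ.≤ g ℕ.* suc a
      atMost≤ zero    = ℕ.≤-trans (atMost-0 hs) (ℕ.≤-trans (count≤g 0) (ℕ.≤-reflexive (≡.sym (ℕ.*-identityʳ g))))
      atMost≤ (suc a) = ℕ.≤-trans (atMost-suc a hs) (ℕ.≤-trans (ℕ.+-mono-≤ (count≤g (suc a)) (atMost≤ a))
        (ℕ.≤-reflexive (≡.sym (ℕ.*-suc g (suc a)))))

      -- Summation by parts: passing from a to a + 1 adds one for every value at most a, and there
      -- are at most g (a + 1) of these. Doubling avoids the half in a (a + 1)/2.
      deficiency≤ : ∀ a → 2 ℕ.* deficiency a hs ℕ.≤ g ℕ.* (a ℕ.* suc a)
      deficiency≤ zero = ℕ.≤-reflexive (≡.trans (cong (2 ℕ.*_) (deficiency-0 hs)) (≡.sym (ℕ.*-zeroʳ g)))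
      deficiency≤ (suc a) = begin
        2 ℕ.* deficiency (suc a) hs                              ≤⟨ ℕ.*-monoʳ-≤ 2 (deficiency-suc a hs) ⟩
        2 ℕ.* (deficiency a hs ℕ.+ atMost a hs)                  ≡⟨ ℕ.*-distribˡ-+ 2 (deficiency a hs) _ ⟩
        2 ℕ.* deficiency a hs ℕ.+ 2 ℕ.* atMost a hs              ≤⟨ ℕ.+-mono-≤ (deficiency≤ a) (ℕ.*-monoʳ-≤ 2 (atMost≤ a)) ⟩
        g ℕ.* (a ℕ.* suc a) ℕ.+ 2 ℕ.* (g ℕ.* suc a)              ≡⟨ collect g a ⟩
        g ℕ.* (suc a ℕ.* suc (suc a))                            ∎
        where
        open ℕ.≤-Reasoning
        collect : ∀ g a → g ℕ.* (a ℕ.* suc a) ℕ.+ 2 ℕ.* (g ℕ.* suc a) ≡ g ℕ.* (suc a ℕ.* suc (suc a))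
        collect = ℕ-Solver.solve-∀

      -- From 2 h ≥ 2 a − 2 (a ∸ h), summed over h.
      sum-lower-bound : ∀ a → 2 ℕ.* (length hs ℕ.* a) ℕ.≤ 2 ℕ.* sum hs ℕ.+ g ℕ.* (a ℕ.* suc a)
      sum-lower-bound a = begin
        2 ℕ.* (length hs ℕ.* a)                        ≤⟨ ℕ.*-monoʳ-≤ 2 (length*≤ a hs) ⟩
        2 ℕ.* (sum hs ℕ.+ deficiency a hs)             ≡⟨ ℕ.*-distribˡ-+ 2 (sum hs) _ ⟩
        2 ℕ.* sum hs ℕ.+ 2 ℕ.* deficiency a hs         ≤⟨ ℕ.+-monoʳ-≤ (2 ℕ.* sum hs) (deficiency≤ a) ⟩
        2 ℕ.* sum hs ℕ.+ g ℕ.* (a ℕ.* suc a)           ∎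
        where open ℕ.≤-Reasoning

  module _ {m : ℕ} where

    open Congruence m

    ≅⇒ℕ : ∀ {a b} → + a ≅ + b → (∃ λ k → a ≡ b ℕ.+ k ℕ.* m) ⊎ (∃ λ k → b ≡ a ℕ.+ k ℕ.* m)
    ≅⇒ℕ {a} {b} (mod (divides (+ k) e)) = inj₁ (k , ℤ.+-injective (begin
      + a                    ≡⟨ restore (+ a) (+ b) ⟩
      + b + (+ a - + b)      ≡⟨ cong (λ x → + b + x) (≡.trans e (≡.sym (ℤ.pos-* k m))) ⟩
      + b + + (k ℕ.* m)      ≡⟨ ℤ.pos-+ b (k ℕ.* m) ⟨
      + (b ℕ.+ k ℕ.* m)      ∎))
      where
      open ≡.≡-Reasoning
      restore : ∀ x y → x ≡ y + (x - y)
      restore = solve-∀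
    ≅⇒ℕ {a} {b} (mod (divides ℤ.-[1+ k ] e)) = inj₂ (suc k , ℤ.+-injective (begin
      + b                            ≡⟨ restore (+ a) (+ b) ⟩
      + a - (+ a - + b)              ≡⟨ cong (λ x → + a - x) e ⟩
      + a - (- (+ suc k)) * + m      ≡⟨ negate (+ a) (+ suc k) (+ m) ⟩
      + a + + suc k * + m            ≡⟨ cong (λ x → + a + x) (ℤ.pos-* (suc k) m) ⟨
      + a + + (suc k ℕ.* m)          ≡⟨ ℤ.pos-+ a (suc k ℕ.* m) ⟨
      + (a ℕ.+ suc k ℕ.* m)          ∎))
      where
      open ≡.≡-Reasoning
      restore : ∀ x y → y ≡ x - (x - y)
      restore = solve-∀
      negate : ∀ x y z → x - (- y) * z ≡ x + y * z
      negate = solve-∀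

    ≅⇒≡ : ∀ {a b} → + a ≅ + b → a ℕ.< m → b ℕ.< m → a ≡ b
    ≅⇒≡ {a} {b} e a<m b<m with ≅⇒ℕ e
    ... | inj₁ (zero , a≡)  = ≡.trans a≡ (ℕ.+-identityʳ b)
    ... | inj₂ (zero , b≡)  = ≡.sym (≡.trans b≡ (ℕ.+-identityʳ a))
    ... | inj₁ (suc k , refl) = ⊥-elim (ℕ.<⇒≱ a<m (ℕ.≤-trans (ℕ.m≤m+n m (k ℕ.* m)) (ℕ.m≤n+m _ b)))
    ... | inj₂ (suc k , refl) = ⊥-elim (ℕ.<⇒≱ b<m (ℕ.≤-trans (ℕ.m≤m+n m (k ℕ.* m)) (ℕ.m≤n+m _ a)))

    ≅-- : ∀ {x y u w} → x ≅ y → u ≅ w → x - u ≅ y - w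
    ≅-- e f = ≅-+-cong e (≅--cong f)

    ≅-from : ∀ {x y u w} → x ≅ y → x - y ≡ u - w → u ≅ w
    ≅-from (mod d) e = mod (subst (_ Signed.∣_) e d)

  -- L is a largest cyclic gap of n marks modulo m; the last condition bounds it from below.
  WideGapRuler : (g m n : ℕ) → Set
  WideGapRuler g m n = ∃ λ L → L ℕ.≤ m × HasRuler g n (m ℕ.∸ L) ×
    (∀ a → 2 ℕ.* m ℕ.+ 2 ℕ.* (n ℕ.* a) ℕ.≤ 2 ℕ.* (n ℕ.* L) ℕ.+ g ℕ.* (a ℕ.* suc a))

  -- A residue class modulo m splits into g classes modulo g m, selected by the quotient modulo g.
  lift-≅ : ∀ g m .{{_ : NonZero g}} {x d} → Congruence._≅_ m x d →
    ∃ λ k → k ℕ.< g × Congruence._≅_ (g ℕ.* m) x (d + + k * + m)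
  lift-≅ g m {x} {d} (Congruence.mod (divides z e)) = z %ℕ g , n%ℕd<d z g , Congruence.mod (divides (z /ℕ g) (begin
    x - (d + + k * + m)                          ≡⟨ regroup x d (+ k * + m) ⟩
    (x - d) - + k * + m                          ≡⟨ cong (λ y → y - + k * + m) (≡.trans e (cong (_* + m) (a≡a%ℕn+[a/ℕn]*n z g))) ⟩
    (+ k + z /ℕ g * + g) * + m - + k * + m       ≡⟨ collect (+ k) (z /ℕ g) (+ g) (+ m) ⟩
    z /ℕ g * (+ g * + m)                         ≡⟨ cong (z /ℕ g *_) (ℤ.pos-* g m) ⟨
    z /ℕ g * + (g ℕ.* m)                         ∎))
    where
    open ≡.≡-Reasoning
    k = z %ℕ g
    regroup : ∀ x d y → x - (d + y) ≡ (x - d) - y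
    regroup = solve-∀
    collect : ∀ k q g m → (k + q * g) * m - k * m ≡ q * (g * m)
    collect = solve-∀

  module SidonSet (g m : ℕ) .{{_ : NonZero g}} .{{_ : NonZero m}} (x : ℕ → ℤ) (I : List ℕ) (I-unique : Unique I)
    (sidon : ∀ {i j k l} → i ∈ I → j ∈ I → k ∈ I → l ∈ I → i ≢ j →
      Congruence._≅_ (g ℕ.* m) (x j - x i) (x l - x k) → i ≡ k × j ≡ l) where

    open Congruence m
    private module V = Congruence (g ℕ.* m)

    -- A pair is charged to the class of its difference modulo g m. Only g classes lie over d, and
    -- by the Sidon property each is charged once.
    difference-bound : ∀ d {ps} → Unique ps →
      (∀ {i j} → (i , j) ∈ ps → i ∈ I × j ∈ I × i ≢ j × x j - x i ≅ d) → length ps ℕ.≤ g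
    difference-bound d {ps} unique props = ℕ.≤-trans
      (matching {R = R} (upTo g) unique partner (λ {_} {_} {k} → injective {k = k})) (ℕ.≤-reflexive (length-upTo g))
      where
      R : ℕ × ℕ → ℕ → Set
      R (i , j) k = i ∈ I × j ∈ I × i ≢ j × x j - x i V.≅ d + + k * + m
      partner : ∀ {p} → p ∈ ps → ∃ λ k → k ∈ upTo g × R p k
      partner p∈ with props p∈
      ... | i∈ , j∈ , i≢j , e with lift-≅ g m e
      ...   | k , k<g , e′ = k , ∈-upTo⁺ k<g , i∈ , j∈ , i≢j , e′
      injective : ∀ {p p′ k} → R p k → R p′ k → p ≡ p′
      injective (i∈ , j∈ , i≢j , e) (k∈ , l∈ , _ , e′) with sidon i∈ j∈ k∈ l∈ i≢j (V.≅-trans e (V.≅-sym e′))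
      ... | refl , refl = refl

    -- The case d = 0 of the same count, where the class k = 0 cannot occur; the index is therefore
    -- `suc k`.
    collision-bound : ∀ {ps} → Unique ps →
      (∀ {i j} → (i , j) ∈ ps → i ∈ I × j ∈ I × i ≢ j × x j - x i ≅ 0ℤ) → length ps ℕ.≤ ℕ.pred g
    collision-bound {ps} unique props = ℕ.≤-trans
      (matching {R = R} (upTo (ℕ.pred g)) unique partner (λ {_} {_} {k} → injective {k = k})) (ℕ.≤-reflexive (length-upTo (ℕ.pred g)))
      where
      R : ℕ × ℕ → ℕ → Set
      R (i , j) k = i ∈ I × j ∈ I × i ≢ j × x j - x i V.≅ 0ℤ + + suc k * + m
      partner : ∀ {p} → p ∈ ps → ∃ λ k → k ∈ upTo (ℕ.pred g) × R p k
      partner {i , j} p∈ with props p∈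
      ... | i∈ , j∈ , i≢j , e with lift-≅ g m e
      -- The difference of (i , i) is also 0, so `sidon` for (i , j) and (i , i) would give j = i.
      ...   | zero , _ , e′ = ⊥-elim (i≢j (≡.sym (proj₂ (sidon i∈ j∈ i∈ i∈ i≢j
                (V.≅-trans e′ (V.≅-reflexive (≡.sym (ℤ.+-inverseʳ (x i)))))))))
      ...   | suc k , k<g , e′ = k , ∈-upTo⁺ (ℕ.<⇒≤pred k<g) , i∈ , j∈ , i≢j , e′
      injective : ∀ {p p′ k} → R p k → R p′ k → p ≡ p′
      injective (i∈ , j∈ , i≢j , e) (k∈ , l∈ , _ , e′) with sidon i∈ j∈ k∈ l∈ i≢j (V.≅-trans e (V.≅-sym e′))
      ... | refl , refl = refl

    Incongruent : List ℕ → Set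
    Incongruent = AllPairs (λ i j → ¬ x i ≅ x j)

    -- Each discarded mark accounts for two ordered pairs of congruent marks.
    deduplicate : ∀ xs → Unique xs → All (_∈ I) xs → ∃₂ λ B ps →
      All (_∈ xs) B × Incongruent B × Unique ps ×
      (∀ {i j} → (i , j) ∈ ps → i ∈ xs × j ∈ xs × i ≢ j × x j - x i ≅ 0ℤ) ×
      2 ℕ.* length xs ≡ 2 ℕ.* length B ℕ.+ length ps
    deduplicate [] _ _ = [] , [] , [] , [] , [] , (λ ()) , refl
    deduplicate (i ∷ xs) (i∉xs ∷ unique) (i∈ ∷ xs⊆) with deduplicate xs unique xs⊆
    ... | B , ps , B⊆ , incongruent , ps-unique , props , len with any? (λ b → x i ≅? x b) B
    ...   | no ¬any = i ∷ B , ps , here refl ∷ All.map there B⊆ , All.¬Any⇒All¬ B ¬any ∷ incongruent , ps-unique ,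
            (λ p∈ → let (j∈ , k∈ , rest) = props p∈ in there j∈ , there k∈ , rest) ,
            ≡.trans (ℕ.*-suc 2 (length xs)) (≡.trans (cong (2 ℕ.+_) len)
              (cong (ℕ._+ length ps) (≡.sym (ℕ.*-suc 2 (length B)))))
    ...   | yes any with find any
    ...     | b , b∈ , e = B , (i , b) ∷ (b , i) ∷ ps , All.map there B⊆ , incongruent ,
              ((λ { refl → i≢b refl }) ∷ All.tabulate (λ { p∈ refl → i∉ (proj₁ (props p∈)) })) ∷
              All.tabulate (λ { p∈ refl → i∉ (proj₁ (proj₂ (props p∈))) }) ∷ ps-unique ,
              props′ ,
              ≡.trans (ℕ.*-suc 2 (length xs)) (≡.trans (cong (2 ℕ.+_) len) (shuffle (2 ℕ.* length B) (length ps)))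
      where
      i∉ : ¬ i ∈ xs
      i∉ i∈xs = All.lookup i∉xs i∈xs refl
      b∈xs : b ∈ xs
      b∈xs = All.lookup B⊆ b∈
      i≢b : i ≢ b
      i≢b refl = i∉ b∈xs
      props′ : ∀ {j k} → (j , k) ∈ (i , b) ∷ (b , i) ∷ ps →
        j ∈ i ∷ xs × k ∈ i ∷ xs × j ≢ k × x k - x j ≅ 0ℤ
      props′ (here refl) = here refl , there b∈xs , i≢b ,
        ≅-from (≅-sym e) (≡.sym (ℤ.+-identityʳ (x b - x i)))
      props′ (there (here refl)) = there b∈xs , here refl , (λ b≡i → i≢b (≡.sym b≡i)) ,
        ≅-from e (≡.sym (ℤ.+-identityʳ (x i - x b)))
      props′ (there (there p∈)) = let (j∈ , k∈ , rest) = props p∈ in there j∈ , there k∈ , rest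
      shuffle : ∀ a b → 2 ℕ.+ (a ℕ.+ b) ≡ a ℕ.+ suc (suc b)
      shuffle = ℕ-Solver.solve-∀

    incongruent-marks : ∀ n → n ℕ.+ g ℕ./ 2 ℕ.≤ length I →
      ∃ λ B → length B ≡ n × All (_∈ I) B × Incongruent B
    incongruent-marks n n≤ with deduplicate I I-unique (All.tabulate (λ i∈ → i∈))
    ... | B , ps , B⊆ , incongruent , ps-unique , props , len =
      take n B , ≡.trans (length-take n B) (ℕ.m≤n⇒m⊓n≡m n≤B) , All.take⁺ n B⊆ , AllPairs.take⁺ n incongruent
      where
      n≤B : n ℕ.≤ length B
      -- Everything is doubled because the collisions are counted as ordered pairs; the strict step
      -- is g % 2 < 2.
      n≤B = ℕ.≮⇒≥ λ B<n → ℕ.<-irrefl refl (begin-strict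
        2 ℕ.* length B ℕ.+ g                                   ≡⟨ cong (2 ℕ.* length B ℕ.+_) (ℕ.m≡m%n+[m/n]*n g 2) ⟩
        2 ℕ.* length B ℕ.+ (g ℕ.% 2 ℕ.+ g ℕ./ 2 ℕ.* 2)         <⟨ ℕ.+-monoʳ-< (2 ℕ.* length B) (ℕ.+-monoˡ-< (g ℕ./ 2 ℕ.* 2) (ℕ.m%n<n g 2)) ⟩
        2 ℕ.* length B ℕ.+ (2 ℕ.+ g ℕ./ 2 ℕ.* 2)               ≡⟨ shuffle (length B) (g ℕ./ 2) ⟩
        2 ℕ.* (suc (length B) ℕ.+ g ℕ./ 2)                     ≤⟨ ℕ.*-monoʳ-≤ 2 (ℕ.+-monoˡ-≤ (g ℕ./ 2) B<n) ⟩
        2 ℕ.* (n ℕ.+ g ℕ./ 2)                                  ≤⟨ ℕ.*-monoʳ-≤ 2 n≤ ⟩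
        2 ℕ.* length I                                         ≡⟨ len ⟩
        2 ℕ.* length B ℕ.+ length ps                           ≤⟨ ℕ.+-monoʳ-≤ (2 ℕ.* length B) (ℕ.≤-trans (collision-bound ps-unique props) (ℕ.pred[n]≤n)) ⟩
        2 ℕ.* length B ℕ.+ g                                   ∎)
        where
        open ℕ.≤-Reasoning
        shuffle : ∀ b h → 2 ℕ.* b ℕ.+ (2 ℕ.+ h ℕ.* 2) ≡ 2 ℕ.* (suc b ℕ.+ h)
        shuffle = ℕ-Solver.solve-∀

    incongruent-injective : ∀ {B i j} → Incongruent B → i ∈ B → j ∈ B → x i ≅ x j → i ≡ j
    incongruent-injective (_ ∷ _) (here refl) (here refl) e = refl
    incongruent-injective (i≇ ∷ _) (here refl) (there j∈) e = ⊥-elim (All.lookup i≇ j∈ e)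
    incongruent-injective (j≇ ∷ _) (there i∈) (here refl) e = ⊥-elim (All.lookup j≇ i∈ (≅-sym e))
    incongruent-injective (_ ∷ rest) (there i∈) (there j∈) e = incongruent-injective rest i∈ j∈ e

    Hit : List ℕ → ℤ → Set
    Hit B z = Any (λ b → z ≅ x b) B

    hit? : ∀ B → Decidable (Hit B)
    hit? B z = any? (λ b → z ≅? x b) B

    -- Distance and successor functions in place of a sorted list. A lone mark is its own successor
    -- at distance m, so `gap≤m` is not strict.
    record CyclicOrder (B : List ℕ) : Set where
      field
        gap         : ℕ → ℕ
        next        : ℕ → ℕ
        gap>0       : ∀ b → 0 ℕ.< gap b
        gap≤m       : ∀ b → gap b ℕ.≤ m
        gap-minimal : ∀ b {j} → 0 ℕ.< j → j ℕ.< gap b → ¬ Hit B (x b + + j)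
        next∈       : ∀ {b} → b ∈ B → next b ∈ B
        next-≅      : ∀ {b} → b ∈ B → x b + + gap b ≅ x (next b)

    +m≅0 : + m ≅ 0ℤ
    +m≅0 = ≅-trans (≅-reflexive (≡.sym (ℤ.*-identityˡ (+ m)))) (multiple≅0 (+ 1))

    cyclicOrder : ∀ B → CyclicOrder B
    cyclicOrder B = record
      { gap = gap
      ; next = λ b → next (hit? B (x b + + gap b)) b
      ; gap>0 = λ b → s≤s z≤n
      ; gap≤m = gap≤m
      ; gap-minimal = λ { b {suc j} _ (s≤s j<) → proj₂ (proj₂ (proj₂ (search b))) j< }
      ; next∈ = λ {b} b∈ → proj₁ (next-spec (hit? B (x b + + gap b)) b∈)
      ; next-≅ = λ {b} b∈ → proj₂ (next-spec (hit? B (x b + + gap b)) b∈)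
      }
      where
      Search : ℕ → Set
      Search b = ∃ λ d → d ℕ.≤ ℕ.pred m × (d ℕ.< ℕ.pred m → Hit B (x b + + suc d)) ×
        (∀ {j} → j ℕ.< d → ¬ Hit B (x b + + suc j))
      search : ∀ b → Search b
      -- If nothing is hit earlier, the default `pred m` turns into the gap m, where x b itself
      -- recurs.
      search b = first (λ e → hit? B (x b + + suc e)) (ℕ.pred m)
      gap : ℕ → ℕ
      gap b = suc (proj₁ (search b))
      gap≤m : ∀ b → gap b ℕ.≤ m
      gap≤m b = subst (gap b ℕ.≤_) (ℕ.suc-pred m) (s≤s (proj₁ (proj₂ (search b))))
      gap-hit : ∀ {b} → b ∈ B → Hit B (x b + + gap b)
      gap-hit {b} b∈ = cases (ℕ.m≤n⇒m<n∨m≡n (gap≤m b))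
        where
        cases : gap b ℕ.< m ⊎ gap b ≡ m → Hit B (x b + + gap b)
        cases (inj₁ gap<m) = proj₁ (proj₂ (proj₂ (search b))) (ℕ.<⇒≤pred gap<m)
        cases (inj₂ gap≡m) = lose b∈ (≅-trans (≅-+-cong (≅-refl {x b}) (≅-trans (≅-reflexive (cong +_ gap≡m)) +m≅0))
          (≅-reflexive (ℤ.+-identityʳ (x b))))
      next : ∀ {z} → Dec (Hit B z) → ℕ → ℕ
      next (yes h) b = proj₁ (find h)
      next (no _)  b = b
      next-spec : ∀ {b} (h? : Dec (Hit B (x b + + gap b))) → b ∈ B →
        next h? b ∈ B × x b + + gap b ≅ x (next h? b)
      next-spec (yes h) b∈ = proj₂ (find h)
      next-spec (no ¬h) b∈ = ⊥-elim (¬h (gap-hit b∈))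

    module Gaps (B : List ℕ) (B⊆I : All (_∈ I) B) (incongruent : Incongruent B) (order : CyclicOrder B) where

      open CyclicOrder order

      B-unique : Unique B
      B-unique = AllPairs.map (λ { ≇ refl → ≇ ≅-refl }) incongruent

      -- For d not 0 modulo m the pairs (b, next b) consist of distinct marks with a common
      -- difference, and `difference-bound` applies. Otherwise the gap is the whole cycle, so b is
      -- the only mark, and 1 ≤ g.
      equal-gaps : ∀ d {F} → Unique F → (∀ {b} → b ∈ F → b ∈ B × gap b ≡ d) → length F ℕ.≤ g
      equal-gaps d {[]} _ _ = z≤n
      equal-gaps d {b ∷ F} unique props with + d ≅? 0ℤ
      ... | no d≇0 = subst (ℕ._≤ g) (length-map (λ b → b , next b) (b ∷ F))
            (difference-bound (+ d) (Unique.map⁺ (cong proj₁) unique) pair-props)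
        where
        pair-props : ∀ {i j} → (i , j) ∈ map (λ b → b , next b) (b ∷ F) → i ∈ I × j ∈ I × i ≢ j × x j - x i ≅ + d
        pair-props p∈ with ∈-map⁻ (λ b → b , next b) p∈
        ... | i , i∈ , refl with props i∈
        ...   | i∈B , refl = All.lookup B⊆I i∈B , All.lookup B⊆I (next∈ i∈B) ,
                  (λ i≡next → d≇0 (≅-trans difference (≅-from (≅-reflexive (cong x (≡.sym i≡next))) (≡.sym (ℤ.+-identityʳ (x (next i) - x i)))))) ,
                  ≅-sym difference
          where
          cancel : ∀ y z → (z + y) - z ≡ y
          cancel = solve-∀
          difference : + gap i ≅ x (next i) - x i
          difference = ≅-trans (≅-reflexive (≡.sym (cancel (+ gap i) (x i)))) (≅-- (next-≅ i∈B) ≅-refl)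
      ... | yes d≅0 with props (here refl)
      ...   | b∈ , refl = ℕ.≤-trans (matching {R = _≡_} (b ∷ []) unique
                (λ c∈ → b , here refl , only (proj₁ (props c∈))) (λ { refl refl → refl }))
              (ℕ.>-nonZero⁻¹ g)
        where
        gap≡m : gap b ≡ m
        gap≡m with ℕ.m≤n⇒m<n∨m≡n (gap≤m b)
        ... | inj₂ e = e
        ... | inj₁ gap<m = ⊥-elim (ℕ.<⇒≢ (gap>0 b) (≡.sym (≅⇒≡ d≅0 gap<m (ℕ.>-nonZero⁻¹ m))))
        only : ∀ {c} → c ∈ B → c ≡ b
        only {c} c∈ with (x c - x b) %ℕ m in eq
        ... | zero = incongruent-injective incongruent c∈ b∈ (≅-from (≅-trans (%ℕ-≅ (x c - x b)) (≅-reflexive (cong +_ eq))) (ℤ.+-identityʳ _))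
        ... | suc e = ⊥-elim (gap-minimal b {suc e} (s≤s z≤n)
                (subst (suc e ℕ.<_) (≡.sym gap≡m) (subst (ℕ._< m) eq (n%ℕd<d (x c - x b) m)))
                (Any.map (λ { refl → ≅-trans (≅-+-cong (≅-refl {x b})
                  (≅-trans (≅-reflexive (cong +_ (≡.sym eq))) (≅-sym (%ℕ-≅ (x c - x b)))))
                  (≅-reflexive (restore (x b) (x c))) }) c∈))
          where
          restore : ∀ y z → y + (z - y) ≡ z
          restore = solve-∀

      -- Walk back from y to the nearest mark b; if the distance were at least gap b, the successor
      -- of b would be nearer.
      cover : ∀ {b₀} → b₀ ∈ B → ∀ y → ∃₂ λ b o → b ∈ B × o ℕ.< gap b × y ≅ x b + + o
      cover {b₀} b₀∈ y = nearest (first (λ o → hit? B (y - + o)) m)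
        where
        restore : ∀ y z → y - (y - z) ≡ z
        restore = solve-∀
        regroup : ∀ y o z → (y - o) - z ≡ y - (z + o)
        regroup = solve-∀
        shift : ∀ y k d → y - k ≡ (y - (k + d)) + d
        shift = solve-∀
        nearest : (∃ λ o → o ℕ.≤ m × (o ℕ.< m → Hit B (y - + o)) × (∀ {j} → j ℕ.< o → ¬ Hit B (y - + j))) →
          ∃₂ λ b o → b ∈ B × o ℕ.< gap b × y ≅ x b + + o
        nearest (o , o≤m , hit , minimal) = marked (find (hit (ℕ.≤∧≢⇒< o≤m o≢m)))
          where
          o≢m : o ≢ m
          o≢m refl = minimal (n%ℕd<d (y - x b₀) m) (lose b₀∈
            (≅-trans (≅-- (≅-refl {y}) (≅-sym (%ℕ-≅ (y - x b₀)))) (≅-reflexive (restore y (x b₀)))))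
          marked : (∃ λ b → b ∈ B × y - + o ≅ x b) → ∃₂ λ b o → b ∈ B × o ℕ.< gap b × y ≅ x b + + o
          marked (b , b∈ , e) = b , o , b∈ , ℕ.≰⇒> gap≰o , ≅-from e (regroup y (+ o) (x b))
            where
            gap≰o : ¬ gap b ℕ.≤ o
            gap≰o gap≤o = minimal (ℕ.∸-monoʳ-< {o} {gap b} {0} (gap>0 b) gap≤o) (lose (next∈ b∈)
              (≅-trans (≅-reflexive split) (≅-trans (≅-+-cong e (≅-refl {+ gap b})) (next-≅ b∈))))
              where
              k = o ℕ.∸ gap b
              split : y - + k ≡ (y - + o) + + gap b
              split = ≡.trans (shift y (+ k) (+ gap b)) (cong (λ k → (y - k) + + gap b)
                (≡.trans (≡.sym (ℤ.pos-+ k (gap b))) (cong +_ (ℕ.m∸n+n≡m gap≤o))))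

      offsets : List ℕ → List (ℕ × ℕ)
      offsets = concatMap (λ b → map (b ,_) (upTo (gap b)))

      length-offsets : ∀ bs → length (offsets bs) ≡ sum (map gap bs)
      length-offsets [] = refl
      length-offsets (b ∷ bs) = ≡.trans (length-++ (map (b ,_) (upTo (gap b))))
        (cong₂ ℕ._+_ (≡.trans (length-map (b ,_) (upTo (gap b))) (length-upTo (gap b))) (length-offsets bs))

      Represents : ℕ → ℕ × ℕ → Set
      Represents y (b , o) = y ℕ.< m × + y ≅ x b + + o

      ∈-offsets : ∀ {b o bs} → b ∈ bs → o ℕ.< gap b → (b , o) ∈ offsets bs
      ∈-offsets {b} {o} {b ∷ bs} (here refl) o< = ∈-++⁺ˡ (∈-map⁺ (b ,_) (∈-upTo⁺ o<))
      ∈-offsets {b} {o} {b′ ∷ bs} (there b∈) o< = ∈-++⁺ʳ (map (b′ ,_) (upTo (gap b′))) (∈-offsets b∈ o<)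

      represented : ∀ {b₀} → b₀ ∈ B → ∀ {y} → y ℕ.< m → ∃ λ p → p ∈ offsets B × Represents y p
      represented b₀∈ {y} y<m = let (b , o , b∈ , o< , e) = cover b₀∈ (+ y) in (b , o) , ∈-offsets b∈ o< , y<m , e

      represents-unique : ∀ {y y′} p → Represents y p → Represents y′ p → y ≡ y′
      represents-unique (b , o) (y<m , e) (y′<m , e′) = ≅⇒≡ (≅-trans e (≅-sym e′)) y<m y′<m

      -- All m residues occur among the pairs (mark, offset within its gap). This is the direction
      -- of "the gaps add up to m" that bounds L from below.
      m≤sum-gaps : ∀ {b₀} → b₀ ∈ B → m ℕ.≤ sum (map gap B)
      m≤sum-gaps b₀∈ = begin
        m                    ≡⟨ length-upTo m ⟨
        length (upTo m)      ≤⟨ matching {R = Represents} (offsets B) (Unique.upTo⁺ m)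
                                  (λ y∈ → represented b₀∈ (∈-upTo⁻ y∈)) (λ {_} {_} {p} → represents-unique p) ⟩
        length (offsets B)   ≡⟨ length-offsets B ⟩
        sum (map gap B)      ∎
        where open ℕ.≤-Reasoning

      module Largest {b₀} (b₀∈ : b₀ ∈ B) (b* : ℕ) (b*∈ : b* ∈ B) (b*-max : All (λ b → gap b ℕ.≤ gap b*) B) where

        L : ℕ
        L = gap b*

        excess : ℕ → ℕ
        excess b = L ℕ.∸ gap b

        count-excess : ∀ j → count j (map excess B) ℕ.≤ g
        count-excess j = ℕ.≤-trans (ℕ.≤-reflexive (length-filter-map excess (ℕ._≟ j) B))
          (equal-gaps (L ℕ.∸ j) (Unique.filter⁺ (λ b → excess b ℕ.≟ j) B-unique) props)
          where
          props : ∀ {b} → b ∈ filter (λ b → excess b ℕ.≟ j) B → b ∈ B × gap b ≡ L ℕ.∸ j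
          props b∈F with ∈-filter⁻ (λ b → excess b ℕ.≟ j) {xs = B} b∈F
          ... | b∈ , e = b∈ , ≡.trans (≡.sym (ℕ.m∸[m∸n]≡n (All.lookup b*-max b∈))) (cong (L ℕ.∸_) e)

        sum-excess : ∀ {bs} → All (λ b → gap b ℕ.≤ L) bs →
          sum (map gap bs) ℕ.+ sum (map excess bs) ≡ length bs ℕ.* L
        sum-excess [] = refl
        sum-excess {b ∷ bs} (≤L ∷ max) = ≡.trans (shuffle (gap b) (sum (map gap bs)) (excess b) (sum (map excess bs)))
          (cong₂ ℕ._+_ (ℕ.m+[n∸m]≡n ≤L) (sum-excess max))
          where
          shuffle : ∀ x y z w → x ℕ.+ y ℕ.+ (z ℕ.+ w) ≡ x ℕ.+ z ℕ.+ (y ℕ.+ w)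
          shuffle = ℕ-Solver.solve-∀

        largest-gap-bound : ∀ a → 2 ℕ.* m ℕ.+ 2 ℕ.* (length B ℕ.* a) ℕ.≤ 2 ℕ.* (length B ℕ.* L) ℕ.+ g ℕ.* (a ℕ.* suc a)
        largest-gap-bound a = begin
          2 ℕ.* m ℕ.+ 2 ℕ.* (length B ℕ.* a)
            ≤⟨ ℕ.+-mono-≤ (ℕ.*-monoʳ-≤ 2 (m≤sum-gaps b₀∈))
                 (subst (λ n → 2 ℕ.* (n ℕ.* a) ℕ.≤ 2 ℕ.* E ℕ.+ g ℕ.* (a ℕ.* suc a)) (length-map excess B)
                   (sum-lower-bound g {map excess B} count-excess a)) ⟩
          2 ℕ.* S ℕ.+ (2 ℕ.* E ℕ.+ g ℕ.* (a ℕ.* suc a))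
            ≡⟨ shuffle S E (g ℕ.* (a ℕ.* suc a)) ⟩
          2 ℕ.* (S ℕ.+ E) ℕ.+ g ℕ.* (a ℕ.* suc a)
            ≡⟨ cong (λ k → 2 ℕ.* k ℕ.+ g ℕ.* (a ℕ.* suc a)) (sum-excess b*-max) ⟩
          2 ℕ.* (length B ℕ.* L) ℕ.+ g ℕ.* (a ℕ.* suc a) ∎
          where
          open ℕ.≤-Reasoning
          S = sum (map gap B)
          E = sum (map excess B)
          shuffle : ∀ S E c → 2 ℕ.* S ℕ.+ (2 ℕ.* E ℕ.+ c) ≡ 2 ℕ.* (S ℕ.+ E) ℕ.+ c
          shuffle = ℕ-Solver.solve-∀

        origin : ℤ
        origin = x b* + + L

        -- The marks are read off from the right end of the largest gap.
        mark : ℕ → ℕ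
        mark b = (x b - origin) %ℕ m

        mark-≅ : ∀ b → x b ≅ origin + + mark b
        mark-≅ b = ≅-from (%ℕ-≅ (x b - origin)) (regroup (x b) origin (+ mark b))
          where
          regroup : ∀ y o k → (y - o) - k ≡ y - (o + k)
          regroup = solve-∀

        mark<m : ∀ b → mark b ℕ.< m
        mark<m b = n%ℕd<d (x b - origin) m

        -- A mark beyond m ∸ L would lie strictly inside the largest gap, at distance mark b ∸ (m ∸
        -- L) from b*.
        mark≤ : ∀ {b} → b ∈ B → mark b ℕ.≤ m ℕ.∸ L
        mark≤ {b} b∈ = ℕ.≮⇒≥ λ m∸L<mark → gap-minimal b* (0<j m∸L<mark) (j<L m∸L<mark)
          (lose b∈ (hit m∸L<mark))
          where
          L≤m = gap≤m b*
          j = mark b ℕ.∸ (m ℕ.∸ L)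
          0<j : m ℕ.∸ L ℕ.< mark b → 0 ℕ.< j
          0<j = ℕ.m<n⇒0<n∸m
          j<L : m ℕ.∸ L ℕ.< mark b → j ℕ.< L
          j<L lt = ℕ.≰⇒> λ L≤j → ℕ.<⇒≱ (mark<m b) (begin
            m                  ≡⟨ ℕ.m+[n∸m]≡n L≤m ⟨
            L ℕ.+ (m ℕ.∸ L)    ≤⟨ ℕ.+-monoˡ-≤ (m ℕ.∸ L) L≤j ⟩
            j ℕ.+ (m ℕ.∸ L)    ≡⟨ ℕ.m∸n+n≡m {mark b} {m ℕ.∸ L} (ℕ.<⇒≤ lt) ⟩
            mark b             ∎)
            where open ℕ.≤-Reasoning
          hit : m ℕ.∸ L ℕ.< mark b → x b* + + j ≅ x b
          hit lt = ≅-trans (≅-from (≅-sym +m≅0) rearrange) (≅-sym (mark-≅ b))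
            where
            mark≡ : + mark b ≡ + j + (+ m - + L)
            mark≡ = ≡.trans (cong +_ (≡.sym (ℕ.m∸n+n≡m (ℕ.<⇒≤ lt)))) (≡.trans (ℤ.pos-+ j (m ℕ.∸ L))
              (cong (λ k → + j + k) (≡.trans (≡.sym (ℤ.⊖-≥ L≤m)) (≡.sym (ℤ.m-n≡m⊖n m L)))))
            regroup : ∀ y j m L → 0ℤ - m ≡ (y + j) - (y + L + (j + (m - L)))
            regroup = solve-∀
            rearrange : 0ℤ - + m ≡ (x b* + + j) - (origin + + mark b)
            rearrange = ≡.trans (regroup (x b*) (+ j) (+ m) (+ L)) (cong (λ k → (x b* + + j) - (origin + k)) (≡.sym mark≡))

        marks : List ℤ
        marks = map (λ b → + mark b) B

        marks-unique : Unique marks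
        marks-unique = AllPairs.map⁺ (AllPairs.map (λ {i} {j} ≇ e → ≇ (≅-trans (mark-≅ i)
          (≅-trans (≅-reflexive (cong (λ k → origin + k) e)) (≅-sym (mark-≅ j))))) incongruent)

        marks-golomb : IsGolombRuler g marks
        marks-golomb = mkGolomb marks-unique bounded
          where
          bounded : ∀ d → 0ℤ ℤ.< d → differenceCount marks d ℕ.≤ g
          bounded d 0<d = ℕ.≤-trans (matching {R = R} ps
              (Unique.filter⁺ P? (Unique.cartesianProduct⁺ marks-unique marks-unique)) partner
              (λ { (refl , refl) (refl , refl) → refl }))
            (difference-bound d (Unique.filter⁺ Q? (Unique.cartesianProduct⁺ B-unique B-unique)) props)
            where
            P? : Decidable {A = ℤ × ℤ} (λ (a , c) → c - a ≡ d)
            P? (a , c) = c - a ℤ.≟ d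
            Q? : Decidable {A = ℕ × ℕ} (λ (i , j) → + mark j - + mark i ≡ d)
            Q? (i , j) = + mark j - + mark i ℤ.≟ d
            ps = filter Q? (cartesianProduct B B)
            R : ℤ × ℤ → ℕ × ℕ → Set
            R (a , c) (i , j) = a ≡ + mark i × c ≡ + mark j
            partner : ∀ {p} → p ∈ filter P? (cartesianProduct marks marks) → ∃ λ p′ → p′ ∈ ps × R p p′
            partner p∈ with ∈-filter⁻ P? {xs = cartesianProduct marks marks} p∈
            ... | p∈′ , e with ∈-cartesianProduct⁻ marks marks p∈′
            ...   | a∈ , c∈ with ∈-map⁻ (λ b → + mark b) a∈ | ∈-map⁻ (λ b → + mark b) c∈
            ...     | i , i∈ , refl | j , j∈ , refl =
                      (i , j) , ∈-filter⁺ Q? (∈-cartesianProduct⁺ i∈ j∈) e , refl , refl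
            props : ∀ {i j} → (i , j) ∈ ps → i ∈ I × j ∈ I × i ≢ j × x j - x i ≅ d
            props {i} {j} p∈ with ∈-filter⁻ Q? {xs = cartesianProduct B B} p∈
            ... | p∈′ , e with ∈-cartesianProduct⁻ B B p∈′
            ...   | i∈ , j∈ = All.lookup B⊆I i∈ , All.lookup B⊆I j∈ ,
                    (λ { refl → ℤ.<⇒≢ 0<d (≡.trans (≡.sym (ℤ.+-inverseʳ (+ mark i))) e) }) ,
                    ≅-trans (≅-- (mark-≅ j) (mark-≅ i))
                      (≅-reflexive (≡.trans (cancel origin (+ mark j) (+ mark i)) e))
              where
              cancel : ∀ o y z → (o + y) - (o + z) ≡ y - z
              cancel = solve-∀

        -- The right end of the gap becomes 0; its left end is -L modulo m, that is, m ∸ L.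
        marks-diameter : HasDiameter marks (m ℕ.∸ L)
        marks-diameter = 0ℤ , + (m ℕ.∸ L) ,
          (subst (_∈ marks) (cong +_ mark-next) (∈-map⁺ (λ b → + mark b) (next∈ b*∈)) ,
           All.map⁺ (All.universal (λ _ → +≤+ z≤n) B)) ,
          (subst (_∈ marks) (cong +_ mark-b*) (∈-map⁺ (λ b → + mark b) b*∈) ,
           All.map⁺ (All.tabulate (λ b∈ → +≤+ (mark≤ b∈)))) ,
          ℤ.+-identityʳ _
          where
          mark-next : mark (next b*) ≡ 0
          mark-next = ≅⇒≡ (≅-trans (≅-sym (%ℕ-≅ (x (next b*) - origin)))
            (≅-trans (≅-- (≅-sym (next-≅ b*∈)) ≅-refl) (≅-reflexive (ℤ.+-inverseʳ origin))))
            (mark<m (next b*)) (ℕ.>-nonZero⁻¹ m)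
          mark-b* : mark b* ≡ m ℕ.∸ L
          mark-b* = ≅⇒≡ (≅-trans (≅-sym (%ℕ-≅ (x b* - origin))) (≅-from (≅-sym +m≅0) rearrange))
            (mark<m b*) (ℕ.∸-monoʳ-< {m} {L} {0} (gap>0 b*) (gap≤m b*))
            where
            regroup : ∀ y m L → 0ℤ - m ≡ (y - (y + L)) - (m - L)
            regroup = solve-∀
            rearrange : 0ℤ - + m ≡ (x b* - origin) - + (m ℕ.∸ L)
            rearrange = ≡.trans (regroup (x b*) (+ m) (+ L))
              (cong (λ k → (x b* - origin) - k) (≡.trans (ℤ.m-n≡m⊖n m L) (ℤ.⊖-≥ (gap≤m b*))))

    ruler : ∀ n .{{_ : NonZero n}} → n ℕ.+ g ℕ./ 2 ℕ.≤ length I → WideGapRuler g m n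
    ruler n n≤ = build (incongruent-marks n n≤)
      where
      build : (∃ λ B → length B ≡ n × All (_∈ I) B × Incongruent B) → WideGapRuler g m n
      build ([] , refl , _) = ⊥-elim (ℕ.≢-nonZero⁻¹ n refl)
      build (b ∷ bs , refl , B⊆I , incongruent) with cyclicOrder (b ∷ bs)
      ... | order with maximiser (CyclicOrder.gap order) b bs
      ...   | b* , b*∈ , max = M.L , CyclicOrder.gap≤m order b* ,
            (M.marks , length-map (λ b → + M.mark b) (b ∷ bs) , M.marks-golomb , M.marks-diameter) , M.largest-gap-bound
        where module M = Gaps.Largest (b ∷ bs) B⊆I incongruent order (here refl) b* b*∈ max

-- Bounding the ceiling of a rational expression.

module Ceilings where

  open import Data.Integer as ℤ using (ℤ; +_; _+_; _*_; _-_; -_)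
  open import Data.Integer.DivMod using (_/ℕ_; div-pos-is-/ℕ; n<s[n/ℕd]*d)
  open import Data.Rational as ℚ using (ℚ; mkℚ; ceiling; floor; toℚᵘ; ↥_; ↧_)
  import Data.Rational.Properties as ℚ
  open import Data.Rational.Unnormalised as ℚᵘ using (ℚᵘ; mkℚᵘ; _≃_; *≡*)
  import Data.Rational.Unnormalised.Properties as ℚᵘ
  open import Relation.Binary.PropositionalEquality as ≡ using (_≡_; cong; subst)

  ≤-floor : ∀ p z → z * ↧ p ℤ.≤ ↥ p → z ℤ.≤ floor p
  ≤-floor (mkℚ n d-1 _) z z*d≤n = subst (z ℤ.≤_) (≡.sym (div-pos-is-/ℕ n (suc d-1)))
    (subst (z ℤ.≤_) (ℤ.pred-suc (n /ℕ suc d-1)) (ℤ.i<j⇒i≤pred[j] {z} {ℤ.suc (n /ℕ suc d-1)}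
      (ℤ.*-cancelʳ-<-nonNeg {z} {ℤ.suc (n /ℕ suc d-1)} (+ suc d-1) (ℤ.≤-<-trans z*d≤n (n<s[n/ℕd]*d n (suc d-1))))))

  ceiling-≤ : ∀ p z → ↥ p ℤ.≤ z * ↧ p → ceiling p ℤ.≤ z
  ceiling-≤ p@record{} z n≤z*d = subst (- floor (ℚ.- p) ℤ.≤_) (ℤ.neg-involutive z)
    (ℤ.neg-mono-≤ (≤-floor (ℚ.- p) (- z) (begin
      - z * ↧ (ℚ.- p)   ≡⟨ cong (- z *_) (ℚ.↧-neg p) ⟩
      - z * ↧ p         ≡⟨ ℤ.neg-distribˡ-* z (↧ p) ⟨
      - (z * ↧ p)       ≤⟨ ℤ.neg-mono-≤ n≤z*d ⟩
      - ↥ p             ≡⟨ ℚ.↥-neg p ⟨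
      ↥ (ℚ.- p)         ∎)))
    where open ℤ.≤-Reasoning

  -- Reducing to lowest terms hides numerator and denominator, so the bound is tested on any
  -- unreduced fraction of the same value.
  ceiling-≤ᵘ : ∀ p q z → toℚᵘ p ≃ q → ℚᵘ.↥ q ℤ.≤ z * ℚᵘ.↧ q → ceiling p ℤ.≤ z
  ceiling-≤ᵘ p@record{} q@record{} z (*≡* e) n≤z*d = ceiling-≤ p z (ℤ.*-cancelʳ-≤-pos (↥ p) (z * ↧ p) (ℚᵘ.↧ q) (begin
    ↥ p * ℚᵘ.↧ q          ≡⟨ e ⟩
    ℚᵘ.↥ q * ↧ p          ≤⟨ ℤ.*-monoʳ-≤-nonNeg (↧ p) n≤z*d ⟩
    z * ℚᵘ.↧ q * ↧ p      ≡⟨ swap z (ℚᵘ.↧ q) (↧ p) ⟩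
    z * ↧ p * ℚᵘ.↧ q      ∎))
    where
    open ℤ.≤-Reasoning
    swap : ∀ x y z → x * y * z ≡ x * z * y
    swap = solve-∀

  toℚᵘ-/ : ∀ i n .{{_ : NonZero n}} → toℚᵘ (i ℚ./ n) ≃ i ℚᵘ./ n
  toℚᵘ-/ i (suc n) = ℚ.toℚᵘ-fromℚᵘ (mkℚᵘ i n)

  -- The hypothesis has the shape, factors 1 included, to which unreduced addition and
  -- multiplication of these fractions compute.
  ceiling-bound : ∀ i j k z g n .{{_ : NonZero g}} .{{_ : NonZero n}} →
    (i * + 2 + j * + g) * + 1 + k * + (g ℕ.* 2) ℤ.≤ z * (+ (g ℕ.* 2 ℕ.* 1 ℕ.* n)) →
    ceiling (((i ℚ./ g) ℚ.+ (j ℚ./ 2) ℚ.+ (k ℚ./ 1)) ℚ.* (+ 1 ℚ./ n)) ℤ.≤ z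
  ceiling-bound i j k z g@(suc _) n@(suc _) bound = ceiling-≤ᵘ _ q z
    (ℚᵘ.≃-trans (ℚ.toℚᵘ-homo-* (a ℚ.+ b ℚ.+ c) (+ 1 ℚ./ n)) (ℚᵘ.*-cong
      (ℚᵘ.≃-trans (ℚ.toℚᵘ-homo-+ (a ℚ.+ b) c) (ℚᵘ.+-cong
        (ℚᵘ.≃-trans (ℚ.toℚᵘ-homo-+ a b) (ℚᵘ.+-cong (toℚᵘ-/ i g) (toℚᵘ-/ j 2)))
        (toℚᵘ-/ k 1)))
      (toℚᵘ-/ (+ 1) n)))
    (subst (ℤ._≤ z * ℚᵘ.↧ q) (≡.sym (ℤ.*-identityʳ _)) bound)
    where
    a = i ℚ./ g
    b = j ℚ./ 2
    c = k ℚ./ 1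
    q = ((i ℚᵘ./ g) ℚᵘ.+ (j ℚᵘ./ 2) ℚᵘ.+ (k ℚᵘ./ 1)) ℚᵘ.* (+ 1 ℚᵘ./ n)

-- Assembly of the bound on G.

open import Data.Nat.Divisibility using (divides)
open import Data.Integer as ℤ using (ℤ; +_)
open import Data.Rational as ℚ using (ℚ; ceiling)
open import Relation.Binary.PropositionalEquality using (_≡_)
open import Data.List using (upTo)
open import Data.List.Properties using (length-upTo)
open import Data.List.Membership.Propositional.Properties using (∈-upTo⁻)
open import Relation.Binary.PropositionalEquality as ≡ using (refl; cong; cong₂; subst; _≢_)
open Congruences
open SidonSets
open Existence
open Rulers
open Ceilings

sidon⇒congruence : ∀ {v s} {D : ℕ → ℕ} → Sidon v s D → ∀ {i j k l} →
  i ∈ upTo s → j ∈ upTo s → k ∈ upTo s → l ∈ upTo s → i ≢ j →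
  Congruence._≅_ v (+ D j ℤ.- + D i) (+ D l ℤ.- + D k) → i ≡ k × j ≡ l
sidon⇒congruence {v} {s} {D} sidon {i} {j} {k} {l} i∈ j∈ k∈ l∈ i≢j e =
  sidon i j k l (∈-upTo⁻ i∈) (∈-upTo⁻ j∈) (∈-upTo⁻ k∈) (∈-upTo⁻ l∈) i≢j (congruent (≅⇒ℕ sums))
  where
  open Congruence v
  regroup : ∀ a b c d → (a ℤ.- b) ℤ.- (c ℤ.- d) ≡ (d ℤ.+ a) ℤ.- (b ℤ.+ c)
  regroup = solve-∀
  sums : + (D i ℕ.+ D l) ≅ + (D k ℕ.+ D j)
  sums = ≅-sym (≅-from e (≡.trans (regroup (+ D j) (+ D i) (+ D l) (+ D k))
    (≡.sym (cong₂ ℤ._-_ (ℤ.pos-+ (D k) (D j)) (ℤ.pos-+ (D i) (D l))))))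
  congruent : ∀ {a b} → (∃ λ k → a ≡ b ℕ.+ k ℕ.* v) ⊎ (∃ λ k → b ≡ a ℕ.+ k ℕ.* v) → Congruent v a b
  congruent {a} {b} (inj₁ (k , e)) = 0 , k , ≡.trans (cong (ℕ._+ a) (ℕ.*-zeroʳ v))
    (≡.trans e (≡.trans (ℕ.+-comm b (k ℕ.* v)) (cong (ℕ._+ b) (ℕ.*-comm k v))))
  congruent {a} {b} (inj₂ (k , e)) = k , 0 , ≡.sym (≡.trans (cong (ℕ._+ b) (ℕ.*-zeroʳ v))
    (≡.trans e (≡.trans (ℕ.+-comm a (k ℕ.* v)) (cong (ℕ._+ a) (ℕ.*-comm k v)))))

modular-ruler : ∀ q g m n .{{_ : NonZero g}} .{{_ : NonZero n}} → PrimePower q →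
  q ℕ.^ 2 ℕ.+ q ℕ.+ 1 ≡ m ℕ.* g → n ℕ.+ g ℕ./ 2 ℕ.≤ q ℕ.+ 1 →
  WideGapRuler g m n
modular-ruler q g zero n pp v≡ _ with () ← ≡.trans (ℕ.+-comm 1 (q ℕ.^ 2 ℕ.+ q)) v≡
modular-ruler q g m@(suc _) n pp v≡ n≤ = from-sidon (singer q (g ℕ.* m) pp (≡.trans (ℕ.*-comm g m) (≡.sym v≡)))
  where
  from-sidon : (∃ λ D → Sidon (g ℕ.* m) (suc q) D) → WideGapRuler g m n
  from-sidon (D , sidon) = SidonSet.ruler g m (λ i → + D i) (upTo (suc q)) (Unique.upTo⁺ (suc q))
    (λ {i} {j} {k} {l} → sidon⇒congruence {D = D} sidon {i} {j} {k} {l}) n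
    (subst (n ℕ.+ g ℕ./ 2 ℕ.≤_) (≡.trans (ℕ.+-comm q 1) (≡.sym (length-upTo (suc q)))) n≤)

-- A negative a together with r < g would force n ≤ 0. The gap bound is stated for natural a,
-- whereas the theorem takes an integer.
nonneg-quotient : ∀ {n g} a r .{{_ : NonZero n}} → + n ≡ a ℤ.* + g ℤ.+ r → r ℤ.< + g → ∃ λ a′ → a ≡ + a′
nonneg-quotient (+ a) r _ _ = a , refl
nonneg-quotient {n} {g} ℤ.-[1+ a ] r e r<g = ⊥-elim (ℤ.<⇒≱ (ℤ.+<+ (ℕ.>-nonZero⁻¹ n)) (begin
  + n                             ≡⟨ e ⟩
  ℤ.-[1+ a ] ℤ.* + g ℤ.+ r        ≤⟨ ℤ.+-monoʳ-≤ (ℤ.-[1+ a ] ℤ.* + g) (ℤ.<⇒≤ r<g) ⟩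
  ℤ.-[1+ a ] ℤ.* + g ℤ.+ + g      ≡⟨ collect (+ a) (+ g) ⟩
  ℤ.- (+ a ℤ.* + g)               ≡⟨ cong ℤ.-_ (ℤ.pos-* a g) ⟨
  ℤ.- (+ (a ℕ.* g))               ≤⟨ ℤ.neg-mono-≤ (ℤ.+≤+ z≤n) ⟩
  + 0                             ∎))
  where
  open ℤ.≤-Reasoning
  collect : ∀ a g → ℤ.- (+ 1 ℤ.+ a) ℤ.* g ℤ.+ g ≡ ℤ.- (a ℤ.* g)
  collect = solve-∀

-- Substituting n = a g + r gives 2 n a - g a (a + 1) = g a (a - 1) + 2 r a; the remaining factor g
-- clears the denominator of v/g.
numerator-bound : ∀ g n m L a r → + n ≡ + a ℤ.* + g ℤ.+ r →
  2 ℕ.* m ℕ.+ 2 ℕ.* (n ℕ.* a) ℕ.≤ 2 ℕ.* (n ℕ.* L) ℕ.+ g ℕ.* (a ℕ.* suc a) →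
  (+ (m ℕ.* g) ℤ.* + 2 ℤ.+ + g ℤ.* + a ℤ.* (+ a ℤ.- + 1) ℤ.* + g) ℤ.* + 1 ℤ.+ r ℤ.* + a ℤ.* + (g ℕ.* 2)
    ℤ.≤ + L ℤ.* + (g ℕ.* 2 ℕ.* 1 ℕ.* n)
numerator-bound g n m L a r n≡ bound = begin
  (+ (m ℕ.* g) ℤ.* + 2 ℤ.+ + g ℤ.* + a ℤ.* (+ a ℤ.- + 1) ℤ.* + g) ℤ.* + 1 ℤ.+ r ℤ.* + a ℤ.* + (g ℕ.* 2)
    ≡⟨ cong₂ (λ y z → (y ℤ.* + 2 ℤ.+ + g ℤ.* + a ℤ.* (+ a ℤ.- + 1) ℤ.* + g) ℤ.* + 1 ℤ.+ r ℤ.* + a ℤ.* z)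
         (ℤ.pos-* m g) (ℤ.pos-* g 2) ⟩
  (+ m ℤ.* + g ℤ.* + 2 ℤ.+ + g ℤ.* + a ℤ.* (+ a ℤ.- + 1) ℤ.* + g) ℤ.* + 1 ℤ.+ r ℤ.* + a ℤ.* (+ g ℤ.* + 2)
    ≡⟨ collect-left (+ m) (+ g) (+ a) r ⟩
  + g ℤ.* (+ 2 ℤ.* + m ℤ.+ + 2 ℤ.* ((+ a ℤ.* + g ℤ.+ r) ℤ.* + a) ℤ.- + g ℤ.* (+ a ℤ.* (+ 1 ℤ.+ + a)))
    ≡⟨ cong (λ y → + g ℤ.* (y ℤ.- + g ℤ.* (+ a ℤ.* (+ 1 ℤ.+ + a)))) left ⟨
  + g ℤ.* (+ (2 ℕ.* m ℕ.+ 2 ℕ.* (n ℕ.* a)) ℤ.- + g ℤ.* (+ a ℤ.* (+ 1 ℤ.+ + a)))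
    ≤⟨ ℤ.*-monoˡ-≤-nonNeg (+ g) (ℤ.+-monoˡ-≤ (ℤ.- (+ g ℤ.* (+ a ℤ.* (+ 1 ℤ.+ + a)))) (ℤ.+≤+ bound)) ⟩
  + g ℤ.* (+ (2 ℕ.* (n ℕ.* L) ℕ.+ g ℕ.* (a ℕ.* suc a)) ℤ.- + g ℤ.* (+ a ℤ.* (+ 1 ℤ.+ + a)))
    ≡⟨ cong (λ y → + g ℤ.* (y ℤ.- + g ℤ.* (+ a ℤ.* (+ 1 ℤ.+ + a)))) right ⟩
  + g ℤ.* (+ 2 ℤ.* (+ n ℤ.* + L) ℤ.+ + g ℤ.* (+ a ℤ.* (+ 1 ℤ.+ + a)) ℤ.- + g ℤ.* (+ a ℤ.* (+ 1 ℤ.+ + a)))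
    ≡⟨ collect-right (+ g) (+ n) (+ L) (+ g ℤ.* (+ a ℤ.* (+ 1 ℤ.+ + a))) ⟩
  + L ℤ.* (+ g ℤ.* + 2 ℤ.* + 1 ℤ.* + n)
    ≡⟨ cong (+ L ℤ.*_) denominator ⟨
  + L ℤ.* + (g ℕ.* 2 ℕ.* 1 ℕ.* n) ∎
  where
  open ℤ.≤-Reasoning
  collect-left : ∀ m g a r → (m ℤ.* g ℤ.* + 2 ℤ.+ g ℤ.* a ℤ.* (a ℤ.- + 1) ℤ.* g) ℤ.* + 1 ℤ.+ r ℤ.* a ℤ.* (g ℤ.* + 2) ≡
    g ℤ.* (+ 2 ℤ.* m ℤ.+ + 2 ℤ.* ((a ℤ.* g ℤ.+ r) ℤ.* a) ℤ.- g ℤ.* (a ℤ.* (+ 1 ℤ.+ a)))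
  collect-left = solve-∀
  collect-right : ∀ g n L c → g ℤ.* (+ 2 ℤ.* (n ℤ.* L) ℤ.+ c ℤ.- c) ≡ L ℤ.* (g ℤ.* + 2 ℤ.* + 1 ℤ.* n)
  collect-right = solve-∀
  double : ∀ i j → + (2 ℕ.* (i ℕ.* j)) ≡ + 2 ℤ.* (+ i ℤ.* + j)
  double i j = ≡.trans (ℤ.pos-* 2 (i ℕ.* j)) (cong (+ 2 ℤ.*_) (ℤ.pos-* i j))
  left : + (2 ℕ.* m ℕ.+ 2 ℕ.* (n ℕ.* a)) ≡ + 2 ℤ.* + m ℤ.+ + 2 ℤ.* ((+ a ℤ.* + g ℤ.+ r) ℤ.* + a)
  left = ≡.trans (ℤ.pos-+ (2 ℕ.* m) (2 ℕ.* (n ℕ.* a))) (cong₂ ℤ._+_ (ℤ.pos-* 2 m)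
    (≡.trans (double n a) (cong (λ y → + 2 ℤ.* (y ℤ.* + a)) n≡)))
  right : + (2 ℕ.* (n ℕ.* L) ℕ.+ g ℕ.* (a ℕ.* suc a)) ≡ + 2 ℤ.* (+ n ℤ.* + L) ℤ.+ + g ℤ.* (+ a ℤ.* (+ 1 ℤ.+ + a))
  right = ≡.trans (ℤ.pos-+ (2 ℕ.* (n ℕ.* L)) (g ℕ.* (a ℕ.* suc a))) (cong₂ ℤ._+_ (double n L)
    (≡.trans (ℤ.pos-* g (a ℕ.* suc a)) (cong (+ g ℤ.*_) (ℤ.pos-* a (suc a)))))
  denominator : + (g ℕ.* 2 ℕ.* 1 ℕ.* n) ≡ + g ℤ.* + 2 ℤ.* + 1 ℤ.* + n
  denominator = ≡.trans (ℤ.pos-* (g ℕ.* 2 ℕ.* 1) n) (cong (ℤ._* + n) (≡.trans (ℤ.pos-* (g ℕ.* 2) 1)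
    (cong (ℤ._* + 1) (ℤ.pos-* g 2))))

theorem7 : (q g n : ℕ) .{{_ : NonZero g}} .{{_ : NonZero n}} →
    PrimePower q →
    g ∣ (q ℕ.^ 2 ℕ.+ q ℕ.+ 1) →
    + n ℤ.≤ + (q ℕ.+ 1) ℤ.- + (g ℕ./ 2) →
    (a r : ℤ) →
    + n ≡ a ℤ.* + g ℤ.+ r →
    + 0 ℤ.≤ r →
    r ℤ.< + g →
    + (G g n) ℤ.≤
    + ((q ℕ.^ 2 ℕ.+ q ℕ.+ 1) ℕ./ g) ℤ.-
    ceiling
    (((+ (q ℕ.^ 2 ℕ.+ q ℕ.+ 1) ℚ./ g)
    ℚ.+ ((+ g ℤ.* a ℤ.* (a ℤ.- + 1)) ℚ./ 2)
    ℚ.+ ((r ℤ.* a) ℚ./ 1))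
    ℚ.* (+ 1 ℚ./ n))
theorem7 q g n pp (divides m v≡) n≤ a r n≡ 0≤r r<g
  with nonneg-quotient a r n≡ r<g | modular-ruler q g m n pp v≡ marks≤
  where
  restore : ∀ i j → i ℤ.- j ℤ.+ j ≡ i
  restore = solve-∀
  marks≤ : n ℕ.+ g ℕ./ 2 ℕ.≤ q ℕ.+ 1
  marks≤ = ℤ.drop‿+≤+ (begin
    + (n ℕ.+ g ℕ./ 2)                              ≡⟨ ℤ.pos-+ n (g ℕ./ 2) ⟩
    + n ℤ.+ + (g ℕ./ 2)                            ≤⟨ ℤ.+-monoˡ-≤ (+ (g ℕ./ 2)) n≤ ⟩
    + (q ℕ.+ 1) ℤ.- + (g ℕ./ 2) ℤ.+ + (g ℕ./ 2)    ≡⟨ restore (+ (q ℕ.+ 1)) (+ (g ℕ./ 2)) ⟩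
    + (q ℕ.+ 1)                                    ∎)
    where open ℤ.≤-Reasoning
... | a′ , refl | L , L≤m , ruler , bound = begin
  + G g n                 ≤⟨ ℤ.+≤+ (proj₂ (G-isLeast g n) (m ℕ.∸ L) ruler) ⟩
  + (m ℕ.∸ L)             ≡⟨ ≡.trans (≡.sym (ℤ.⊖-≥ L≤m)) (≡.sym (ℤ.m-n≡m⊖n m L)) ⟩
  -- The gap bound holds for every natural number; a′ is the quotient of n by g, the value at which
  -- it is strongest.
  + m ℤ.- + L             ≤⟨ ℤ.+-monoʳ-≤ (+ m) (ℤ.neg-mono-≤ (ceiling-bound (+ (q ℕ.^ 2 ℕ.+ q ℕ.+ 1))
                               (+ g ℤ.* + a′ ℤ.* (+ a′ ℤ.- + 1)) (r ℤ.* + a′) (+ L) g n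
                               (subst (λ v → (+ v ℤ.* + 2 ℤ.+ + g ℤ.* + a′ ℤ.* (+ a′ ℤ.- + 1) ℤ.* + g) ℤ.* + 1
                                   ℤ.+ r ℤ.* + a′ ℤ.* + (g ℕ.* 2) ℤ.≤ + L ℤ.* + (g ℕ.* 2 ℕ.* 1 ℕ.* n))
                                 (≡.sym v≡) (numerator-bound g n m L a′ r n≡ (bound a′))))) ⟩
  + m ℤ.- X               ≡⟨ cong (λ k → + k ℤ.- X) (≡.trans (cong (ℕ._/ g) v≡) (ℕ.m*n/n≡m m g)) ⟨
  + ((q ℕ.^ 2 ℕ.+ q ℕ.+ 1) ℕ./ g) ℤ.- X ∎
  where
  open ℤ.≤-Reasoning
  X = ceiling
    (((+ (q ℕ.^ 2 ℕ.+ q ℕ.+ 1) ℚ./ g)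
    ℚ.+ ((+ g ℤ.* + a′ ℤ.* (+ a′ ℤ.- + 1)) ℚ./ 2)
    ℚ.+ ((r ℤ.* + a′) ℚ./ 1))
    ℚ.* (+ 1 ℚ./ n))
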